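{- Let $m\ge1$. The free $\mathrm{Dyck}^m$ algebra on one generator is isomorphic to $(\mathbb K[\mathrm{Dyck}^m],*_0,\dots,*_m)$; more precisely, the unique $\mathrm{Dyck}^m$ algebra morphism from the free $\mathrm{Dyck}^m$ algebra on a generator $a$ to $\mathbb K[\mathrm{Dyck}^m]$ sending $a$ to the unique $m$-Dyck path $\rho_m$ of size $1$ is an isomorphism.
   Context: A $\mathrm{Dyck}^m$ algebra over a field $\mathbb K$ is a vector space $D$ with bilinear operations $*_0,\dots,*_m$ such that $x*_i(y*_jz)=(x*_iy)*_jz$ for $0\le i<j\le m$ and $\sum_{j=0}^ix*_i(y*_jz)=\sum_{k=i}^m(x*_ky)*_iz$ for $0\le i\le m$. An $m$-Dyck path of size $n\ge1$: lattice path from $(0,0)$ to $(2nm,0)$ with $n$ up steps $(m,m)$ and $nm$ down steps $(1,-1)$, never below the $x$-axis; $\mathbb K[\mathrm{Dyck}^m]$ has basis all such paths of positive size. Up steps are ranked $1,\dots,n$; a down step is at level $k$ if the last preceding up step has rank $k$; $L(P)$ = number of level-$n$ down steps, listed $d^P_1,\dots,d^P_{L(P)}$. $P\times_jQ$ ($0\le j\le L(P)$): delete the last $j$ down steps of $P$, append a translate of $Q$, append $j$ down steps. Prime: not $A\times_0B$ with $A,B$ of smaller positive size; each path is uniquely $Q_1\times_0\cdots\times_0Q_r$, $Q_j$ prime. Coloring $\alpha_P(d)$: rank of the first up step met by the leftward horizontal half-line from the midpoint of $d$. $\Lambda^i_r(P)$: weak compositions $(\lambda_0,\dots,\lambda_r)$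 of $L(P)$ such that in $\alpha_P(d^P_{L(P)-\lambda_r+1})\cdots\alpha_P(d^P_{L(P)})$ every integer appears at most $i$ times and some integer exactly $i$ times. For $Q=Q_1\times_0\cdots\times_0Q_r$, $P*_{\underline\lambda}Q:=((\cdots(P\times_{\lambda_1+\dots+\lambda_r}Q_1)\cdots)\times_{\lambda_r}Q_r)$, $P*_iQ:=\sum_{\underline\lambda\in\Lambda^i_r(P)}P*_{\underline\lambda}Q$, extended bilinearly; with these operations $\mathbb K[\mathrm{Dyck}^m]$ is a $\mathrm{Dyck}^m$ algebra. -}

module Defs where

open import Level using (Level; _⊔_) renaming (suc to lsuc)
open import Data.Nat using (ℕ; zero; suc; _∸_) renaming (_+_ to _+ℕ_)
open import Data.Nat using (_≤_; _<_; _≡ᵇ_; _≤ᵇ_)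
open import Data.Nat.Properties using (_≤?_)
open import Data.Bool using (Bool; true; false; _∧_; _∨_; if_then_else_)
open import Data.Fin using (Fin; toℕ)
open import Data.List using (List; []; _∷_; _++_; map; concatMap; length; reverse; replicate; take; drop; filter; foldr; upTo; allFin)
open import Data.Nat.ListAction using (sum)
open import Data.Bool.ListAction using (all; any)
open import Data.Product using (Σ; _×_; _,_)
open import Relation.Nullary using (¬_)
open import Algebra.Bundles using (CommutativeRing)
open import Algebra.Module.Bundles using (Module)

record Field c ℓ : Set (lsuc (c ⊔ ℓ)) where
  field
    commutativeRing : CommutativeRing c ℓ
  open CommutativeRing commutativeRing public
  field
    0≉1     : ¬ (0# ≈ 1#)
    inverse : ∀ x → ¬ (x ≈ 0#) → Σ Carrier λ y → x * y ≈ 1#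

record DyckAlgebra {c ℓ} (K : Field c ℓ) (m : ℕ) c' ℓ' : Set (c ⊔ ℓ ⊔ lsuc (c' ⊔ ℓ')) where
  open Field K using (commutativeRing) renaming (Carrier to Scalar)
  field
    vectorSpace : Module commutativeRing c' ℓ'
  open Module vectorSpace public
  field
    op : Fin (suc m) → Carrierᴹ → Carrierᴹ → Carrierᴹ

  ∑ : List Carrierᴹ → Carrierᴹ
  ∑ = foldr _+ᴹ_ 0ᴹ

  field
    op-cong  : ∀ i {x x' y y'} → x ≈ᴹ x' → y ≈ᴹ y' → op i x y ≈ᴹ op i x' y'
    op-+ˡ    : ∀ i x x' y → op i (x +ᴹ x') y ≈ᴹ op i x y +ᴹ op i x' y
    op-+ʳ    : ∀ i x y y' → op i x (y +ᴹ y') ≈ᴹ op i x y +ᴹ op i x y'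
    op-*ₗˡ   : ∀ i (a : Scalar) x y → op i (a *ₗ x) y ≈ᴹ a *ₗ op i x y
    op-*ₗʳ   : ∀ i (a : Scalar) x y → op i x (a *ₗ y) ≈ᴹ a *ₗ op i x y
    dyck-assoc : ∀ (i j : Fin (suc m)) → toℕ i < toℕ j → ∀ x y z →
                 op i x (op j y z) ≈ᴹ op j (op i x y) z
    dyck-sum : ∀ (i : Fin (suc m)) x y z →
               ∑ (map (λ j → op i x (op j y z))
                      (filter (λ j → toℕ j ≤? toℕ i) (allFin (suc m))))
               ≈ᴹ
               ∑ (map (λ k → op i (op k x y) z)
                      (filter (λ k → toℕ i ≤? toℕ k) (allFin (suc m))))

-- m-Dyck paths, encoded as words in up steps U = (m,m) and down steps
-- D = (1,-1).

data Step : Set where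
  U D : Step

isD : Step → Bool
isD U = false
isD D = true

walkOK : ℕ → ℕ → List Step → Bool
walkOK m h []             = h ≡ᵇ 0
walkOK m h (U ∷ xs)       = walkOK m (h +ℕ m) xs
walkOK m zero (D ∷ xs)    = false
walkOK m (suc h) (D ∷ xs) = walkOK m h xs

-- an m-Dyck path of positive size (nonempty word; since m ≥ 1 it then has
-- at least one up step)
IsDyck : ℕ → List Step → Bool
IsDyck m []       = false
IsDyck m (x ∷ xs) = walkOK m 0 (x ∷ xs)

ρ : ℕ → List Step
ρ m = U ∷ replicate m D

-- L(P): number of down steps of level n (= the down steps after the
-- last up step, i.e. the trailing down steps)
trailingDs : List Step → ℕ
trailingDs xs = go (reverse xs)
  where
  go : List Step → ℕ
  go []       = 0
  go (U ∷ _)  = 0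
  go (D ∷ ys) = suc (go ys)

L : List Step → ℕ
L = trailingDs

cross : ℕ → List Step → List Step → List Step
cross j P Q = take (length P ∸ j) P ++ Q ++ replicate j D

primes : ℕ → List Step → List (List Step)
primes m = go 0 []
  where
  go : ℕ → List Step → List Step → List (List Step)
  go h acc [] with acc
  ... | []    = []
  ... | _ ∷ _ = reverse acc ∷ []
  go h acc (U ∷ xs)             = go (h +ℕ m) (U ∷ acc) xs
  go (suc zero) acc (D ∷ xs)    = reverse (D ∷ acc) ∷ go 0 [] xs
  go (suc (suc h)) acc (D ∷ xs) = go (suc h) (D ∷ acc) xs
  go zero acc (D ∷ xs)          = go 0 (D ∷ acc) xs   -- not reached for Dyck paths

-- coloring α_P of the down steps (listed left to right).  A down step from
-- height h+1 to h has midpoint at height h + 1/2; the first up step met by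
-- the leftward half-line is the nearest preceding up step from height a to
-- a + m with a ≤ h < a + m.  We record preceding up steps as (rank, a),
-- most recent first.
findColor : ℕ → ℕ → List (ℕ × ℕ) → ℕ
findColor m h []             = 0
findColor m h ((r , a) ∷ us) =
  if (a ≤ᵇ h) ∧ (suc h ≤ᵇ a +ℕ m) then r else findColor m h us

colors : ℕ → List Step → List ℕ
colors m = go 1 0 []
  where
  go : ℕ → ℕ → List (ℕ × ℕ) → List Step → List ℕ
  go r h us []       = []
  go r h us (U ∷ xs) = go (suc r) (h +ℕ m) ((r , h) ∷ us) xs
  go r h us (D ∷ xs) = findColor m (h ∸ 1) us ∷ go r (h ∸ 1) us xs

lastColors : ℕ → List Step → ℕ → List ℕ
lastColors m P λr = let cs = colors m P in drop (length cs ∸ λr) cs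

count : ℕ → List ℕ → ℕ
count c []       = 0
count c (x ∷ xs) = (if c ≡ᵇ x then 1 else 0) +ℕ count c xs

-- every integer appears at most i times, and some integer appears exactly
-- i times (for i = 0 the latter holds trivially: pick an absent integer)
multCond : ℕ → List ℕ → Bool
multCond i w = all (λ c → count c w ≤ᵇ i) w ∧ ((i ≡ᵇ 0) ∨ any (λ c → count c w ≡ᵇ i) w)

weakComps : ℕ → ℕ → List (List ℕ)
weakComps zero n with n
... | zero  = [] ∷ []
... | suc _ = []
weakComps (suc zero) n = (n ∷ []) ∷ []
weakComps (suc (suc k)) n =
  concatMap (λ a → map (a ∷_) (weakComps (suc k) (n ∸ a))) (upTo (suc n))

lastOr0 : List ℕ → ℕ
lastOr0 []           = 0
lastOr0 (x ∷ [])     = x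
lastOr0 (x ∷ y ∷ ys) = lastOr0 (y ∷ ys)

tail : List ℕ → List ℕ
tail []       = []
tail (_ ∷ xs) = xs

applyComp : List Step → List (List Step) → List ℕ → List Step
applyComp R []       ls = R
applyComp R (Q ∷ Qs) ls = applyComp (cross (sum ls) R Q) Qs (tail ls)

-- P *_i Q as a formal sum (list of paths, each with coefficient 1),
-- summed over Λ^i_r(P)
mult : ℕ → ℕ → List Step → List Step → List (List Step)
mult m i P Q =
  let Qs = primes m Q
      r  = length Qs
  in map (λ ls → applyComp P Qs (tail ls))
         (filter (λ ls → Data.Bool._≟_ (multCond i (lastColors m P (lastOr0 ls))) true)
                 (weakComps (suc r) (L P)))

multR : ℕ → ℕ → List Step → List (List Step) → List (List Step)
multR m i P Qs = concatMap (mult m i P) Qs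

multL : ℕ → ℕ → List (List Step) → List Step → List (List Step)
multL m i Ps Q = concatMap (λ P → mult m i P Q) Ps

-- Equality of formal sums in K[Dyck^m] with coefficients 1: for each path
-- T, the coefficients (multiplicity of T, as an element of K) agree.

listEq : List Step → List Step → Bool
listEq []       []       = true
listEq (U ∷ xs) (U ∷ ys) = listEq xs ys
listEq (D ∷ xs) (D ∷ ys) = listEq xs ys
listEq _        _        = false

multiplicity : List Step → List (List Step) → ℕ
multiplicity T []       = 0
multiplicity T (P ∷ Ps) = (if listEq T P then 1 else 0) +ℕ multiplicity T Ps

module _ {c ℓ} (K : Field c ℓ) where
  open Field K

  ℕ→K : ℕ → Carrier
  ℕ→K zero    = 0#
  ℕ→K (suc n) = 1# + ℕ→K n

  _≈F_ : List (List Step) → List (List Step) → Set ℓ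
  A ≈F B = ∀ T → ℕ→K (multiplicity T A) ≈ ℕ→K (multiplicity T B)

-- (K[Dyck^m], *_0, …, *_m) satisfies the Dyck^m algebra identities.
-- By bilinearity it suffices (and is necessary) that they hold on basis
-- elements (m-Dyck paths P, Q, R), as equalities of formal sums.

open import Data.Bool using (T)

KDyckIdentities : ∀ {c ℓ} → Field c ℓ → ℕ → Set ℓ
KDyckIdentities K m =
  (∀ (i j : Fin (suc m)) → toℕ i < toℕ j → ∀ P Q R →
     T (IsDyck m P) → T (IsDyck m Q) → T (IsDyck m R) →
     _≈F_ K (multR m (toℕ i) P (mult m (toℕ j) Q R))
            (multL m (toℕ j) (mult m (toℕ i) P Q) R))
  ×
  (∀ (i : Fin (suc m)) → ∀ P Q R →
     T (IsDyck m P) → T (IsDyck m Q) → T (IsDyck m R) →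
     _≈F_ K (concatMap (λ j → multR m (toℕ i) P (mult m (toℕ j) Q R))
                       (filter (λ j → toℕ j ≤? toℕ i) (allFin (suc m))))
            (concatMap (λ k → multL m (toℕ i) (mult m (toℕ k) P Q) R)
                       (filter (λ k → toℕ i ≤? toℕ k) (allFin (suc m)))))

-- Linear maps K[Dyck^m] → D correspond to functions f on paths (values on
-- non-paths are irrelevant).  Such a linear map is a Dyck^m algebra
-- morphism iff on basis elements  f̂(P *_i Q) = f(P) *_i f(Q), where f̂ is
-- the linear extension (a sum, since all coefficients are 1).

module _ {c ℓ c' ℓ'} {K : Field c ℓ} {m : ℕ} (D : DyckAlgebra K m c' ℓ') where
  open DyckAlgebra D

  IsDyckMorphism : (List Step → Carrierᴹ) → Set ℓ'
  IsDyckMorphism f =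
    ∀ (i : Fin (suc m)) P Q → T (IsDyck m P) → T (IsDyck m Q) →
      ∑ (map f (mult m (toℕ i) P Q)) ≈ᴹ op i (f P) (f Q)

{-# OPTIONS --safe #-}
module Submission where

-- A path U P_m D P_(m-1) D ... D P_0 is the tree with the (possibly empty) slots P_m, ..., P_0;
-- write u ∘_k y for the tree u, whose slots k, ..., 0 are empty, with y put into slot k.  In terms
-- of ∘_k the products obey three rules, where low(u) is the index of the last filled slot:
--   (u ∘_k y) *_i z = u ∘_k (y *_i z)              for i > k,
--   (u ∘_k y) *_k z = u ∘_k (Σ_(j≤k) y *_j z),
--   u *_i z = Σ_(z = z'z'') (Σ_(j>i) u *_j z') ∘_i z''   for low(u) > i, z' possibly empty.
-- All Dyck identities for a triple u, q, r are the single equality of tagged formal sums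
--   Σ_(i,j) [i , max(i,j)] u *_i (q *_j r) = Σ_(i,j) [min(i,j) , j] (u *_i q) *_j r,
-- which follows from the three rules by induction on u.  Freeness: the third rule, solved for its
-- term with empty z', defines recursively what u ∘_k z must be sent to in a Dyck algebra A,
-- and the identities of A show that the map so defined respects the first two rules as well.

-- The obstacle is that `∘_k` is not an operation of a Dyck algebra: the target of a morphism only
-- offers the products, so the value of a graft has to be recovered by a subtraction. That recursion
-- passes through values of partial trees, which is why trees with some slots not yet reached are
-- kept as a family of their own. Their products are recorded for i ≥ k only, because these leave
-- the slots below k empty.
--
-- The first two rules together say that a term of y *_j z, grafted into slot k, gets the tag max(k,
-- j). This merges all tags j ≤ k, so a single Dyck identity for y does not carry over to u ∘_k y by
-- itself. The tagged equality does carry over, because max is associative and distributes over min;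
-- it loses nothing, because its tags (a, b) satisfy a ≤ b on both sides.
--
-- Identities of formal sums are stated as equalities of sums of an arbitrary function with values
-- in an arbitrary commutative monoid. With values in the natural numbers they compare
-- multiplicities of paths; with values in the target algebra they compute evaluations.

open import Defs
open import Algebra.Bundles using (AbelianGroup; CommutativeMonoid)
open import Algebra.Module.Bundles using (Module)
import Algebra.Properties.AbelianGroup as AbelianGroupProperties
open import Data.Bool as Bool using (Bool; true; false; T; if_then_else_; _∧_)
import Data.Bool.ListAction as BoolList
open import Data.Bool.Properties using (T-≡; T-∧; T-∨)
open import Data.Empty using (⊥-elim)
open import Data.Fin using (Fin; zero; suc; toℕ; fromℕ<)
import Data.Fin.Properties as Fin
open import Data.List using (List; []; _∷_; _++_; _ʳ++_; map; concat; concatMap; filter; foldr; replicate; tabulate; allFin; applyUpTo; upTo; reverse; take; drop; length)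
open import Data.List.Membership.Propositional using (_∈_; lose)
open import Data.List.Properties using (++-assoc; ++-identityʳ; reverse-++; length-++; length-replicate; ++-ʳ++; reverse-involutive)
open import Data.List.Relation.Unary.All as All using (All; []; _∷_)
import Data.List.Relation.Unary.All.Properties as All
open import Data.List.Relation.Unary.Any as Any using (here; there)
import Data.List.Relation.Unary.Any.Properties as Any
open import Data.Maybe using (Maybe; just; nothing; maybe′)
open import Data.Nat using (ℕ; zero; suc; _+_; _∸_; _⊔_; _⊓_; _≤_; _<_; _≤ᵇ_; _<ᵇ_; _≡ᵇ_; z≤n; s≤s)
open import Data.Nat.ListAction using (sum)
open import Data.Nat.Properties as ℕ using (≤-refl; ≤-trans; _≤?_)
open import Data.Product using (Σ; ∃; _×_; _,_; proj₁; proj₂)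
open import Data.Sum using (_⊎_; inj₁; inj₂)
open import Function using (_∘_; _∋_; Equivalence)
open import Relation.Binary.PropositionalEquality as ≡ using (_≡_; refl; cong; cong₂; sym; trans; subst; module ≡-Reasoning)
open import Relation.Nullary using (Dec; ¬_; yes; no; does)
open import Relation.Unary using (Pred; Decidable)

-- The local functions of Defs

leadingDs : List Step → ℕ
leadingDs [] = 0
leadingDs (U ∷ _) = 0
leadingDs (D ∷ w) = suc (leadingDs w)

-- Each signature below with `_` is solved by the corresponding local function of Defs, which has no
-- name outside: the `with` at its point of use turns the arguments of that function into variables.

trailingDs-reverse : ∀ w → trailingDs w ≡ leadingDs (reverse w)
private
  go≡leading : ∀ w v → _ ≡ leadingDs v

trailingDs-reverse w with reverse w
... | v = go≡leading w v
go≡leading w [] = refl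
go≡leading w (U ∷ v) = refl
go≡leading w (D ∷ v) = cong suc (go≡leading w v)

flush : List Step → List (List Step)
flush [] = []
flush acc@(_ ∷ _) = reverse acc ∷ []

splitPrimes : ℕ → ℕ → List Step → List Step → List (List Step)
splitPrimes m h acc [] = flush acc
splitPrimes m h acc (U ∷ xs)             = splitPrimes m (h + m) (U ∷ acc) xs
splitPrimes m (suc zero) acc (D ∷ xs)    = reverse (D ∷ acc) ∷ splitPrimes m 0 [] xs
splitPrimes m (suc (suc h)) acc (D ∷ xs) = splitPrimes m (suc h) (D ∷ acc) xs
splitPrimes m zero acc (D ∷ xs)          = splitPrimes m 0 (D ∷ acc) xs

primes-split : ∀ m w → primes m w ≡ splitPrimes m 0 [] w
private
  go≡split : ∀ m h acc w → _ ≡ splitPrimes m h acc w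
primes-split m w with (ℕ ∋ 0) | (List Step ∋ [])
... | h | acc = go≡split m h acc w
go≡split m h [] [] = refl
go≡split m h (x ∷ acc) [] = refl
go≡split m h acc (U ∷ w) = go≡split m (h + m) (U ∷ acc) w
go≡split m zero acc (D ∷ w) = go≡split m 0 (D ∷ acc) w
go≡split m (suc zero) acc (D ∷ w) = cong (reverse (D ∷ acc) ∷_) (go≡split m 0 [] w)
go≡split m (suc (suc h)) acc (D ∷ w) = go≡split m (suc h) (D ∷ acc) w

colorsFrom : ℕ → ℕ → ℕ → List (ℕ × ℕ) → List Step → List ℕ
colorsFrom m r h us []       = []
colorsFrom m r h us (U ∷ xs) = colorsFrom m (suc r) (h + m) ((r , h) ∷ us) xs
colorsFrom m r h us (D ∷ xs) = findColor m (h ∸ 1) us ∷ colorsFrom m r (h ∸ 1) us xs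

colors-from : ∀ m w → colors m w ≡ colorsFrom m 1 0 [] w
private
  go≡colorsFrom : ∀ m r h us w → _ ≡ colorsFrom m r h us w
colors-from m w with 1 | (ℕ ∋ 0) | (List (ℕ × ℕ) ∋ [])
... | r | h | us = go≡colorsFrom m r h us w
go≡colorsFrom m r h us [] = refl
go≡colorsFrom m r h us (U ∷ w) = go≡colorsFrom m (suc r) (h + m) ((r , h) ∷ us) w
go≡colorsFrom m r h us (D ∷ w) = cong (findColor m (h ∸ 1) us ∷_) (go≡colorsFrom m r (h ∸ 1) us w)

-- Finite sums in a commutative monoid

≡ᵇ-sym : ∀ i j → (i ≡ᵇ j) ≡ (j ≡ᵇ i)
≡ᵇ-sym zero    zero    = refl
≡ᵇ-sym zero    (suc j) = refl
≡ᵇ-sym (suc i) zero    = refl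
≡ᵇ-sym (suc i) (suc j) = ≡ᵇ-sym i j

module Summation {c ℓ} (M : CommutativeMonoid c ℓ) where

  open CommutativeMonoid M renaming (refl to ≈-refl; sym to ≈-sym; trans to ≈-trans)
  open import Relation.Binary.Reasoning.Setoid setoid
  open import Algebra.Properties.CommutativeSemigroup commutativeSemigroup using (interchange)

  ⨁ : ∀ {a} {A : Set a} → List A → (A → Carrier) → Carrier
  ⨁ []      h = ε
  ⨁ (x ∷ L) h = h x ∙ ⨁ L h

  when : Bool → Carrier → Carrier
  when b v = if b then v else ε

  module _ {a} {A : Set a} where

    ⨁-foldr : ∀ (L : List A) h → foldr _∙_ ε (map h L) ≈ ⨁ L h
    ⨁-foldr []      h = ≈-refl
    ⨁-foldr (x ∷ L) h = ∙-congˡ (⨁-foldr L h)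

    ⨁-cong-All : ∀ {L : List A} {f g} → All (λ x → f x ≈ g x) L → ⨁ L f ≈ ⨁ L g
    ⨁-cong-All []       = ≈-refl
    ⨁-cong-All (p ∷ ps) = ∙-cong p (⨁-cong-All ps)

    ⨁-cong : ∀ (L : List A) {f g} → (∀ x → f x ≈ g x) → ⨁ L f ≈ ⨁ L g
    ⨁-cong []      p = ≈-refl
    ⨁-cong (x ∷ L) p = ∙-cong (p x) (⨁-cong L p)

    ⨁-ε : ∀ (L : List A) → ⨁ L (λ _ → ε) ≈ ε
    ⨁-ε []      = ≈-refl
    ⨁-ε (x ∷ L) = ≈-trans (identityˡ _) (⨁-ε L)

    ⨁-∙ : ∀ (L : List A) f g → ⨁ L (λ x → f x ∙ g x) ≈ ⨁ L f ∙ ⨁ L g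
    ⨁-∙ []      f g = ≈-sym (identityˡ ε)
    ⨁-∙ (x ∷ L) f g = ≈-trans (∙-congˡ (⨁-∙ L f g)) (interchange _ _ _ _)

    ⨁-++ : ∀ (L L′ : List A) h → ⨁ (L ++ L′) h ≈ ⨁ L h ∙ ⨁ L′ h
    ⨁-++ []      L′ h = ≈-sym (identityˡ _)
    ⨁-++ (x ∷ L) L′ h = ≈-trans (∙-congˡ (⨁-++ L L′ h)) (≈-sym (assoc _ _ _))

    ⨁-homo : ∀ {φ : Carrier → Carrier} → φ ε ≈ ε → (∀ x y → φ (x ∙ y) ≈ φ x ∙ φ y) →
             ∀ (L : List A) h → φ (⨁ L h) ≈ ⨁ L (φ ∘ h)
    ⨁-homo φε φ∙ []      h = φε
    ⨁-homo φε φ∙ (x ∷ L) h = ≈-trans (φ∙ _ _) (∙-congˡ (⨁-homo φε φ∙ L h))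

    ⨁-map : ∀ {b} {B : Set b} (f : B → A) L h → ⨁ (map f L) h ≈ ⨁ L (h ∘ f)
    ⨁-map f []      h = ≈-refl
    ⨁-map f (x ∷ L) h = ∙-congˡ (⨁-map f L h)

    ⨁-concatMap : ∀ {b} {B : Set b} (f : B → List A) L h →
                  ⨁ (concatMap f L) h ≈ ⨁ L (λ x → ⨁ (f x) h)
    ⨁-concatMap f []      h = ≈-refl
    ⨁-concatMap f (x ∷ L) h = ≈-trans (⨁-++ (f x) _ h) (∙-congˡ (⨁-concatMap f L h))

    when-⨁ : ∀ b (L : List A) h → when b (⨁ L h) ≈ ⨁ L (λ x → when b (h x))
    when-⨁ true  L h = ≈-refl
    when-⨁ false L h = ≈-sym (⨁-ε L)

    ⨁-filter : ∀ {p} {P : Pred A p} (P? : Decidable P) L h →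
               ⨁ (filter P? L) h ≈ ⨁ L (λ x → when (does (P? x)) (h x))
    ⨁-filter P? []      h = ≈-refl
    ⨁-filter P? (x ∷ L) h with does (P? x)
    ... | true  = ∙-congˡ (⨁-filter P? L h)
    ... | false = ≈-trans (⨁-filter P? L h) (≈-sym (identityˡ _))

  ⨁-swap : ∀ {a b} {A : Set a} {B : Set b} (L : List A) (L′ : List B) (h : A → B → Carrier) →
           ⨁ L (λ x → ⨁ L′ (h x)) ≈ ⨁ L′ (λ y → ⨁ L (λ x → h x y))
  ⨁-swap []      L′ h = ≈-sym (⨁-ε L′)
  ⨁-swap (x ∷ L) L′ h = ≈-trans (∙-congˡ (⨁-swap L L′ h)) (≈-sym (⨁-∙ L′ _ _))

  when-cong : ∀ b {v w} → v ≈ w → when b v ≈ when b w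
  when-cong true  p = p
  when-cong false p = ≈-refl

  when-cong-T : ∀ b {v w} → (T b → v ≈ w) → when b v ≈ when b w
  when-cong-T true  p = p _
  when-cong-T false p = ≈-refl

  when-ε : ∀ b → when b ε ≈ ε
  when-ε true  = ≈-refl
  when-ε false = ≈-refl

  when-∙ : ∀ b v w → when b (v ∙ w) ≈ when b v ∙ when b w
  when-∙ true  v w = ≈-refl
  when-∙ false v w = ≈-sym (identityˡ ε)

  when-homo : ∀ {φ : Carrier → Carrier} → φ ε ≈ ε → ∀ b v → φ (when b v) ≈ when b (φ v)
  when-homo φε true  v = ≈-refl
  when-homo φε false v = φε

  when-∧ : ∀ b b′ v → when b (when b′ v) ≈ when (b ∧ b′) v
  when-∧ true  b′ v = ≈-refl
  when-∧ false b′ v = ≈-refl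

  ⨁-tabulate : ∀ {a} {A : Set a} {n} (f : Fin n → A) h → ⨁ (tabulate f) h ≈ ⨁ (allFin n) (h ∘ f)
  ⨁-tabulate {n = zero}  f h = ≈-refl
  ⨁-tabulate {n = suc n} f h = ∙-congˡ (≈-trans (⨁-tabulate (f ∘ Fin.suc) h) (≈-sym (⨁-tabulate {n = n} Fin.suc (h ∘ f))))

  ⨁-applyUpTo : ∀ {a} {A : Set a} (f : ℕ → A) n h → ⨁ (applyUpTo f n) h ≈ ⨁ (upTo n) (h ∘ f)
  ⨁-applyUpTo f zero    h = ≈-refl
  ⨁-applyUpTo f (suc n) h = ∙-congˡ (≈-trans (⨁-applyUpTo (f ∘ suc) n h) (≈-sym (⨁-applyUpTo suc n (h ∘ f))))

  ⨁-δ : ∀ {n} (κ : Fin n) (g : Fin n → Carrier) →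
        ⨁ (allFin n) (λ k → when (toℕ k ≡ᵇ toℕ κ) (g k)) ≈ g κ
  ⨁-δ {suc n} zero g = begin
    g zero ∙ ⨁ (tabulate {n = n} Fin.suc) (λ k → when (toℕ k ≡ᵇ 0) (g k)) ≈⟨ ∙-congˡ (⨁-tabulate {n = n} Fin.suc _) ⟩
    g zero ∙ ⨁ (allFin n) (λ _ → ε)                                      ≈⟨ ∙-congˡ (⨁-ε (allFin n)) ⟩
    g zero ∙ ε                                                           ≈⟨ identityʳ _ ⟩
    g zero                                                               ∎
  ⨁-δ {suc n} (suc κ) g =
    ≈-trans (identityˡ _) (≈-trans (⨁-tabulate {n = n} Fin.suc _) (⨁-δ κ (g ∘ suc)))

  -- Trades a sum over the operations for a condition on the tag `j`. A tag out of range would be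
  -- lost, so each use takes its bound from `mul-tags`.
  ⨁-δ-when : ∀ {n j} → j < n → ∀ (P : ℕ → Bool) v →
             ⨁ (allFin n) (λ k → when (P (toℕ k)) (when (j ≡ᵇ toℕ k) v)) ≈ when (P j) v
  ⨁-δ-when {n} {j} j<n P v = begin
    ⨁ (allFin n) (λ k → when (P (toℕ k)) (when (j ≡ᵇ toℕ k) v))
      ≈⟨ ⨁-cong (allFin n) (λ k → when-swap (P (toℕ k)) (j ≡ᵇ toℕ k) (toℕ k ≡ᵇ toℕ κ) (flip-≡ᵇ k)) ⟩
    ⨁ (allFin n) (λ k → when (toℕ k ≡ᵇ toℕ κ) (when (P (toℕ k)) v))
      ≈⟨ ⨁-δ κ (λ k → when (P (toℕ k)) v) ⟩
    when (P (toℕ κ)) v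
      ≈⟨ reflexive (≡.cong (λ i → when (P i) v) (Fin.toℕ-fromℕ< j<n)) ⟩
    when (P j) v ∎
    where
    κ = fromℕ< j<n

    flip-≡ᵇ : ∀ k → (j ≡ᵇ toℕ k) ≡ (toℕ k ≡ᵇ toℕ κ)
    flip-≡ᵇ k = ≡.trans (≡ᵇ-sym j (toℕ k)) (≡.cong (toℕ k ≡ᵇ_) (≡.sym (Fin.toℕ-fromℕ< j<n)))

    when-swap : ∀ b b′ b″ → b′ ≡ b″ → when b (when b′ v) ≈ when b″ (when b v)
    when-swap true  b′    b″ refl = ≈-refl
    when-swap false true  b″ refl = ≈-refl
    when-swap false false b″ refl = ≈-refl

-- The tree model

-- In a `Tree m k` the slots m, …, k have been passed: `root` is the bare first up step, and a path
-- of positive size is a `Tree m 0`.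
data Tree (m : ℕ) : ℕ → Set where
  root : Tree m (suc m)
  node : ∀ {k} → Tree m (suc k) → Maybe (Tree m 0) → Tree m k

module _ {m : ℕ} where

  -- Deconcatenation of a path in front of one of its prime factors: in `dec` the left part may be
  -- empty, the right part never is.
  dec⁺ : Tree m 0 → List (Tree m 0 × Tree m 0)
  dec  : Tree m 0 → List (Maybe (Tree m 0) × Tree m 0)
  dec⁺ (node u nothing)  = []
  dec⁺ (node u (just y)) = map (λ (a , b) → node u a , b) (dec y)
  dec z = (nothing , z) ∷ map (λ (a , b) → just a , b) (dec⁺ z)

  decM : Maybe (Tree m 0) → List (Maybe (Tree m 0) × Maybe (Tree m 0))
  decM nothing  = (nothing , nothing) ∷ []
  decM (just z) = (just z , nothing) ∷ map (λ (a , b) → a , just b) (dec z)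

  -- An entry (i , X) of `mul u z` is a term X of u *_i z; for u : Tree m k only the i ≥ k occur.
  mul  : ∀ {k} → Tree m k → Tree m 0 → List (ℕ × Tree m k)
  star : ∀ {k} → Tree m k → Maybe (Tree m 0) → List (Tree m k)
  mul root                 z = []
  mul (node {k} u nothing) z =
    map (λ (i , X) → i , node X nothing) (mul u z) ++
    concatMap (λ (a , b) → map (λ X → k , node X (just b)) (star u a)) (dec z)
  mul (node {k} u (just y)) z = map (λ (i , Y) → k ⊔ i , node u (just Y)) (mul y z)
  star u nothing  = u ∷ []
  star u (just z) = map proj₂ (mul u z)

  level≤ : ∀ {k} → Tree m k → k ≤ suc m
  level≤ root       = ≤-refl
  level≤ (node u c) = ≤-trans (ℕ.n≤1+n _) (level≤ u)

  mul-tags : ∀ {k} (u : Tree m k) z → All (λ (i , X) → k ≤ i × i ≤ m) (mul u z)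
  mul-tags root z = []
  mul-tags (node {k} u nothing) z = All.++⁺
    (All.map⁺ (All.map (λ (p , q) → ℕ.<⇒≤ p , q) (mul-tags u z)))
    (All.concat⁺ (All.map⁺ (All.universal (λ (a , b) → All.map⁺ (All.universal
      (λ X → ≤-refl , ℕ.≤-pred (level≤ u)) (star u a))) (dec z))))
  mul-tags (node {k} u (just y)) z = All.map⁺ (All.map
    (λ {(i , Y)} (p , q) → ℕ.m≤m⊔n k i , ℕ.⊔-lub (ℕ.≤-pred (level≤ u)) q) (mul-tags y z))

-- Cuts and products of trees as formal sums

module TreeSums {c ℓ} (M : CommutativeMonoid c ℓ) (m : ℕ) where
  open CommutativeMonoid M renaming (refl to ≈-refl; sym to ≈-sym; trans to ≈-trans)
  open import Relation.Binary.Reasoning.Setoid setoid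
  open Summation M

  ⨁-dec : ∀ (z : Tree m 0) h → ⨁ (dec z) h ≈ h (nothing , z) ∙ ⨁ (dec⁺ z) (λ (a , b) → h (just a , b))
  ⨁-dec z h = ∙-congˡ (⨁-map _ (dec⁺ z) h)

  ⨁-dec-node : ∀ (u : Tree m 1) y h →
               ⨁ (dec (node u (just y))) h ≈
               h (nothing , node u (just y)) ∙ ⨁ (dec y) (λ (a , b) → h (just (node u a) , b))
  ⨁-dec-node u y h = ≈-trans (⨁-dec (node u (just y)) h) (∙-congˡ (⨁-map _ (dec y) _))

  ⨁-decM-node : ∀ (u : Tree m 1) a h →
                ⨁ (decM (just (node u a))) h ≈
                h (nothing , just (node u a)) ∙ ⨁ (decM a) (λ (c , d) → h (just (node u c) , d))
  ⨁-decM-node u nothing  h = begin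
    h (just (node u nothing) , nothing) ∙ (h (nothing , just (node u nothing)) ∙ ε)
      ≈⟨ ≈-sym (assoc _ _ _) ⟩
    (h (just (node u nothing) , nothing) ∙ h (nothing , just (node u nothing))) ∙ ε
      ≈⟨ ∙-congʳ (comm _ _) ⟩
    (h (nothing , just (node u nothing)) ∙ h (just (node u nothing) , nothing)) ∙ ε
      ≈⟨ assoc _ _ _ ⟩
    h (nothing , just (node u nothing)) ∙ (h (just (node u nothing) , nothing) ∙ ε) ∎
  ⨁-decM-node u (just y) h = begin
    A ∙ ⨁ (map (λ (a , b) → a , just b) (dec (node u (just y)))) h
      ≈⟨ ∙-congˡ (⨁-map _ (dec (node u (just y))) h) ⟩
    A ∙ ⨁ (dec (node u (just y))) (λ (a , b) → h (a , just b))
      ≈⟨ ∙-congˡ (⨁-dec-node u y _) ⟩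
    A ∙ (B ∙ ⨁ (dec y) (λ (a , b) → h (just (node u a) , just b)))
      ≈⟨ ≈-trans (≈-sym (assoc _ _ _)) (≈-trans (∙-congʳ (comm A B)) (assoc _ _ _)) ⟩
    B ∙ (A ∙ ⨁ (dec y) (λ (a , b) → h (just (node u a) , just b)))
      ≈⟨ ∙-congˡ (∙-congˡ (≈-sym (⨁-map _ (dec y) _))) ⟩
    B ∙ ⨁ (decM (just y)) (λ (c , d) → h (just (node u c) , d)) ∎
    where
    A = h (just (node u (just y)) , nothing)
    B = h (nothing , just (node u (just y)))

  -- Coassociativity of deconcatenation: both sides run over the ways to cut twice, where only the
  -- last of the three parts has to be nonempty.
  dec-coassoc : ∀ z (h : Maybe (Tree m 0) → Maybe (Tree m 0) → Tree m 0 → Carrier) →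
                ⨁ (dec z) (λ (a , b) → ⨁ (decM a) (λ (c , d) → h c d b)) ≈
                ⨁ (dec z) (λ (a , b) → ⨁ (dec b) (λ (c , d) → h a c d))
  dec-coassoc (node u nothing)  h = ≈-refl
  dec-coassoc z@(node u (just y)) h = begin
    ⨁ (dec z) (λ (a , b) → ⨁ (decM a) (λ (c , d) → h c d b))
      ≈⟨ ⨁-dec-node u y _ ⟩
    (h nothing nothing z ∙ ε) ∙ ⨁ (dec y) (λ (a , b) → ⨁ (decM (just (node u a))) (λ (c , d) → h c d b))
      ≈⟨ ∙-cong (identityʳ _) (⨁-cong (dec y) (λ (a , b) → ⨁-decM-node u a _)) ⟩
    h nothing nothing z ∙ ⨁ (dec y) (λ (a , b) → h nothing (just (node u a)) b ∙
                                                 ⨁ (decM a) (λ (c , d) → h (just (node u c)) d b))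
      ≈⟨ ∙-congˡ (⨁-∙ (dec y) _ _) ⟩
    h nothing nothing z ∙ (⨁ (dec y) (λ (a , b) → h nothing (just (node u a)) b) ∙
                           ⨁ (dec y) (λ (a , b) → ⨁ (decM a) (λ (c , d) → h (just (node u c)) d b)))
      ≈⟨ ≈-sym (assoc _ _ _) ⟩
    (h nothing nothing z ∙ ⨁ (dec y) (λ (a , b) → h nothing (just (node u a)) b)) ∙
      ⨁ (dec y) (λ (a , b) → ⨁ (decM a) (λ (c , d) → h (just (node u c)) d b))
      ≈⟨ ∙-cong (≈-sym (⨁-dec-node u y _)) (dec-coassoc y (λ c d b → h (just (node u c)) d b)) ⟩
    ⨁ (dec z) (λ (c , d) → h nothing c d) ∙
      ⨁ (dec y) (λ (a , b) → ⨁ (dec b) (λ (c , d) → h (just (node u a)) c d))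
      ≈⟨ ≈-sym (⨁-dec-node u y _) ⟩
    ⨁ (dec z) (λ (a , b) → ⨁ (dec b) (λ (c , d) → h a c d)) ∎

  module _ {k : ℕ} where

    ⨁-mul-nothing : ∀ (u : Tree m (suc k)) z h →
      ⨁ (mul (node u nothing) z) h ≈
      ⨁ (mul u z) (λ (i , X) → h (i , node X nothing)) ∙
      ⨁ (dec z) (λ (a , b) → ⨁ (star u a) (λ X → h (k , node X (just b))))
    ⨁-mul-nothing u z h = ≈-trans
      (⨁-++ (map (λ (i , X) → i , node X nothing) (mul u z)) (concatMap grafts (dec z)) h)
      (∙-cong (⨁-map _ (mul u z) h)
        (≈-trans (⨁-concatMap grafts (dec z) h) (⨁-cong (dec z) (λ (a , b) → ⨁-map _ (star u a) h))))
      where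
      grafts : Maybe (Tree m 0) × Tree m 0 → List (ℕ × Tree m k)
      grafts (a , b) = map (λ X → k , node X (just b)) (star u a)

    ⨁-mul-just : ∀ (u : Tree m (suc k)) y z h →
      ⨁ (mul (node u (just y)) z) h ≈ ⨁ (mul y z) (λ (i , Y) → h (k ⊔ i , node u (just Y)))
    ⨁-mul-just u y z h = ⨁-map _ (mul y z) h

    ⨁-star : ∀ (u : Tree m k) z h → ⨁ (star u (just z)) h ≈ ⨁ (mul u z) (λ (i , X) → h X)
    ⨁-star u z h = ⨁-map _ (mul u z) h

    -- Without tags the two kinds of terms of the third rule become one sum over cuts: slot `k`
    -- stays empty exactly for the cut with empty right part.
    ⨁-star-nothing : ∀ (u : Tree m (suc k)) a h →
      ⨁ (star (node u nothing) a) h ≈ ⨁ (decM a) (λ (c , d) → ⨁ (star u c) (λ X → h (node X d)))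
    ⨁-star-nothing u nothing  h = ≈-sym (identityʳ _)
    ⨁-star-nothing u (just z) h = begin
      ⨁ (star (node u nothing) (just z)) h
        ≈⟨ ⨁-star (node u nothing) z h ⟩
      ⨁ (mul (node u nothing) z) (λ (i , X) → h X)
        ≈⟨ ⨁-mul-nothing u z _ ⟩
      ⨁ (mul u z) (λ (i , X) → h (node X nothing)) ∙
      ⨁ (dec z) (λ (a , b) → ⨁ (star u a) (λ X → h (node X (just b))))
        ≈⟨ ∙-cong (≈-sym (⨁-map _ (mul u z) _)) (≈-sym (⨁-map _ (dec z) _)) ⟩
      ⨁ (decM (just z)) (λ (c , d) → ⨁ (star u c) (λ X → h (node X d))) ∎

    ⨁-star-just : ∀ (u : Tree m (suc k)) y a h →
      ⨁ (star (node u (just y)) a) h ≈ ⨁ (star y a) (λ Y → h (node u (just Y)))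
    ⨁-star-just u y nothing  h = ≈-refl
    ⨁-star-just u y (just z) h = begin
      ⨁ (star (node u (just y)) (just z)) h              ≈⟨ ⨁-star (node u (just y)) z h ⟩
      ⨁ (mul (node u (just y)) z) (λ (i , X) → h X)      ≈⟨ ⨁-mul-just u y z _ ⟩
      ⨁ (mul y z) (λ (i , Y) → h (node u (just Y)))      ≈⟨ ≈-sym (⨁-star-0 z) ⟩
      ⨁ (star y (just z)) (λ Y → h (node u (just Y)))    ∎
      where
      ⨁-star-0 : ∀ z → ⨁ (star y (just z)) (λ Y → h (node u (just Y))) ≈ ⨁ (mul y z) (λ (i , Y) → h (node u (just Y)))
      ⨁-star-0 z = ⨁-map _ (mul y z) _

  -- A cut of a term of the product has on its right either a product of `R` with a final part of
  -- `Q`, or a final part of `R` alone. In the second case no down step of `Q` follows the cut,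
  -- whence the tag 0.
  dec-mul : ∀ (Q R : Tree m 0) (h : ℕ → Maybe (Tree m 0) → Tree m 0 → Carrier) →
    ⨁ (mul Q R) (λ (j , Y) → ⨁ (dec Y) (λ (a , b) → h j a b)) ≈
    ⨁ (dec Q) (λ (a , q) → ⨁ (mul q R) (λ (j , Y) → h j a Y)) ∙
    ⨁ (dec R) (λ (a , b) → ⨁ (star Q a) (λ X → h 0 (just X) b))
  dec-mul Q@(node u nothing) R h = begin
    ⨁ (mul Q R) (λ (j , Y) → ⨁ (dec Y) (λ (a , b) → h j a b))
      ≈⟨ ⨁-mul-nothing u R _ ⟩
    ⨁ (mul u R) (λ (i , X) → h i nothing (node X nothing) ∙ ε) ∙
    ⨁ (dec R) (λ (a , b) → ⨁ (star u a) (λ X → ⨁ (dec (node X (just b))) (λ (c , d) → h 0 c d)))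
      ≈⟨ ∙-cong (⨁-cong (mul u R) (λ _ → identityʳ _))
           (⨁-cong (dec R) (λ (a , b) → ≈-trans
             (⨁-cong (star u a) (λ X → ⨁-dec-node X b _)) (⨁-∙ (star u a) _ _))) ⟩
    ⨁ (mul u R) (λ (i , X) → h i nothing (node X nothing)) ∙
    ⨁ (dec R) (λ (a , b) → ⨁ (star u a) (λ X → h 0 nothing (node X (just b))) ∙
                           ⨁ (star u a) (λ X → ⨁ (dec b) (λ (c , d) → h 0 (just (node X c)) d)))
      ≈⟨ ≈-trans (∙-congˡ (⨁-∙ (dec R) _ _)) (≈-sym (assoc _ _ _)) ⟩
    (⨁ (mul u R) (λ (i , X) → h i nothing (node X nothing)) ∙
     ⨁ (dec R) (λ (a , b) → ⨁ (star u a) (λ X → h 0 nothing (node X (just b))))) ∙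
    ⨁ (dec R) (λ (a , b) → ⨁ (star u a) (λ X → ⨁ (dec b) (λ (c , d) → h 0 (just (node X c)) d)))
      ≈⟨ ∙-cong (≈-trans (≈-sym (⨁-mul-nothing u R _)) (≈-sym (identityʳ _)))
           (⨁-cong (dec R) (λ (a , b) → ⨁-swap (star u a) (dec b) _)) ⟩
    ⨁ (dec Q) (λ (a , q) → ⨁ (mul q R) (λ (j , Y) → h j a Y)) ∙
    ⨁ (dec R) (λ (a , b) → ⨁ (dec b) (λ (c , d) → ⨁ (star u a) (λ X → h 0 (just (node X c)) d)))
      ≈⟨ ∙-congˡ (≈-sym (dec-coassoc R (λ a c d → ⨁ (star u a) (λ X → h 0 (just (node X c)) d)))) ⟩
    ⨁ (dec Q) (λ (a , q) → ⨁ (mul q R) (λ (j , Y) → h j a Y)) ∙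
    ⨁ (dec R) (λ (a , b) → ⨁ (decM a) (λ (c , d) → ⨁ (star u c) (λ X → h 0 (just (node X d)) b)))
      ≈⟨ ∙-congˡ (⨁-cong (dec R) (λ (a , b) → ≈-sym (⨁-star-nothing u a _))) ⟩
    ⨁ (dec Q) (λ (a , q) → ⨁ (mul q R) (λ (j , Y) → h j a Y)) ∙
    ⨁ (dec R) (λ (a , b) → ⨁ (star Q a) (λ X → h 0 (just X) b)) ∎
  dec-mul Q@(node u (just y)) R h = begin
    ⨁ (mul Q R) (λ (j , Y) → ⨁ (dec Y) (λ (a , b) → h j a b))
      ≈⟨ ⨁-mul-just u y R _ ⟩
    ⨁ (mul y R) (λ (i , Y) → ⨁ (dec (node u (just Y))) (λ (a , b) → h i a b))
      ≈⟨ ≈-trans (⨁-cong (mul y R) (λ (i , Y) → ⨁-dec-node u Y _)) (⨁-∙ (mul y R) _ _) ⟩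
    ⨁ (mul y R) (λ (i , Y) → h i nothing (node u (just Y))) ∙
    ⨁ (mul y R) (λ (i , Y) → ⨁ (dec Y) (λ (a , b) → h i (just (node u a)) b))
      ≈⟨ ∙-cong (≈-sym (⨁-mul-just u y R _)) (dec-mul y R (λ j a b → h j (just (node u a)) b)) ⟩
    ⨁ (mul Q R) (λ (j , Y) → h j nothing Y) ∙
    (⨁ (dec y) (λ (a , q) → ⨁ (mul q R) (λ (j , Y) → h j (just (node u a)) Y)) ∙
     ⨁ (dec R) (λ (a , b) → ⨁ (star y a) (λ X → h 0 (just (node u (just X))) b)))
      ≈⟨ ≈-sym (assoc _ _ _) ⟩
    (⨁ (mul Q R) (λ (j , Y) → h j nothing Y) ∙
     ⨁ (dec y) (λ (a , q) → ⨁ (mul q R) (λ (j , Y) → h j (just (node u a)) Y))) ∙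
    ⨁ (dec R) (λ (a , b) → ⨁ (star y a) (λ X → h 0 (just (node u (just X))) b))
      ≈⟨ ∙-cong (≈-sym (⨁-dec-node u y _)) (⨁-cong (dec R) (λ (a , b) → ≈-sym (⨁-star-just u y a _))) ⟩
    ⨁ (dec Q) (λ (a , q) → ⨁ (mul q R) (λ (j , Y) → h j a Y)) ∙
    ⨁ (dec R) (λ (a , b) → ⨁ (star Q a) (λ X → h 0 (just X) b)) ∎

  -- The terms tagged (a , b) give associativity if a < b, and the summation identity if a = b.
  mul-assoc : ∀ {k} (u : Tree m k) Q R (h : ℕ → ℕ → Tree m k → Carrier) →
    ⨁ (mul Q R) (λ (j , Y) → ⨁ (mul u Y) (λ (i , X) → h i (i ⊔ j) X)) ≈
    ⨁ (mul u Q) (λ (i , Y) → ⨁ (mul Y R) (λ (j , X) → h (i ⊓ j) j X))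
  mul-assoc root Q R h = ⨁-ε (mul Q R)
  mul-assoc (node {k} u (just y)) Q R h = begin
    ⨁ (mul Q R) (λ (j , Y) → ⨁ (mul (node u (just y)) Y) (λ (i , X) → h i (i ⊔ j) X))
      ≈⟨ ⨁-cong (mul Q R) (λ (j , Y) → ≈-trans (⨁-mul-just u y Y _) (⨁-cong (mul y Y) (λ (i , X) →
           reflexive (cong (λ t → h (k ⊔ i) t (node u (just X))) (ℕ.⊔-assoc k i j))))) ⟩
    ⨁ (mul Q R) (λ (j , Y) → ⨁ (mul y Y) (λ (i , X) → h (k ⊔ i) (k ⊔ (i ⊔ j)) (node u (just X))))
      ≈⟨ mul-assoc y Q R (λ i j X → h (k ⊔ i) (k ⊔ j) (node u (just X))) ⟩
    ⨁ (mul y Q) (λ (i , Y) → ⨁ (mul Y R) (λ (j , X) → h (k ⊔ (i ⊓ j)) (k ⊔ j) (node u (just X))))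
      ≈⟨ ⨁-cong (mul y Q) (λ (i , Y) → ≈-trans (⨁-cong (mul Y R) (λ (j , X) →
           reflexive (cong (λ t → h t (k ⊔ j) (node u (just X))) (ℕ.⊔-distribˡ-⊓ k i j))))
           (≈-sym (⨁-mul-just u Y R _))) ⟩
    ⨁ (mul y Q) (λ (i , Y) → ⨁ (mul (node u (just Y)) R) (λ (j , X) → h ((k ⊔ i) ⊓ j) j X))
      ≈⟨ ≈-sym (⨁-mul-just u y Q _) ⟩
    ⨁ (mul (node u (just y)) Q) (λ (i , Y) → ⨁ (mul Y R) (λ (j , X) → h (i ⊓ j) j X)) ∎
  mul-assoc (node {k} u nothing) Q R h = begin
    ⨁ (mul Q R) (λ (j , Y) → ⨁ (mul (node u nothing) Y) (λ (i , X) → h i (i ⊔ j) X))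
      ≈⟨ ≈-trans (⨁-cong (mul Q R) (λ (j , Y) → ⨁-mul-nothing u Y _)) (⨁-∙ (mul Q R) _ _) ⟩
    ⨁ (mul Q R) (λ (j , Y) → ⨁ (mul u Y) (λ (i , X) → h i (i ⊔ j) (node X nothing))) ∙
    ⨁ (mul Q R) (λ (j , Y) → ⨁ (dec Y) (λ (a , b) → ⨁ (star u a) (λ X → h k (k ⊔ j) (node X (just b)))))
      ≈⟨ ∙-cong (mul-assoc u Q R (λ i j X → h i j (node X nothing)))
           (dec-mul Q R (λ j a b → ⨁ (star u a) (λ X → h k (k ⊔ j) (node X (just b))))) ⟩
    ⨁ (mul u Q) (λ (i , Y) → ⨁ (mul Y R) (λ (j , X) → h (i ⊓ j) j (node X nothing))) ∙
    (⨁ (dec Q) (λ (a , q) → ⨁ (mul q R) (λ (j , Y) → ⨁ (star u a) (λ X → h k (k ⊔ j) (node X (just Y))))) ∙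
     ⨁ (dec R) (λ (a , b) → ⨁ (star Q a) (λ Z → ⨁ (star u (just Z)) (λ X → h k (k ⊔ 0) (node X (just b))))))
      ≈⟨ ∙-congˡ (∙-cong (⨁-cong (dec Q) (λ (a , q) → middle a q)) (⨁-cong (dec R) (λ (a , b) → last a b))) ⟩
    ⨁ (mul u Q) (λ (i , Y) → ⨁ (mul Y R) (λ (j , X) → h (i ⊓ j) j (node X nothing))) ∙
    (⨁ (dec Q) (λ (a , q) → ⨁ (star u a) (λ X → ⨁ (mul (node X (just q)) R) (λ (j , Y) → h (k ⊓ j) j Y))) ∙
     ⨁ (dec R) (λ (a , b) → ⨁ (mul u Q) (λ (i , Y) → ⨁ (star Y a) (λ X → h (i ⊓ k) k (node X (just b))))))
      ≈⟨ ∙-congˡ (∙-congˡ (⨁-swap (dec R) (mul u Q) _)) ⟩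
    ⨁ (mul u Q) (λ (i , Y) → ⨁ (mul Y R) (λ (j , X) → h (i ⊓ j) j (node X nothing))) ∙
    (⨁ (dec Q) (λ (a , q) → ⨁ (star u a) (λ X → ⨁ (mul (node X (just q)) R) (λ (j , Y) → h (k ⊓ j) j Y))) ∙
     ⨁ (mul u Q) (λ (i , Y) → ⨁ (dec R) (λ (a , b) → ⨁ (star Y a) (λ X → h (i ⊓ k) k (node X (just b))))))
      ≈⟨ ≈-trans (∙-congˡ (comm _ _)) (≈-sym (assoc _ _ _)) ⟩
    (⨁ (mul u Q) (λ (i , Y) → ⨁ (mul Y R) (λ (j , X) → h (i ⊓ j) j (node X nothing))) ∙
     ⨁ (mul u Q) (λ (i , Y) → ⨁ (dec R) (λ (a , b) → ⨁ (star Y a) (λ X → h (i ⊓ k) k (node X (just b)))))) ∙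
    ⨁ (dec Q) (λ (a , q) → ⨁ (star u a) (λ X → ⨁ (mul (node X (just q)) R) (λ (j , Y) → h (k ⊓ j) j Y)))
      ≈⟨ ∙-congʳ (≈-trans (≈-sym (⨁-∙ (mul u Q) _ _))
           (⨁-cong (mul u Q) (λ (i , Y) → ≈-sym (⨁-mul-nothing Y R _)))) ⟩
    ⨁ (mul u Q) (λ (i , Y) → ⨁ (mul (node Y nothing) R) (λ (j , X) → h (i ⊓ j) j X)) ∙
    ⨁ (dec Q) (λ (a , q) → ⨁ (star u a) (λ X → ⨁ (mul (node X (just q)) R) (λ (j , Y) → h (k ⊓ j) j Y)))
      ≈⟨ ≈-sym (⨁-mul-nothing u Q _) ⟩
    ⨁ (mul (node u nothing) Q) (λ (i , Y) → ⨁ (mul Y R) (λ (j , X) → h (i ⊓ j) j X)) ∎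
    where
    middle : ∀ a q →
      ⨁ (mul q R) (λ (j , Y) → ⨁ (star u a) (λ X → h k (k ⊔ j) (node X (just Y)))) ≈
      ⨁ (star u a) (λ X → ⨁ (mul (node X (just q)) R) (λ (j , Y) → h (k ⊓ j) j Y))
    middle a q = ≈-trans (⨁-swap (mul q R) (star u a) _) (⨁-cong (star u a) (λ X → ≈-sym
      (≈-trans (⨁-mul-just X q R _) (⨁-cong (mul q R) (λ (j , Y) →
        reflexive (cong (λ t → h t (k ⊔ j) (node X (just Y))) (ℕ.⊓-absorbs-⊔ k j)))))))

    -- The tags of `mul u Q` exceed `k`, so their minimum with `k` is `k`. Hence `last` needs the
    -- induction hypothesis only with the tags forgotten.
    tag : ∀ b a → ⨁ (mul u Q) (λ (i , Y) → ⨁ (star Y a) (λ X → h (i ⊓ k) k (node X (just b)))) ≈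
                ⨁ (mul u Q) (λ (i , Y) → ⨁ (star Y a) (λ X → h k (k ⊔ 0) (node X (just b))))
    tag b a = ⨁-cong-All (All.map (λ {(i , Y)} (p , _) → ⨁-cong (star Y a) (λ X → reflexive
      (cong₂ (λ s t → h s t (node X (just b))) (ℕ.m≥n⇒m⊓n≡n (ℕ.<⇒≤ p)) (≡.sym (ℕ.⊔-identityʳ k))))) (mul-tags u Q))

    last : ∀ a b →
      ⨁ (star Q a) (λ Z → ⨁ (star u (just Z)) (λ X → h k (k ⊔ 0) (node X (just b)))) ≈
      ⨁ (mul u Q) (λ (i , Y) → ⨁ (star Y a) (λ X → h (i ⊓ k) k (node X (just b))))
    last nothing b = begin
      ⨁ (star u (just Q)) H ∙ ε
        ≈⟨ identityʳ _ ⟩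
      ⨁ (star u (just Q)) H
        ≈⟨ ⨁-star u Q H ⟩
      ⨁ (mul u Q) (λ (i , Y) → H Y)
        ≈⟨ ⨁-cong (mul u Q) (λ _ → ≈-sym (identityʳ _)) ⟩
      ⨁ (mul u Q) (λ (i , Y) → ⨁ (star Y nothing) H)
        ≈⟨ ≈-sym (tag b nothing) ⟩
      ⨁ (mul u Q) (λ (i , Y) → ⨁ (star Y nothing) (λ X → h (i ⊓ k) k (node X (just b)))) ∎
      where H = λ X → h k (k ⊔ 0) (node X (just b))
    last (just a) b = begin
      ⨁ (star Q (just a)) (λ Z → ⨁ (star u (just Z)) H)
        ≈⟨ ⨁-star Q a _ ⟩
      ⨁ (mul Q a) (λ (_ , Z) → ⨁ (star u (just Z)) H)
        ≈⟨ ⨁-cong (mul Q a) (λ (_ , Z) → ⨁-star u Z H) ⟩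
      ⨁ (mul Q a) (λ (_ , Z) → ⨁ (mul u Z) (λ (_ , X) → H X))
        ≈⟨ mul-assoc u Q a (λ _ _ → H) ⟩
      ⨁ (mul u Q) (λ (_ , Y) → ⨁ (mul Y a) (λ (_ , X) → H X))
        ≈⟨ ⨁-cong (mul u Q) (λ (_ , Y) → ≈-sym (⨁-star Y a H)) ⟩
      ⨁ (mul u Q) (λ (_ , Y) → ⨁ (star Y (just a)) H)
        ≈⟨ ≈-sym (tag b (just a)) ⟩
      ⨁ (mul u Q) (λ (i , Y) → ⨁ (star Y (just a)) (λ X → h (i ⊓ k) k (node X (just b)))) ∎
      where H = λ X → h k (k ⊔ 0) (node X (just b))

-- Words of trees and weaving

Word : Set
Word = List Step

replicate-∷ʳ : ∀ n (w : Word) → replicate n D ++ D ∷ w ≡ D ∷ replicate n D ++ w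
replicate-∷ʳ zero    w = refl
replicate-∷ʳ (suc n) w = cong (D ∷_) (replicate-∷ʳ n w)

module _ {m : ℕ} where

  -- `stem u` is the word up to the beginning of slot k; `word root` is a junk value.
  stem  : ∀ {k} → Tree m (suc k) → Word
  word  : ∀ {k} → Tree m k → Word
  wordM : Maybe (Tree m 0) → Word
  stem root       = U ∷ []
  stem (node u c) = word (node u c) ++ D ∷ []
  word root       = []
  word (node u c) = stem u ++ wordM c
  wordM nothing  = []
  wordM (just y) = word y

  primesT : Tree m 0 → List Word
  primesM : Maybe (Tree m 0) → List Word
  primesT (node u c) = stem u ∷ primesM c
  primesM nothing  = []
  primesM (just y) = primesT y

  -- The part that a product leaves untouched: factors are inserted only into the run of down steps
  -- after the last up step.
  prefix : ∀ {k} → Tree m k → Word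
  prefix root              = []
  prefix (node u nothing)  = prefix u
  prefix (node u (just y)) = stem u ++ prefix y

  descent     : ∀ {k} → Tree m k → ℕ
  stemDescent : ∀ {k} → Tree m (suc k) → ℕ
  descent root              = 0
  descent (node u nothing)  = stemDescent u
  descent (node u (just y)) = descent y
  stemDescent root       = 0
  stemDescent (node u c) = suc (descent (node u c))

  -- For a path P, the i with P *_λ Q a term of P *_i Q whenever λ_r = t (junk for t > descent).
  index : ∀ {k} → Tree m k → ℕ → ℕ
  index root                  t       = 0
  index (node {k} u nothing)  zero    = k
  index (node {k} u nothing)  (suc t) = index u t
  index (node {k} u (just y)) t       = k ⊔ index y t

  concat-primesM : ∀ c → concat (primesM c) ≡ wordM c
  concat-primesM nothing           = refl
  concat-primesM (just (node u c)) = cong (stem u ++_) (concat-primesM c)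

  word-prefix : ∀ {k} (u : Tree m (suc k)) c →
                word (node u c) ≡ prefix (node u c) ++ U ∷ replicate (descent (node u c)) D
  stem-prefix : ∀ {k} (u : Tree m (suc k)) → stem u ≡ prefix u ++ U ∷ replicate (stemDescent u) D
  word-prefix u nothing = ≡.trans (++-identityʳ (stem u)) (stem-prefix u)
  word-prefix u (just (node v c)) =
    ≡.trans (cong (stem u ++_) (word-prefix v c)) (≡.sym (++-assoc (stem u) _ _))
  stem-prefix root       = refl
  stem-prefix (node u c) = begin
    word (node u c) ++ D ∷ []                         ≡⟨ cong (_++ D ∷ []) (word-prefix u c) ⟩
    (P ++ U ∷ replicate n D) ++ D ∷ []                ≡⟨ ++-assoc P _ _ ⟩
    P ++ U ∷ replicate n D ++ D ∷ []                  ≡⟨ cong (λ w → P ++ U ∷ w) (replicate-∷ʳ n []) ⟩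
    P ++ U ∷ D ∷ replicate n D ++ []                  ≡⟨ cong (λ w → P ++ U ∷ D ∷ w) (++-identityʳ _) ⟩
    P ++ U ∷ D ∷ replicate n D                        ∎
    where
    open ≡-Reasoning
    P = prefix (node u c)
    n = descent (node u c)

  -- A bare `root` admits no product and never results from one, so every term is a `node`, whose
  -- stem is its word with one more down step.
  mul-stem : ∀ {k} (u : Tree m (suc k)) z → All (λ (i , X) → stem X ≡ word X ++ D ∷ []) (mul u z)
  mul-stem root z = []
  mul-stem (node u nothing) z = All.++⁺
    (All.map⁺ (All.universal (λ _ → refl) (mul u z)))
    (All.concat⁺ (All.map⁺ (All.universal (λ (a , b) → All.map⁺ (All.universal
      (λ _ → refl) (star u a))) (dec z))))
  mul-stem (node u (just y)) z = All.map⁺ (All.universal (λ _ → refl) (mul y z))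

-- The entries are (λ_r , D^λ_0 Q_1 D^λ_1 ⋯ Q_r D^λ_r) with λ_0 + ⋯ + λ_r = n; `weaves⁺` keeps those
-- with λ_r ≥ 1 and tags them by λ_r − 1.
weaves : ℕ → List Word → List (ℕ × Word)
weaves n []       = (n , replicate n D) ∷ []
weaves n (Q ∷ Qs) =
  concatMap (λ a → map (λ (t , w) → t , replicate a D ++ Q ++ w) (weaves (n ∸ a) Qs)) (upTo (suc n))

weaves⁺ : ℕ → List Word → List (ℕ × Word)
weaves⁺ zero    Qs = []
weaves⁺ (suc n) Qs = map (λ (t , w) → t , w ++ D ∷ []) (weaves n Qs)

-- The counterpart of `star` on words. Zero down steps occur for the bare `root` only, which can be
-- kept but not multiplied.
weaves⋆ : ℕ → List Word → List Word
weaves⋆ zero    []       = [] ∷ []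
weaves⋆ zero    (_ ∷ _)  = []
weaves⋆ (suc n) Qs       = map proj₂ (weaves⁺ (suc n) Qs)

splits : List Word → List (List Word × List Word)
splits []       = []
splits (Q ∷ Qs) = ([] , Q ∷ Qs) ∷ map (λ (A , B) → Q ∷ A , B) (splits Qs)

-- Weaves as formal sums, and products of trees as weaves

module WordSums {c ℓ} (M : CommutativeMonoid c ℓ) where
  open CommutativeMonoid M renaming (refl to ≈-refl; sym to ≈-sym; trans to ≈-trans)
  open import Relation.Binary.Reasoning.Setoid setoid
  open import Algebra.Properties.CommutativeSemigroup commutativeSemigroup using (interchange)
  open Summation M

  ⨁-weaves : ∀ n Q Qs h → ⨁ (weaves n (Q ∷ Qs)) h ≈
    ⨁ (upTo (suc n)) (λ a → ⨁ (weaves (n ∸ a) Qs) (λ (t , w) → h (t , replicate a D ++ Q ++ w)))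
  ⨁-weaves n Q Qs h = ≈-trans (⨁-concatMap block (upTo (suc n)) h)
    (⨁-cong (upTo (suc n)) (λ a → ⨁-map _ (weaves (n ∸ a) Qs) h))
    where
    block : ℕ → List (ℕ × Word)
    block a = map (λ (t , w) → t , replicate a D ++ Q ++ w) (weaves (n ∸ a) Qs)

  ⨁-weaves-zero : ∀ Q Qs h → ⨁ (weaves 0 (Q ∷ Qs)) h ≈ ⨁ (weaves 0 Qs) (λ (t , w) → h (t , Q ++ w))
  ⨁-weaves-zero Q Qs h = ≈-trans (⨁-weaves 0 Q Qs h) (identityʳ _)

  ⨁-weaves-concat : ∀ Qs h → ⨁ (weaves 0 Qs) h ≈ h (0 , concat Qs)
  ⨁-weaves-concat []       h = identityʳ _
  ⨁-weaves-concat (Q ∷ Qs) h = ≈-trans (⨁-weaves-zero Q Qs h) (⨁-weaves-concat Qs _)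

  ⨁-weaves-suc : ∀ n Q Qs h → ⨁ (weaves (suc n) (Q ∷ Qs)) h ≈
    ⨁ (weaves (suc n) Qs) (λ (t , w) → h (t , Q ++ w)) ∙
    ⨁ (weaves n (Q ∷ Qs)) (λ (t , w) → h (t , D ∷ w))
  ⨁-weaves-suc n Q Qs h = ≈-trans (⨁-weaves (suc n) Q Qs h) (∙-congˡ
    (≈-trans (⨁-applyUpTo suc (suc n) _) (≈-sym (⨁-weaves n Q Qs _))))

  ⨁-weaves⋆ : ∀ n Qs h → ⨁ (weaves⋆ (suc n) Qs) h ≈ ⨁ (weaves n Qs) (λ (t , w) → h (w ++ D ∷ []))
  ⨁-weaves⋆ n Qs h = ≈-trans (⨁-map proj₂ (weaves⁺ (suc n) Qs) h) (⨁-map _ (weaves n Qs) _)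

  ⨁-splits : ∀ Q Qs h → ⨁ (splits (Q ∷ Qs)) h ≈
    h ([] , Q ∷ Qs) ∙ ⨁ (splits Qs) (λ (A , B) → h (Q ∷ A , B))
  ⨁-splits Q Qs h = ∙-congˡ (⨁-map _ (splits Qs) h)

  -- Sort the weaves by their last down step: it ends the weave, or it is followed by a nonempty run
  -- `B` of factors. This is the third rule on words, with `B` as the part that is put into slot k.
  ⨁-weaves-peel : ∀ n Qs (h : ℕ → Word → Carrier) →
    ⨁ (weaves (suc n) Qs) (λ (t , w) → h t w) ≈
    ⨁ (weaves n Qs) (λ (t , w) → h (suc t) (w ++ D ∷ [])) ∙
    ⨁ (splits Qs) (λ (A , B) → ⨁ (weaves⋆ (suc n) A) (λ w → h 0 (w ++ concat B)))
  ⨁-weaves-peel n [] h = ∙-congʳ (≈-trans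
    (reflexive (cong (λ w → h (suc n) (D ∷ w)) (≡.sym (++-identityʳ (replicate n D)))))
    (≈-trans (reflexive (cong (h (suc n)) (≡.sym (replicate-∷ʳ n [])))) (≈-sym (identityʳ _))))
  ⨁-weaves-peel n (Q ∷ Qs) h = begin
    ⨁ (weaves (suc n) (Q ∷ Qs)) (λ (t , w) → h t w)
      ≈⟨ ⨁-weaves-suc n Q Qs _ ⟩
    ⨁ (weaves (suc n) Qs) (λ (t , w) → h t (Q ++ w)) ∙
    ⨁ (weaves n (Q ∷ Qs)) (λ (t , w) → h t (D ∷ w))
      ≈⟨ ∙-congʳ (⨁-weaves-peel n Qs (λ t w → h t (Q ++ w))) ⟩
    (⨁ (weaves n Qs) (λ (t , w) → h (suc t) (Q ++ w ++ D ∷ [])) ∙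
     ⨁ (splits Qs) (λ (A , B) → ⨁ (weaves⋆ (suc n) A) (λ w → h 0 (Q ++ w ++ concat B)))) ∙
    ⨁ (weaves n (Q ∷ Qs)) (λ (t , w) → h t (D ∷ w))
      ≈⟨ ∙-congʳ (∙-congˡ (⨁-cong (splits Qs) (λ (A , B) → ⨁-weaves⋆ n A _))) ⟩
    (⨁ (weaves n Qs) (λ (t , w) → h (suc t) (Q ++ w ++ D ∷ [])) ∙
     ⨁ (splits Qs) (λ (A , B) → ⨁ (weaves n A) (λ (t , w) → h 0 (Q ++ (w ++ D ∷ []) ++ concat B)))) ∙
    ⨁ (weaves n (Q ∷ Qs)) (λ (t , w) → h t (D ∷ w))
      ≈⟨ front n ⟩
    ⨁ (weaves n (Q ∷ Qs)) (λ (t , w) → h (suc t) (w ++ D ∷ [])) ∙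
    (⨁ (weaves n []) (λ (t , w) → h 0 ((w ++ D ∷ []) ++ concat (Q ∷ Qs))) ∙
     ⨁ (splits Qs) (λ (A , B) → ⨁ (weaves n (Q ∷ A)) (λ (t , w) → h 0 ((w ++ D ∷ []) ++ concat B))))
      ≈⟨ ∙-congˡ (∙-cong (≈-sym (⨁-weaves⋆ n [] (λ w → h 0 (w ++ concat (Q ∷ Qs)))))
           (⨁-cong (splits Qs) (λ (A , B) → ≈-sym (⨁-weaves⋆ n (Q ∷ A) _)))) ⟩
    ⨁ (weaves n (Q ∷ Qs)) (λ (t , w) → h (suc t) (w ++ D ∷ [])) ∙
    (⨁ (weaves⋆ (suc n) []) (λ w → h 0 (w ++ concat (Q ∷ Qs))) ∙
     ⨁ (splits Qs) (λ (A , B) → ⨁ (weaves⋆ (suc n) (Q ∷ A)) (λ w → h 0 (w ++ concat B))))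
      ≈⟨ ∙-congˡ (≈-sym (⨁-splits Q Qs _)) ⟩
    ⨁ (weaves n (Q ∷ Qs)) (λ (t , w) → h (suc t) (w ++ D ∷ [])) ∙
    ⨁ (splits (Q ∷ Qs)) (λ (A , B) → ⨁ (weaves⋆ (suc n) A) (λ w → h 0 (w ++ concat B))) ∎
    where
    shift : ∀ n → ⨁ (weaves n Qs) (λ (t , w) → h (suc t) (Q ++ w ++ D ∷ [])) ≈
                  ⨁ (weaves n Qs) (λ (t , w) → h (suc t) ((Q ++ w) ++ D ∷ []))
    shift n = ⨁-cong (weaves n Qs) (λ (t , w) → reflexive (cong (h (suc t)) (≡.sym (++-assoc Q w _))))

    shift₀ : ∀ n → ⨁ (splits Qs) (λ (A , B) → ⨁ (weaves n A) (λ (t , w) → h 0 (Q ++ (w ++ D ∷ []) ++ concat B))) ≈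
                   ⨁ (splits Qs) (λ (A , B) → ⨁ (weaves n A) (λ (t , w) → h 0 (((Q ++ w) ++ D ∷ []) ++ concat B)))
    shift₀ n = ⨁-cong (splits Qs) (λ (A , B) → ⨁-cong (weaves n A) (λ (t , w) → reflexive (cong (h 0)
      (≡.trans (≡.sym (++-assoc Q _ (concat B))) (cong (_++ concat B) (≡.sym (++-assoc Q w _)))))))

    -- Both sides are sorted by whether a word starts with `Q` or with `D`. The words starting with
    -- `D` have one down step fewer and are peeled in turn; for `n = 0` there is just one, which
    -- belongs to the split with `A` empty.
    front : ∀ n →
      (⨁ (weaves n Qs) (λ (t , w) → h (suc t) (Q ++ w ++ D ∷ [])) ∙
       ⨁ (splits Qs) (λ (A , B) → ⨁ (weaves n A) (λ (t , w) → h 0 (Q ++ (w ++ D ∷ []) ++ concat B)))) ∙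
      ⨁ (weaves n (Q ∷ Qs)) (λ (t , w) → h t (D ∷ w)) ≈
      ⨁ (weaves n (Q ∷ Qs)) (λ (t , w) → h (suc t) (w ++ D ∷ [])) ∙
      (⨁ (weaves n []) (λ (t , w) → h 0 ((w ++ D ∷ []) ++ concat (Q ∷ Qs))) ∙
       ⨁ (splits Qs) (λ (A , B) → ⨁ (weaves n (Q ∷ A)) (λ (t , w) → h 0 ((w ++ D ∷ []) ++ concat B))))
    front zero = begin
      (⨁ (weaves 0 Qs) (λ (t , w) → h (suc t) (Q ++ w ++ D ∷ [])) ∙
       ⨁ (splits Qs) (λ (A , B) → ⨁ (weaves 0 A) (λ (t , w) → h 0 (Q ++ (w ++ D ∷ []) ++ concat B)))) ∙
      ⨁ (weaves 0 (Q ∷ Qs)) (λ (t , w) → h t (D ∷ w))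
        ≈⟨ ∙-cong (∙-cong (≈-trans (shift 0) (≈-sym (⨁-weaves-zero Q Qs _)))
             (≈-trans (shift₀ 0) (⨁-cong (splits Qs) (λ (A , B) → ≈-sym (⨁-weaves-zero Q A _)))))
             (≈-trans (⨁-weaves-concat (Q ∷ Qs) _) (≈-sym (identityʳ _))) ⟩
      (⨁ (weaves 0 (Q ∷ Qs)) (λ (t , w) → h (suc t) (w ++ D ∷ [])) ∙
       ⨁ (splits Qs) (λ (A , B) → ⨁ (weaves 0 (Q ∷ A)) (λ (t , w) → h 0 ((w ++ D ∷ []) ++ concat B)))) ∙
      ⨁ (weaves 0 []) (λ (t , w) → h 0 ((w ++ D ∷ []) ++ concat (Q ∷ Qs)))
        ≈⟨ ≈-trans (assoc _ _ _) (∙-congˡ (comm _ _)) ⟩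
      _ ∎
    front (suc n) = begin
      (⨁ (weaves (suc n) Qs) (λ (t , w) → h (suc t) (Q ++ w ++ D ∷ [])) ∙
       ⨁ (splits Qs) (λ (A , B) → ⨁ (weaves (suc n) A) (λ (t , w) → h 0 (Q ++ (w ++ D ∷ []) ++ concat B)))) ∙
      ⨁ (weaves (suc n) (Q ∷ Qs)) (λ (t , w) → h t (D ∷ w))
        ≈⟨ ∙-cong (∙-cong (shift (suc n)) (shift₀ (suc n))) (⨁-weaves-peel n (Q ∷ Qs) (λ t w → h t (D ∷ w))) ⟩
      (⨁ (weaves (suc n) Qs) (λ (t , w) → h (suc t) ((Q ++ w) ++ D ∷ [])) ∙
       ⨁ (splits Qs) (λ (A , B) → ⨁ (weaves (suc n) A) (λ (t , w) → h 0 (((Q ++ w) ++ D ∷ []) ++ concat B)))) ∙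
      (⨁ (weaves n (Q ∷ Qs)) (λ (t , w) → h (suc t) (D ∷ w ++ D ∷ [])) ∙
       ⨁ (splits (Q ∷ Qs)) (λ (A , B) → ⨁ (weaves⋆ (suc n) A) (λ w → h 0 (D ∷ w ++ concat B))))
        ≈⟨ interchange _ _ _ _ ⟩
      (⨁ (weaves (suc n) Qs) (λ (t , w) → h (suc t) ((Q ++ w) ++ D ∷ [])) ∙
       ⨁ (weaves n (Q ∷ Qs)) (λ (t , w) → h (suc t) (D ∷ w ++ D ∷ []))) ∙
      (⨁ (splits Qs) (λ (A , B) → ⨁ (weaves (suc n) A) (λ (t , w) → h 0 (((Q ++ w) ++ D ∷ []) ++ concat B))) ∙
       ⨁ (splits (Q ∷ Qs)) (λ (A , B) → ⨁ (weaves⋆ (suc n) A) (λ w → h 0 (D ∷ w ++ concat B))))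
        ≈⟨ ∙-cong (≈-sym (⨁-weaves-suc n Q Qs _)) (∙-congˡ (≈-trans (⨁-splits Q Qs _)
             (∙-cong (⨁-weaves⋆ n [] (λ w → h 0 (D ∷ w ++ concat (Q ∷ Qs))))
             (⨁-cong (splits Qs) (λ (A , B) → ⨁-weaves⋆ n (Q ∷ A) _))))) ⟩
      ⨁ (weaves (suc n) (Q ∷ Qs)) (λ (t , w) → h (suc t) (w ++ D ∷ [])) ∙
      (⨁ (splits Qs) (λ (A , B) → ⨁ (weaves (suc n) A) (λ (t , w) → h 0 (((Q ++ w) ++ D ∷ []) ++ concat B))) ∙
       (⨁ (weaves n []) (λ (t , w) → h 0 (D ∷ (w ++ D ∷ []) ++ concat (Q ∷ Qs))) ∙
        ⨁ (splits Qs) (λ (A , B) → ⨁ (weaves n (Q ∷ A)) (λ (t , w) → h 0 (D ∷ (w ++ D ∷ []) ++ concat B)))))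
        ≈⟨ ∙-congˡ (≈-trans (≈-sym (assoc _ _ _)) (≈-trans (∙-congʳ (comm _ _)) (assoc _ _ _))) ⟩
      ⨁ (weaves (suc n) (Q ∷ Qs)) (λ (t , w) → h (suc t) (w ++ D ∷ [])) ∙
      (⨁ (weaves n []) (λ (t , w) → h 0 (D ∷ (w ++ D ∷ []) ++ concat (Q ∷ Qs))) ∙
       (⨁ (splits Qs) (λ (A , B) → ⨁ (weaves (suc n) A) (λ (t , w) → h 0 (((Q ++ w) ++ D ∷ []) ++ concat B))) ∙
        ⨁ (splits Qs) (λ (A , B) → ⨁ (weaves n (Q ∷ A)) (λ (t , w) → h 0 (D ∷ (w ++ D ∷ []) ++ concat B)))))
        ≈⟨ ∙-congˡ (∙-congˡ (≈-trans (≈-sym (⨁-∙ (splits Qs) _ _))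
             (⨁-cong (splits Qs) (λ (A , B) → ≈-sym (⨁-weaves-suc n Q A _))))) ⟩
      _ ∎

  -- Extends the peeling to zero down steps. There the only weave is the concatenation, which is the
  -- split with `A` empty; a factor must exist since `B` is nonempty.
  ⨁-weaves-end : ∀ n Q Qs (h : ℕ → Word → Carrier) →
    ⨁ (weaves n (Q ∷ Qs)) (λ (t , w) → h t w) ≈
    ⨁ (weaves⁺ n (Q ∷ Qs)) (λ (t , w) → h (suc t) w) ∙
    ⨁ (splits (Q ∷ Qs)) (λ (A , B) → ⨁ (weaves⋆ n A) (λ w → h 0 (w ++ concat B)))
  ⨁-weaves-end zero Q Qs h = begin
    ⨁ (weaves 0 (Q ∷ Qs)) (λ (t , w) → h t w)
      ≈⟨ ⨁-weaves-concat (Q ∷ Qs) _ ⟩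
    h 0 (concat (Q ∷ Qs))
      ≈⟨ ≈-trans (≈-sym (identityʳ _)) (≈-sym (identityʳ _)) ⟩
    (h 0 (concat (Q ∷ Qs)) ∙ ε) ∙ ε
      ≈⟨ ∙-congˡ (≈-sym (⨁-ε (splits Qs))) ⟩
    (h 0 (concat (Q ∷ Qs)) ∙ ε) ∙ ⨁ (splits Qs) (λ _ → ε)
      ≈⟨ ≈-trans (≈-sym (⨁-splits Q Qs _)) (≈-sym (identityˡ _)) ⟩
    ε ∙ ⨁ (splits (Q ∷ Qs)) (λ (A , B) → ⨁ (weaves⋆ 0 A) (λ w → h 0 (w ++ concat B))) ∎
  ⨁-weaves-end (suc n) Q Qs h = ≈-trans (⨁-weaves-peel n (Q ∷ Qs) h)
    (∙-congʳ (≈-sym (⨁-map _ (weaves n (Q ∷ Qs)) _)))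

  module _ {m : ℕ} where
    open TreeSums M m

    ⨁-dec-splits : ∀ (z : Tree m 0) (G : List Word → Word → Carrier) →
      ⨁ (dec z) (λ (a , b) → G (primesM a) (word b)) ≈
      ⨁ (splits (primesT z)) (λ (A , B) → G A (concat B))
    ⨁-dec-splits (node u nothing) G = ≈-refl
    ⨁-dec-splits z@(node u (just y)) G = begin
      ⨁ (dec z) (λ (a , b) → G (primesM a) (word b))
        ≈⟨ ⨁-dec-node u y _ ⟩
      G [] (word z) ∙ ⨁ (dec y) (λ (a , b) → G (stem u ∷ primesM a) (word b))
        ≈⟨ ∙-cong (reflexive (cong (G []) (≡.sym (concat-primesM (just z))))) (⨁-dec-splits y (λ A → G (stem u ∷ A))) ⟩
      G [] (concat (primesT z)) ∙ ⨁ (splits (primesT y)) (λ (A , B) → G (stem u ∷ A) (concat B))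
        ≈⟨ ≈-sym (⨁-splits (stem u) (primesT y) _) ⟩
      ⨁ (splits (primesT z)) (λ (A , B) → G A (concat B)) ∎

    -- Follows the clauses of `mul`. If slot `k` is filled, the factors go into the last run of its
    -- content. If it is empty, `⨁-weaves-end` decides: a closing down step means that the product
    -- takes place in `u` and slot `k` stays empty; otherwise the trailing factors fill slot `k`.
    mul-weaves : ∀ {k} (u : Tree m (suc k)) c z (h : ℕ → Word → Carrier) →
      ⨁ (mul (node u c) z) (λ (i , X) → h i (word X)) ≈
      ⨁ (weaves (descent (node u c)) (primesT z))
        (λ (t , w) → h (index (node u c) t) (prefix (node u c) ++ U ∷ w))
    mul-weaves⁺ : ∀ {k} (u : Tree m (suc k)) z (h : ℕ → Word → Carrier) →
      ⨁ (mul u z) (λ (i , X) → h i (stem X)) ≈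
      ⨁ (weaves⁺ (stemDescent u) (primesT z)) (λ (t , w) → h (index u t) (prefix u ++ U ∷ w))
    star-weaves⋆ : ∀ {k} (u : Tree m (suc k)) a (h : Word → Carrier) →
      ⨁ (star u a) (λ X → h (stem X)) ≈
      ⨁ (weaves⋆ (stemDescent u) (primesM a)) (λ w → h (prefix u ++ U ∷ w))

    mul-weaves {k} u nothing z@(node _ _) h = begin
      ⨁ (mul (node u nothing) z) (λ (i , X) → h i (word X))
        ≈⟨ ⨁-mul-nothing u z _ ⟩
      ⨁ (mul u z) (λ (i , X) → h i (stem X ++ [])) ∙
      ⨁ (dec z) (λ (a , b) → ⨁ (star u a) (λ X → h k (stem X ++ word b)))
        ≈⟨ ∙-cong (⨁-cong (mul u z) (λ (i , X) → reflexive (cong (h i) (++-identityʳ (stem X)))))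
             (⨁-cong (dec z) (λ (a , b) → star-weaves⋆ u a (λ w → h k (w ++ word b)))) ⟩
      ⨁ (mul u z) (λ (i , X) → h i (stem X)) ∙
      ⨁ (dec z) (λ (a , b) → ⨁ (weaves⋆ n (primesM a)) (λ w → h k ((P ++ U ∷ w) ++ word b)))
        ≈⟨ ∙-cong (mul-weaves⁺ u z h)
             (⨁-dec-splits z (λ A v → ⨁ (weaves⋆ n A) (λ w → h k ((P ++ U ∷ w) ++ v)))) ⟩
      ⨁ (weaves⁺ n (primesT z)) (λ (t , w) → h (index u t) (P ++ U ∷ w)) ∙
      ⨁ (splits (primesT z)) (λ (A , B) → ⨁ (weaves⋆ n A) (λ w → h k ((P ++ U ∷ w) ++ concat B)))
        ≈⟨ ∙-congˡ (⨁-cong (splits (primesT z)) (λ (A , B) → ⨁-cong (weaves⋆ n A) (λ w →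
             reflexive (cong (h k) (++-assoc P (U ∷ w) (concat B)))))) ⟩
      ⨁ (weaves⁺ n (primesT z)) (λ (t , w) → h (index u t) (P ++ U ∷ w)) ∙
      ⨁ (splits (primesT z)) (λ (A , B) → ⨁ (weaves⋆ n A) (λ w → h k (P ++ U ∷ w ++ concat B)))
        ≈⟨ ≈-sym (⨁-weaves-end n _ _ (λ t w → h (index (node u nothing) t) (P ++ U ∷ w))) ⟩
      ⨁ (weaves n (primesT z)) (λ (t , w) → h (index (node u nothing) t) (P ++ U ∷ w)) ∎
      where
      n = stemDescent u
      P = prefix u
    mul-weaves {k} u (just y@(node v c)) z h = begin
      ⨁ (mul (node u (just y)) z) (λ (i , X) → h i (word X))
        ≈⟨ ⨁-mul-just u y z _ ⟩
      ⨁ (mul y z) (λ (i , Y) → h (k ⊔ i) (stem u ++ word Y))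
        ≈⟨ mul-weaves v c z (λ i w → h (k ⊔ i) (stem u ++ w)) ⟩
      ⨁ (weaves (descent y) (primesT z)) (λ (t , w) → h (k ⊔ index y t) (stem u ++ prefix y ++ U ∷ w))
        ≈⟨ ⨁-cong (weaves (descent y) (primesT z)) (λ (t , w) →
             reflexive (cong (h (k ⊔ index y t)) (≡.sym (++-assoc (stem u) (prefix y) _)))) ⟩
      ⨁ (weaves (descent y) (primesT z)) (λ (t , w) → h (k ⊔ index y t) ((stem u ++ prefix y) ++ U ∷ w)) ∎

    mul-weaves⁺ root       z h = ≈-refl
    mul-weaves⁺ (node u c) z h = begin
      ⨁ (mul (node u c) z) (λ (i , X) → h i (stem X))
        ≈⟨ ⨁-cong-All (All.map (λ {(i , X)} eq → reflexive (cong (h i) eq)) (mul-stem (node u c) z)) ⟩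
      ⨁ (mul (node u c) z) (λ (i , X) → h i (word X ++ D ∷ []))
        ≈⟨ mul-weaves u c z (λ i w → h i (w ++ D ∷ [])) ⟩
      ⨁ (weaves n (primesT z)) (λ (t , w) → h (index (node u c) t) ((P ++ U ∷ w) ++ D ∷ []))
        ≈⟨ ⨁-cong (weaves n (primesT z)) (λ (t , w) →
             reflexive (cong (h (index (node u c) t)) (++-assoc P (U ∷ w) _))) ⟩
      ⨁ (weaves n (primesT z)) (λ (t , w) → h (index (node u c) t) (P ++ U ∷ w ++ D ∷ []))
        ≈⟨ ≈-sym (⨁-map _ (weaves n (primesT z)) _) ⟩
      ⨁ (weaves⁺ (suc n) (primesT z)) (λ (t , w) → h (index (node u c) t) (P ++ U ∷ w)) ∎
      where
      n = descent (node u c)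
      P = prefix (node u c)

    star-weaves⋆ root       nothing h = ≈-refl
    star-weaves⋆ (node u c) nothing h = ∙-congʳ (reflexive (cong h (≡.trans (stem-prefix (node u c))
      (cong (λ w → prefix (node u c) ++ U ∷ w)
        (≡.sym (≡.trans (replicate-∷ʳ n []) (cong (D ∷_) (++-identityʳ (replicate n D)))))))))
      where n = descent (node u c)
    star-weaves⋆ root (just (node _ _)) h = ≈-refl
    star-weaves⋆ u@(node _ _) (just z) h = begin
      ⨁ (star u (just z)) (λ X → h (stem X))
        ≈⟨ ⨁-star u z _ ⟩
      ⨁ (mul u z) (λ (i , X) → h (stem X))
        ≈⟨ mul-weaves⁺ u z (λ _ → h) ⟩
      ⨁ (weaves⁺ (stemDescent u) (primesT z)) (λ (t , w) → h (prefix u ++ U ∷ w))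
        ≈⟨ ≈-sym (⨁-map proj₂ (weaves⁺ (stemDescent u) (primesT z)) _) ⟩
      ⨁ (weaves⋆ (stemDescent u) (primesT z)) (λ w → h (prefix u ++ U ∷ w)) ∎

-- The products of Defs on words of trees

T-ext : ∀ {x y} → (T x → T y) → (T y → T x) → x ≡ y
T-ext {false} {false} f g = refl
T-ext {false} {true}  f g = ⊥-elim (g _)
T-ext {true}  {false} f g = ⊥-elim (f _)
T-ext {true}  {true}  f g = refl

T⇒≡ : ∀ {b} → T b → b ≡ true
T⇒≡ = Equivalence.to T-≡

¬T⇒≡ : ∀ {b} → ¬ T b → b ≡ false
¬T⇒≡ {false} _ = refl
¬T⇒≡ {true}  p = ⊥-elim (p _)

leadingDs-reverse : ∀ w n → leadingDs (reverse (w ++ replicate n D)) ≡ n + leadingDs (reverse w)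
leadingDs-reverse w zero    = cong (leadingDs ∘ reverse) (++-identityʳ w)
leadingDs-reverse w (suc n) = begin
  leadingDs (reverse (w ++ D ∷ replicate n D))           ≡⟨ cong (leadingDs ∘ reverse) (sym (++-assoc w (D ∷ []) _)) ⟩
  leadingDs (reverse ((w ++ D ∷ []) ++ replicate n D))   ≡⟨ leadingDs-reverse (w ++ D ∷ []) n ⟩
  n + leadingDs (reverse (w ++ D ∷ []))                  ≡⟨ cong (λ v → n + leadingDs v) (reverse-++ w (D ∷ [])) ⟩
  n + suc (leadingDs (reverse w))                        ≡⟨ ℕ.+-suc n _ ⟩
  suc n + leadingDs (reverse w)                          ∎
  where open ≡-Reasoning

trailingDs-descent : ∀ w n → trailingDs (w ++ U ∷ replicate n D) ≡ n
trailingDs-descent w n = begin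
  trailingDs (w ++ U ∷ replicate n D)                    ≡⟨ trailingDs-reverse (w ++ U ∷ replicate n D) ⟩
  leadingDs (reverse (w ++ U ∷ replicate n D))           ≡⟨ cong (leadingDs ∘ reverse) (sym (++-assoc w (U ∷ []) _)) ⟩
  leadingDs (reverse ((w ++ U ∷ []) ++ replicate n D))   ≡⟨ leadingDs-reverse (w ++ U ∷ []) n ⟩
  n + leadingDs (reverse (w ++ U ∷ []))                  ≡⟨ cong (λ v → n + leadingDs v) (reverse-++ w (U ∷ [])) ⟩
  n + 0                                                  ≡⟨ ℕ.+-identityʳ n ⟩
  n                                                      ∎
  where open ≡-Reasoning

module _ {a} {A : Set a} where

  take-++ : ∀ (xs ys : List A) → take (length (xs ++ ys) ∸ length ys) (xs ++ ys) ≡ xs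
  take-++ xs ys = begin
    take (length (xs ++ ys) ∸ length ys) (xs ++ ys)      ≡⟨ cong (λ n → take (n ∸ length ys) (xs ++ ys)) (length-++ xs) ⟩
    take (length xs + length ys ∸ length ys) (xs ++ ys)  ≡⟨ cong (λ n → take n (xs ++ ys)) (ℕ.m+n∸n≡m (length xs) (length ys)) ⟩
    take (length xs) (xs ++ ys)                          ≡⟨ go xs ⟩
    xs                                                   ∎
    where
    open ≡-Reasoning
    go : ∀ xs → take (length xs) (xs ++ ys) ≡ xs
    go []       = refl
    go (x ∷ xs) = cong (x ∷_) (go xs)

  drop-++ : ∀ (xs ys : List A) → drop (length (xs ++ ys) ∸ length ys) (xs ++ ys) ≡ ys
  drop-++ xs ys = begin
    drop (length (xs ++ ys) ∸ length ys) (xs ++ ys)      ≡⟨ cong (λ n → drop (n ∸ length ys) (xs ++ ys)) (length-++ xs) ⟩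
    drop (length xs + length ys ∸ length ys) (xs ++ ys)  ≡⟨ cong (λ n → drop n (xs ++ ys)) (ℕ.m+n∸n≡m (length xs) (length ys)) ⟩
    drop (length xs) (xs ++ ys)                          ≡⟨ go xs ⟩
    ys                                                   ∎
    where
    open ≡-Reasoning
    go : ∀ xs → drop (length xs) (xs ++ ys) ≡ ys
    go []       = refl
    go (x ∷ xs) = go xs

cross-replicate : ∀ j P Q → cross j (P ++ replicate j D) Q ≡ P ++ Q ++ replicate j D
cross-replicate j P Q = cong (_++ Q ++ replicate j D) (trans
  (cong (λ n → take (length (P ++ replicate j D) ∸ n) (P ++ replicate j D)) (sym (length-replicate j)))
  (take-++ P (replicate j D)))

replicate-+ : ∀ a b → replicate (a + b) D ≡ replicate a D ++ replicate b D
replicate-+ zero    b = refl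
replicate-+ (suc a) b = cong (D ∷_) (replicate-+ a b)

weakComps-spec : ∀ r n → All (λ ls → sum ls ≡ n × (∀ a → lastOr0 (a ∷ ls) ≡ lastOr0 ls)) (weakComps (suc r) n)
weakComps-spec zero    n = (ℕ.+-identityʳ n , λ a → refl) ∷ []
weakComps-spec (suc r) n = All.concat⁺ (All.map⁺ (All.map
  (λ {a} a≤n → All.map⁺ (All.map
    (λ (p , _) → trans (cong (a +_) p) (ℕ.m+[n∸m]≡n (ℕ.≤-pred a≤n)) , λ _ → refl)
    (weakComps-spec r (n ∸ a))))
  (All.all-upTo (suc n))))

weaves-≤ : ∀ n Qs → All (λ (t , w) → t ≤ n) (weaves n Qs)
weaves-≤ n []       = ≤-refl ∷ []
weaves-≤ n (Q ∷ Qs) = All.concat⁺ (All.map⁺ (All.universal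
  (λ a → All.map⁺ (All.map (λ t≤ → ≤-trans t≤ (ℕ.m∸n≤m n a)) (weaves-≤ (n ∸ a) Qs))) (upTo (suc n))))

-- Prime factors and colours of the word of a tree

module _ {m : ℕ} where

  size  : ∀ {k} → Tree m k → ℕ
  sizeM : Maybe (Tree m 0) → ℕ
  size root       = 1
  size (node u c) = size u + sizeM c
  sizeM nothing  = 0
  sizeM (just y) = size y

  size>0 : ∀ {k} (u : Tree m k) → 1 ≤ size u
  size>0 root       = ≤-refl
  size>0 (node u c) = ≤-trans (size>0 u) (ℕ.m≤m+n _ _)

  -- The bound means that no down step of the stem reaches the axis, so no prime is emitted while it
  -- is read. A stem that does end on the axis is a whole prime; `splitPrimes-word` treats it.
  splitPrimes-stem : ∀ {k} (u : Tree m (suc k)) h acc w → 1 ≤ h + k →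
    splitPrimes m h acc (stem u ++ w) ≡ splitPrimes m (h + k) (stem u ʳ++ acc) w
  splitPrimes-wordM : ∀ (c : Maybe (Tree m 0)) h acc w → 1 ≤ h →
    splitPrimes m h acc (wordM c ++ w) ≡ splitPrimes m h (wordM c ʳ++ acc) w
  splitPrimes-stem root h acc w _ = refl
  splitPrimes-stem {k} (node u c) h acc w 1≤ = begin
    splitPrimes m h acc (((stem u ++ wordM c) ++ D ∷ []) ++ w)
      ≡⟨ cong (splitPrimes m h acc) (trans (++-assoc (stem u ++ wordM c) _ w) (++-assoc (stem u) (wordM c) (D ∷ w))) ⟩
    splitPrimes m h acc (stem u ++ wordM c ++ D ∷ w)
      ≡⟨ splitPrimes-stem u h acc _ (≤-trans (s≤s z≤n) (ℕ.m≤n+m (suc k) h)) ⟩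
    splitPrimes m (h + suc k) (stem u ʳ++ acc) (wordM c ++ D ∷ w)
      ≡⟨ splitPrimes-wordM c (h + suc k) _ _ (≤-trans (s≤s z≤n) (ℕ.m≤n+m (suc k) h)) ⟩
    splitPrimes m (h + suc k) (wordM c ʳ++ stem u ʳ++ acc) (D ∷ w)
      ≡⟨ down (trans (ℕ.+-suc h k) (cong suc (sym (ℕ.m+[n∸m]≡n 1≤)))) (ℕ.m+[n∸m]≡n 1≤) ⟩
    splitPrimes m (h + k) (D ∷ wordM c ʳ++ stem u ʳ++ acc) w
      ≡⟨ cong (λ v → splitPrimes m (h + k) (D ∷ v) w) (sym (++-ʳ++ (stem u))) ⟩
    splitPrimes m (h + k) (D ∷ (stem u ++ wordM c) ʳ++ acc) w
      ≡⟨ cong (λ v → splitPrimes m (h + k) v w) (sym (++-ʳ++ (stem u ++ wordM c))) ⟩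
    splitPrimes m (h + k) (((stem u ++ wordM c) ++ D ∷ []) ʳ++ acc) w ∎
    where
    open ≡-Reasoning
    down : ∀ {g g₁ g₂ v} → g₁ ≡ suc (suc g) → suc g ≡ g₂ →
           splitPrimes m g₁ v (D ∷ w) ≡ splitPrimes m g₂ (D ∷ v) w
    down refl refl = refl
  splitPrimes-wordM nothing           h acc w 1≤h = refl
  splitPrimes-wordM (just (node u c)) h acc w 1≤h = begin
    splitPrimes m h acc ((stem u ++ wordM c) ++ w)
      ≡⟨ cong (splitPrimes m h acc) (++-assoc (stem u) (wordM c) w) ⟩
    splitPrimes m h acc (stem u ++ wordM c ++ w)
      ≡⟨ splitPrimes-stem u h acc _ (≤-trans 1≤h (ℕ.m≤m+n h 0)) ⟩
    splitPrimes m (h + 0) (stem u ʳ++ acc) (wordM c ++ w)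
      ≡⟨ cong (λ g → splitPrimes m g (stem u ʳ++ acc) (wordM c ++ w)) (ℕ.+-identityʳ h) ⟩
    splitPrimes m h (stem u ʳ++ acc) (wordM c ++ w)
      ≡⟨ splitPrimes-wordM c h _ w 1≤h ⟩
    splitPrimes m h (wordM c ʳ++ stem u ʳ++ acc) w
      ≡⟨ cong (λ v → splitPrimes m h v w) (sym (++-ʳ++ (stem u))) ⟩
    splitPrimes m h ((stem u ++ wordM c) ʳ++ acc) w ∎
    where open ≡-Reasoning

  splitPrimes-word : 1 ≤ m → ∀ (c : Maybe (Tree m 0)) → splitPrimes m 0 [] (wordM c) ≡ primesM c
  -- A prime without down steps exists only for `m = 0`; the scanner, which ends primes at down
  -- steps, would not find its end.
  splitPrimes-word () (just (node root c))
  splitPrimes-word _   nothing = refl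
  splitPrimes-word 1≤m (just (node u@(node v b) c)) = begin
    splitPrimes m 0 [] (stem u ++ wordM c)
      ≡⟨ cong (splitPrimes m 0 []) (trans (++-assoc (stem v ++ wordM b) _ (wordM c)) (++-assoc (stem v) (wordM b) _)) ⟩
    splitPrimes m 0 [] (stem v ++ wordM b ++ D ∷ wordM c)
      ≡⟨ splitPrimes-stem v 0 [] _ ≤-refl ⟩
    splitPrimes m 1 (stem v ʳ++ []) (wordM b ++ D ∷ wordM c)
      ≡⟨ splitPrimes-wordM b 1 _ _ ≤-refl ⟩
    reverse (D ∷ wordM b ʳ++ stem v ʳ++ []) ∷ splitPrimes m 0 [] (wordM c)
      ≡⟨ cong₂ _∷_ eq (splitPrimes-word 1≤m c) ⟩
    stem u ∷ primesM c ∎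
    where
    open ≡-Reasoning
    eq : reverse (D ∷ wordM b ʳ++ stem v ʳ++ []) ≡ stem u
    eq = begin
      reverse (D ∷ wordM b ʳ++ stem v ʳ++ [])      ≡⟨ cong (λ x → reverse (D ∷ x)) (sym (++-ʳ++ (stem v))) ⟩
      reverse (D ∷ reverse (stem v ++ wordM b))    ≡⟨ cong reverse (sym (reverse-++ (stem v ++ wordM b) (D ∷ []))) ⟩
      reverse (reverse (stem u))                   ≡⟨ reverse-involutive (stem u) ⟩
      stem u                                       ∎

  primes-word : 1 ≤ m → ∀ (z : Tree m 0) → primes m (word z) ≡ primesT z
  primes-word 1≤m z@(node u c) = trans (primes-split m (word z)) (splitPrimes-word 1≤m (just z))

  -- All down steps of a root have the rank `r` of its up step as colour: the trees in the slots lie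
  -- above the half-lines in question. Ranks in a slot start after the `size u` up steps before it.
  stemColors  : ∀ {k} → ℕ → Tree m (suc k) → List ℕ
  wordColors  : ∀ {k} → ℕ → Tree m k → List ℕ
  wordMColors : ℕ → Maybe (Tree m 0) → List ℕ
  stemColors r root       = []
  stemColors r (node u c) = wordColors r (node u c) ++ r ∷ []
  wordColors r root       = []
  wordColors r (node u c) = stemColors r u ++ wordMColors (r + size u) c
  wordMColors r nothing  = []
  wordMColors r (just y) = wordColors r y

  -- The invariant on the recorded up steps: at the `k` levels still open the half-line meets the up
  -- step of the root, and below the starting height it meets what it met before. Trees already read
  -- into slots lie higher and hide nothing.
  colorsFrom-stem : ∀ {k} r h us (u : Tree m (suc k)) w → ∃ λ us′ →
    (∀ g → g < k → findColor m (h + g) us′ ≡ r) ×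
    (∀ g → g < h → findColor m g us′ ≡ findColor m g us) ×
    colorsFrom m r h us (stem u ++ w) ≡ stemColors r u ++ colorsFrom m (r + size u) (h + k) us′ w
  colorsFrom-wordM : ∀ r h us (c : Maybe (Tree m 0)) w → ∃ λ us′ →
    (∀ g → g < h → findColor m g us′ ≡ findColor m g us) ×
    colorsFrom m r h us (wordM c ++ w) ≡ wordMColors r c ++ colorsFrom m (r + sizeM c) h us′ w
  colorsFrom-stem r h us root w =
    (r , h) ∷ us ,
    (λ g g<m → cong (λ b → if b then r else findColor m (h + g) us)
      (T⇒≡ (Equivalence.from T-∧ (ℕ.≤⇒≤ᵇ (ℕ.m≤m+n h g) , ℕ.≤⇒≤ᵇ (ℕ.+-monoʳ-< h g<m))))) ,
    (λ g g<h → cong (λ b → if b ∧ (suc g ≤ᵇ h + m) then r else findColor m g us)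
      (¬T⇒≡ (λ h≤g → ℕ.<⇒≱ g<h (ℕ.≤ᵇ⇒≤ h g h≤g)))) ,
    cong (λ s → colorsFrom m s (h + m) ((r , h) ∷ us) w) (sym (ℕ.+-comm r 1))
  colorsFrom-stem {k} r h us (node u c) w
    with colorsFrom-stem r h us u (wordM c ++ D ∷ w)
  ... | us₁ , new₁ , old₁ , eq₁
    with colorsFrom-wordM (r + size u) (h + suc k) us₁ c (D ∷ w)
  ... | us₂ , old₂ , eq₂ =
    us₂ ,
    (λ g g<k → trans (old₂ (h + g) (ℕ.+-monoʳ-< h (ℕ.m≤n⇒m≤1+n g<k))) (new₁ g (ℕ.m≤n⇒m≤1+n g<k))) ,
    (λ g g<h → trans (old₂ g (≤-trans g<h (ℕ.m≤m+n h _))) (old₁ g g<h)) ,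
    (begin
      colorsFrom m r h us (((stem u ++ wordM c) ++ D ∷ []) ++ w)
        ≡⟨ cong (colorsFrom m r h us) (trans (++-assoc (stem u ++ wordM c) _ w) (++-assoc (stem u) (wordM c) (D ∷ w))) ⟩
      colorsFrom m r h us (stem u ++ wordM c ++ D ∷ w)
        ≡⟨ eq₁ ⟩
      stemColors r u ++ colorsFrom m (r + size u) (h + suc k) us₁ (wordM c ++ D ∷ w)
        ≡⟨ cong (stemColors r u ++_) eq₂ ⟩
      stemColors r u ++ cs ++ colorsFrom m s (h + suc k) us₂ (D ∷ w)
        ≡⟨ cong (λ g → stemColors r u ++ cs ++ findColor m g us₂ ∷ colorsFrom m s g us₂ w) (cong (_∸ 1) (ℕ.+-suc h k)) ⟩
      stemColors r u ++ cs ++ findColor m (h + k) us₂ ∷ colorsFrom m s (h + k) us₂ w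
        ≡⟨ cong (λ x → stemColors r u ++ cs ++ x ∷ colorsFrom m s (h + k) us₂ w)
             (trans (old₂ (h + k) (ℕ.+-monoʳ-< h ≤-refl)) (new₁ k ≤-refl)) ⟩
      stemColors r u ++ cs ++ r ∷ colorsFrom m s (h + k) us₂ w
        ≡⟨ cong (λ x → stemColors r u ++ cs ++ r ∷ colorsFrom m x (h + k) us₂ w) (ℕ.+-assoc r (size u) (sizeM c)) ⟩
      stemColors r u ++ cs ++ r ∷ rest
        ≡⟨ sym (trans (++-assoc (stemColors r u ++ cs) _ rest) (++-assoc (stemColors r u) cs _)) ⟩
      ((stemColors r u ++ cs) ++ r ∷ []) ++ rest ∎)
    where
    open ≡-Reasoning
    s    = r + size u + sizeM c
    cs   = wordMColors (r + size u) c
    rest = colorsFrom m (r + size (node u c)) (h + k) us₂ w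
  colorsFrom-wordM r h us nothing  w =
    us , (λ _ _ → refl) , cong (λ s → colorsFrom m s h us w) (sym (ℕ.+-identityʳ r))
  colorsFrom-wordM r h us (just (node u c)) w
    with colorsFrom-stem r h us u (wordM c ++ w)
  ... | us₁ , _ , old₁ , eq₁
    with colorsFrom-wordM (r + size u) h us₁ c w
  ... | us₂ , old₂ , eq₂ =
    us₂ ,
    (λ g g<h → trans (old₂ g g<h) (old₁ g g<h)) ,
    (begin
      colorsFrom m r h us ((stem u ++ wordM c) ++ w)
        ≡⟨ cong (colorsFrom m r h us) (++-assoc (stem u) (wordM c) w) ⟩
      colorsFrom m r h us (stem u ++ wordM c ++ w)
        ≡⟨ eq₁ ⟩
      stemColors r u ++ colorsFrom m (r + size u) (h + 0) us₁ (wordM c ++ w)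
        ≡⟨ cong (λ g → stemColors r u ++ colorsFrom m (r + size u) g us₁ (wordM c ++ w)) (ℕ.+-identityʳ h) ⟩
      stemColors r u ++ colorsFrom m (r + size u) h us₁ (wordM c ++ w)
        ≡⟨ cong (stemColors r u ++_) eq₂ ⟩
      stemColors r u ++ cs ++ colorsFrom m (r + size u + sizeM c) h us₂ w
        ≡⟨ sym (++-assoc (stemColors r u) cs _) ⟩
      (stemColors r u ++ cs) ++ colorsFrom m (r + size u + sizeM c) h us₂ w
        ≡⟨ cong (λ s → (stemColors r u ++ cs) ++ colorsFrom m s h us₂ w) (ℕ.+-assoc r (size u) (sizeM c)) ⟩
      (stemColors r u ++ cs) ++ colorsFrom m (r + size (node u c)) h us₂ w ∎)
    where
    open ≡-Reasoning
    cs = wordMColors (r + size u) c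

  colors-word : ∀ (z : Tree m 0) → colors m (word z) ≡ wordColors 1 z
  colors-word z with colorsFrom-wordM 1 0 [] (just z) []
  ... | us , _ , eq = begin
    colors m (word z)                      ≡⟨ colors-from m (word z) ⟩
    colorsFrom m 1 0 [] (word z)           ≡⟨ cong (colorsFrom m 1 0 []) (sym (++-identityʳ (word z))) ⟩
    colorsFrom m 1 0 [] (word z ++ [])     ≡⟨ eq ⟩
    wordColors 1 z ++ []                   ≡⟨ ++-identityʳ _ ⟩
    wordColors 1 z                         ∎
    where open ≡-Reasoning

  tailColors : ∀ {k} → ℕ → Tree m k → ℕ → List ℕ
  tailColors r root              t       = []
  tailColors r (node u nothing)  zero    = []
  tailColors r (node u nothing)  (suc t) = tailColors r u t ++ r ∷ []
  tailColors r (node u (just y)) t       = tailColors (r + size u) y t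

  tailColors-suffix : ∀ {k} r (u : Tree m (suc k)) c t → t ≤ descent (node u c) → ∃ λ cs →
    wordColors r (node u c) ≡ cs ++ tailColors r (node u c) t × length (tailColors r (node u c) t) ≡ t
  tailColors-suffix r u nothing zero _ = stemColors r u , refl , refl
  tailColors-suffix r u@(node v b) nothing (suc t) (s≤s t≤)
    with tailColors-suffix r v b t t≤
  ... | cs , eq , len =
    cs ,
    trans (++-identityʳ _) (trans (cong (_++ r ∷ []) eq) (++-assoc cs _ _)) ,
    trans (length-++ (tailColors r u t)) (trans (ℕ.+-comm _ 1) (cong suc len))
  tailColors-suffix r u (just (node v b)) t t≤
    with tailColors-suffix (r + size u) v b t t≤
  ... | cs , eq , len =
    stemColors r u ++ cs ,
    trans (cong (stemColors r u ++_) eq) (sym (++-assoc (stemColors r u) cs _)) ,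
    len

  lastColors-word : ∀ (z : Tree m 0) t → t ≤ descent z → lastColors m (word z) t ≡ tailColors 1 z t
  lastColors-word z@(node u c) t t≤ with tailColors-suffix 1 u c t t≤
  ... | cs , eq , len = begin
    lastColors m (word z) t                                        ≡⟨ cong (λ v → drop (length v ∸ t) v) (trans (colors-word z) eq) ⟩
    drop (length (cs ++ ts) ∸ t) (cs ++ ts)                        ≡⟨ cong (λ s → drop (length (cs ++ ts) ∸ s) (cs ++ ts)) (sym len) ⟩
    drop (length (cs ++ ts) ∸ length ts) (cs ++ ts)                ≡⟨ drop-++ cs ts ⟩
    ts                                                             ∎
    where
    open ≡-Reasoning
    ts = tailColors 1 z t

  tailColors-≥ : ∀ {k} r (u : Tree m k) t → All (r ≤_) (tailColors r u t)
  tailColors-≥ r root              t       = []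
  tailColors-≥ r (node u nothing)  zero    = []
  tailColors-≥ r (node u nothing)  (suc t) = All.++⁺ (tailColors-≥ r u t) (≤-refl ∷ [])
  tailColors-≥ r (node u (just y)) t       =
    All.map (≤-trans (ℕ.m≤m+n r (size u))) (tailColors-≥ (r + size u) y t)

-- Multiplicities of colours and the index of a product

count-++ : ∀ c v w → count c (v ++ w) ≡ count c v + count c w
count-++ c []      w = refl
count-++ c (x ∷ v) w = trans (cong ((if c ≡ᵇ x then 1 else 0) +_) (count-++ c v w)) (sym (ℕ.+-assoc (if c ≡ᵇ x then 1 else 0) (count c v) (count c w)))

count-∉ : ∀ c w → All (λ x → ¬ c ≡ x) w → count c w ≡ 0
count-∉ c []      []       = refl
count-∉ c (x ∷ w) (p ∷ ps) = cong₂ _+_ (cong (if_then 1 else 0) (¬T⇒≡ (p ∘ ℕ.≡ᵇ⇒≡ c x))) (count-∉ c w ps)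

count-replicate : ∀ r k → count r (replicate k r) ≡ k
count-replicate r zero    = refl
count-replicate r (suc k) = cong₂ _+_ (cong (if_then 1 else 0) (T⇒≡ (ℕ.≡⇒≡ᵇ r r refl))) (count-replicate r k)

count-∈ : ∀ c w → ¬ count c w ≡ 0 → c ∈ w
count-∈ c []      p = ⊥-elim (p refl)
count-∈ c (x ∷ w) p with c ≡ᵇ x in eq
... | true  = here (ℕ.≡ᵇ⇒≡ c x (subst T (sym eq) _))
... | false = there (count-∈ c w p)

-- The alternative `n ≡ 0` follows the convention of `multCond` that multiplicity 0 counts as
-- attained.
IsMaxMultiplicity : ℕ → List ℕ → Set
IsMaxMultiplicity n w = (∀ c → count c w ≤ n) × (n ≡ 0 ⊎ ∃ λ c → count c w ≡ n)

-- A maximum is unique. The quantifiers of `multCond` range over the letters of the word only, which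
-- suffices because a colour of nonzero count is a letter, by `count-∈`.
multCond-isMax : ∀ {n w} i → IsMaxMultiplicity n w → multCond i w ≡ (n ≡ᵇ i)
multCond-isMax {n} {w} i (bound , attained) = T-ext to from
  where
  n≤i : n ≡ 0 ⊎ ∃ (λ c → count c w ≡ n) → All (λ c → T (count c w ≤ᵇ i)) w → n ≤ i
  n≤i (inj₁ n≡0)      ps = subst (_≤ i) (sym n≡0) z≤n
  n≤i (inj₂ (c , eq)) ps with n ℕ.≟ 0
  ... | yes n≡0 = subst (_≤ i) (sym n≡0) z≤n
  ... | no  n≢0 = subst (_≤ i) eq (ℕ.≤ᵇ⇒≤ _ _ (All.lookup ps (count-∈ c w (n≢0 ∘ trans (sym eq)))))

  i≤n : T (i ≡ᵇ 0) ⊎ T (BoolList.any (λ c → count c w ≡ᵇ i) w) → i ≤ n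
  i≤n (inj₁ p) = subst (_≤ n) (sym (ℕ.≡ᵇ⇒≡ i 0 p)) z≤n
  i≤n (inj₂ p) with Any.satisfied (Any.any⁻ (λ c → count c w ≡ᵇ i) w p)
  ... | c , q = subst (_≤ n) (ℕ.≡ᵇ⇒≡ _ i q) (bound c)

  to : T (multCond i w) → T (n ≡ᵇ i)
  to p with Equivalence.to T-∧ p
  ... | ps , q = ℕ.≡⇒≡ᵇ n i (ℕ.≤-antisym (n≤i attained (All.all⁺ _ w ps)) (i≤n (Equivalence.to T-∨ q)))

  exact : n ≡ 0 ⊎ ∃ (λ c → count c w ≡ n) → n ≡ i → T (i ≡ᵇ 0) ⊎ T (BoolList.any (λ c → count c w ≡ᵇ i) w)
  exact (inj₁ n≡0)      n≡i = inj₁ (ℕ.≡⇒≡ᵇ i 0 (trans (sym n≡i) n≡0))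
  exact (inj₂ (c , eq)) n≡i with i ℕ.≟ 0
  ... | yes i≡0 = inj₁ (ℕ.≡⇒≡ᵇ i 0 i≡0)
  ... | no  i≢0 = inj₂ (Any.any⁺ _ (lose
          (count-∈ c w (i≢0 ∘ trans (sym (trans eq n≡i)))) (ℕ.≡⇒≡ᵇ _ _ (trans eq n≡i))))

  from : T (n ≡ᵇ i) → T (multCond i w)
  from p = Equivalence.from T-∧
    ( All.all⁻ _ (All.universal (λ c → ℕ.≤⇒≤ᵇ (≤-trans (bound c) (ℕ.≤-reflexive n≡i))) w)
    , Equivalence.from T-∨ (exact attained n≡i))
    where n≡i = ℕ.≡ᵇ⇒≡ n i p

isMax-replicate : ∀ r k → IsMaxMultiplicity k (replicate k r)
isMax-replicate r k = le k , inj₂ (r , count-replicate r k)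
  where
  le : ∀ k c → count c (replicate k r) ≤ k
  le zero    c = z≤n
  le (suc k) c with c ≡ᵇ r
  ... | true  = s≤s (le k c)
  ... | false = ℕ.m≤n⇒m≤1+n (le k c)

-- The colour `r` is new, so its multiplicity `k` merely competes with the old maximum. This is
-- where the maximum in the tags comes from.
isMax-⊔ : ∀ {n w} r k → All (r <_) w → IsMaxMultiplicity n w → IsMaxMultiplicity (k ⊔ n) (w ++ replicate k r)
isMax-⊔ {n} {w} r k r<w (bound , attained) = le , attain attained
  where
  r∉w : count r w ≡ 0
  r∉w = count-∉ r w (All.map ℕ.<⇒≢ r<w)

  c∉k : ∀ {c} → ¬ c ≡ r → count c (replicate k r) ≡ 0
  c∉k {c} c≢r = count-∉ c (replicate k r) (All.replicate⁺ k c≢r)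

  count-r : count r (w ++ replicate k r) ≡ k
  count-r = trans (count-++ r w _) (cong₂ _+_ r∉w (count-replicate r k))

  count-c : ∀ {c} → ¬ c ≡ r → count c (w ++ replicate k r) ≡ count c w
  count-c {c} c≢r = trans (count-++ c w _) (trans (cong (count c w +_) (c∉k c≢r)) (ℕ.+-identityʳ _))

  le : ∀ c → count c (w ++ replicate k r) ≤ k ⊔ n
  le c with c ℕ.≟ r
  ... | yes refl = subst (_≤ k ⊔ n) (sym count-r) (ℕ.m≤m⊔n k n)
  ... | no  c≢r  = subst (_≤ k ⊔ n) (sym (count-c c≢r)) (≤-trans (bound c) (ℕ.m≤n⊔m k n))

  attain : n ≡ 0 ⊎ ∃ (λ c → count c w ≡ n) → k ⊔ n ≡ 0 ⊎ ∃ λ c → count c (w ++ replicate k r) ≡ k ⊔ n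
  attain (inj₁ refl) = inj₂ (r , trans count-r (sym (ℕ.⊔-identityʳ k)))
  attain (inj₂ (c , refl)) with ℕ.≤-total k (count c w) | c ℕ.≟ r
  ... | inj₂ n≤k | _ = inj₂ (r , trans count-r (sym (ℕ.m≥n⇒m⊔n≡m n≤k)))
  ... | inj₁ k≤n | no c≢r = inj₂ (c , trans (count-c c≢r) (sym (ℕ.m≤n⇒m⊔n≡n k≤n)))
  ... | inj₁ k≤n | yes refl = inj₂ (r , trans count-r (sym (ℕ.m≥n⇒m⊔n≡m (subst (_≤ k) (sym r∉w) z≤n))))

module _ {m : ℕ} where

  -- The `k` down steps still to come after a partial tree have the colour `r` of its root and must
  -- be counted with the others. Appending them makes the statement for an empty slot that of the
  -- next slot up.
  index-isMax : ∀ {k} r (u : Tree m (suc k)) c t → t ≤ descent (node u c) →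
    IsMaxMultiplicity (index (node u c) t) (tailColors r (node u c) t ++ replicate k r)
  index-isMax {k} r u nothing zero _ = isMax-replicate r k
  index-isMax {k} r (node v b) nothing (suc t) (s≤s t≤) =
    subst (IsMaxMultiplicity _) (sym (++-assoc (tailColors r (node v b) t) (r ∷ []) _)) (index-isMax r v b t t≤)
  index-isMax {k} r u (just y@(node v b)) t t≤ = isMax-⊔ r k
    (All.map (≤-trans (subst (_≤ r + size u) (ℕ.+-comm r 1) (ℕ.+-monoʳ-≤ r (size>0 u)))) (tailColors-≥ (r + size u) y t))
    (subst (IsMaxMultiplicity _) (++-identityʳ (tailColors (r + size u) y t)) (index-isMax (r + size u) v b t t≤))

  multCond-index : ∀ i (z : Tree m 0) t → t ≤ descent z →
    multCond i (lastColors m (word z) t) ≡ (index z t ≡ᵇ i)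
  multCond-index i z@(node u c) t t≤ = trans
    (cong (multCond i) (trans (lastColors-word z t t≤) (sym (++-identityʳ _))))
    (multCond-isMax {w = tailColors 1 z t ++ []} i (index-isMax 1 u c t t≤))

-- Products of paths as products of trees

module PathSums {c ℓ} (M : CommutativeMonoid c ℓ) (m : ℕ) (1≤m : 1 ≤ m) where
  open CommutativeMonoid M renaming (refl to ≈-refl; sym to ≈-sym; trans to ≈-trans)
  open import Relation.Binary.Reasoning.Setoid setoid
  open Summation M
  open WordSums M

  -- Once the first factor is inserted, everything up to its end is final and later factors only
  -- enter the down steps behind it. So the induction lengthens `P` and shortens the run.
  ⨁-weakComps : ∀ Qs n P (h : ℕ → Word → Carrier) →
    ⨁ (weakComps (suc (length Qs)) n) (λ ls → h (lastOr0 ls) (applyComp (P ++ replicate n D) Qs (tail ls))) ≈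
    ⨁ (weaves n Qs) (λ (t , w) → h t (P ++ w))
  ⨁-weakComps []       n P h = ≈-refl
  ⨁-weakComps (Q ∷ Qs) n P h = begin
    ⨁ (weakComps (suc (suc r)) n) (λ ls → h (lastOr0 ls) (applyComp (P ++ replicate n D) (Q ∷ Qs) (tail ls)))
      ≈⟨ ⨁-concatMap (λ a → map (a ∷_) (weakComps (suc r) (n ∸ a))) (upTo (suc n)) _ ⟩
    ⨁ (upTo (suc n)) (λ a → ⨁ (map (a ∷_) (weakComps (suc r) (n ∸ a)))
      (λ ls → h (lastOr0 ls) (applyComp (P ++ replicate n D) (Q ∷ Qs) (tail ls))))
      ≈⟨ ⨁-cong (upTo (suc n)) (λ a → ⨁-map (a ∷_) (weakComps (suc r) (n ∸ a)) _) ⟩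
    ⨁ (upTo (suc n)) (λ a → ⨁ (weakComps (suc r) (n ∸ a))
      (λ ls → h (lastOr0 (a ∷ ls)) (applyComp (cross (sum ls) (P ++ replicate n D) Q) Qs (tail ls))))
      ≈⟨ ⨁-cong-All (All.map (λ {a} a≤n → ⨁-cong-All (All.map (λ {ls} (p , q) → reflexive
           (cong₂ h (q a) (cong (λ R → applyComp R Qs (tail ls)) (insert (ℕ.≤-pred a≤n) p))))
           (weakComps-spec r (n ∸ a)))) (All.all-upTo (suc n))) ⟩
    ⨁ (upTo (suc n)) (λ a → ⨁ (weakComps (suc r) (n ∸ a))
      (λ ls → h (lastOr0 ls) (applyComp ((P ++ replicate a D ++ Q) ++ replicate (n ∸ a) D) Qs (tail ls))))
      ≈⟨ ⨁-cong (upTo (suc n)) (λ a → ⨁-weakComps Qs (n ∸ a) (P ++ replicate a D ++ Q) h) ⟩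
    ⨁ (upTo (suc n)) (λ a → ⨁ (weaves (n ∸ a) Qs) (λ (t , w) → h t ((P ++ replicate a D ++ Q) ++ w)))
      ≈⟨ ⨁-cong (upTo (suc n)) (λ a → ⨁-cong (weaves (n ∸ a) Qs) (λ (t , w) → reflexive (cong (h t)
           (≡.trans (++-assoc P _ w) (cong (P ++_) (++-assoc (replicate a D) Q w)))))) ⟩
    ⨁ (upTo (suc n)) (λ a → ⨁ (weaves (n ∸ a) Qs) (λ (t , w) → h t (P ++ replicate a D ++ Q ++ w)))
      ≈⟨ ≈-sym (⨁-weaves n Q Qs _) ⟩
    ⨁ (weaves n (Q ∷ Qs)) (λ (t , w) → h t (P ++ w)) ∎
    where
    r = length Qs

    insert : ∀ {a s} → a ≤ n → s ≡ n ∸ a →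
             cross s (P ++ replicate n D) Q ≡ (P ++ replicate a D ++ Q) ++ replicate (n ∸ a) D
    insert {a} a≤n refl = ≡.trans
      (cong (λ v → cross (n ∸ a) v Q) (≡.trans
        (cong (P ++_) (≡.trans (cong (λ s → replicate s D) (≡.sym (ℕ.m+[n∸m]≡n a≤n))) (replicate-+ a (n ∸ a))))
        (≡.sym (++-assoc P _ _))))
      (≡.trans (cross-replicate (n ∸ a) (P ++ replicate a D) Q)
        (≡.trans (≡.sym (++-assoc (P ++ replicate a D) Q _)) (cong (_++ replicate (n ∸ a) D) (++-assoc P _ Q))))

  -- The colour condition on a composition depends on its last part alone, and by `multCond-index`
  -- it holds for exactly one `i`, the tag of the resulting term.
  ⨁-mult : ∀ i (p q : Tree m 0) h →
    ⨁ (mult m i (word p) (word q)) h ≈ ⨁ (mul p q) (λ (j , X) → when (j ≡ᵇ i) (h (word X)))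
  ⨁-mult i p@(node u c) q h = begin
    ⨁ (mult m i (word p) (word q)) h
      ≈⟨ reflexive (cong₂ (λ Qs n → ⨁ (expand Qs n (word p)) h) (primes-word 1≤m q)
           (≡.trans (cong trailingDs (word-prefix u c)) (trailingDs-descent (prefix p) n))) ⟩
    ⨁ (expand Qs n (word p)) h
      ≈⟨ reflexive (cong (λ w → ⨁ (map (λ ls → applyComp w Qs (tail ls)) (filter ok? (weakComps (suc (length Qs)) n))) h)
           (≡.trans (word-prefix u c) (≡.sym (++-assoc (prefix p) (U ∷ []) _)))) ⟩
    ⨁ (map (λ ls → applyComp (P ++ replicate n D) Qs (tail ls)) (filter ok? (weakComps (suc (length Qs)) n))) h
      ≈⟨ ≈-trans (⨁-map _ (filter ok? (weakComps (suc (length Qs)) n)) h) (⨁-filter ok? (weakComps (suc (length Qs)) n) _) ⟩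
    ⨁ (weakComps (suc (length Qs)) n) (λ ls → when (does (ok? ls)) (h (applyComp (P ++ replicate n D) Qs (tail ls))))
      ≈⟨ ⨁-weakComps Qs n P (λ t w → when (does (multCond i (lastColors m (word p) t) Bool.≟ true)) (h w)) ⟩
    ⨁ (weaves n Qs) (λ (t , w) → when (does (multCond i (lastColors m (word p) t) Bool.≟ true)) (h (P ++ w)))
      ≈⟨ ⨁-cong-All (All.map (λ {(t , w)} t≤n → reflexive (cong₂ (λ b v → when b (h v))
           (≡.trans (does-≟ _) (multCond-index i p t t≤n)) (++-assoc (prefix p) (U ∷ []) w))) (weaves-≤ n Qs)) ⟩
    ⨁ (weaves n Qs) (λ (t , w) → when (index p t ≡ᵇ i) (h (prefix p ++ U ∷ w)))
      ≈⟨ ≈-sym (mul-weaves u c q (λ j w → when (j ≡ᵇ i) (h w))) ⟩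
    ⨁ (mul p q) (λ (j , X) → when (j ≡ᵇ i) (h (word X))) ∎
    where
    n  = descent p
    Qs = primesT q
    P  = prefix p ++ U ∷ []

    ok? : (ls : List ℕ) → Dec (multCond i (lastColors m (word p) (lastOr0 ls)) ≡ true)
    ok? ls = multCond i (lastColors m (word p) (lastOr0 ls)) Bool.≟ true

    expand : List Word → ℕ → Word → List Word
    expand Qs n w = map (λ ls → applyComp w Qs (tail ls)) (filter ok? (weakComps (suc (length Qs)) n))

    does-≟ : ∀ b → does (b Bool.≟ true) ≡ b
    does-≟ false = refl
    does-≟ true  = refl

-- Parsing

module _ {m : ℕ} where

  -- The open trees, innermost first: entry `(k , u)` is reading slot `k` and awaits `k` down steps.
  -- An entry with `k = 0` is a finished prime whose slot 0 collects the rest of its path; it is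
  -- closed by a down step of an enclosing tree or by the end of the word.
  Stack : Set
  Stack = List (Σ ℕ λ k → Tree m (suc k))

  down : Maybe (Tree m 0) → Stack → Maybe Stack
  down c []                = nothing
  down c ((zero  , u) ∷ s) = down (just (node u c)) s
  down c ((suc k , u) ∷ s) = just ((k , node u c) ∷ s)

  close : Maybe (Tree m 0) → Stack → Maybe (Tree m 0)
  close c []                = c
  close c ((zero  , u) ∷ s) = close (just (node u c)) s
  close c ((suc k , u) ∷ s) = nothing

  parse  : Stack → Word → Maybe (Tree m 0)
  resume : Maybe Stack → Word → Maybe (Tree m 0)
  parse s []      = close nothing s
  parse s (U ∷ w) = parse ((m , root) ∷ s) w
  parse s (D ∷ w) = resume (down nothing s) w
  resume nothing  w = nothing
  resume (just s) w = parse s w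

  parse-stem : ∀ {k} (u : Tree m (suc k)) s w → parse s (stem u ++ w) ≡ parse ((k , u) ∷ s) w
  parse-wordM-D : ∀ c (s : Stack) w → parse s (wordM c ++ D ∷ w) ≡ resume (down c s) w
  parse-stem root s w = refl
  parse-stem {k} (node u c) s w = begin
    parse s (((stem u ++ wordM c) ++ D ∷ []) ++ w)
      ≡⟨ cong (parse s) (trans (++-assoc (stem u ++ wordM c) _ w) (++-assoc (stem u) (wordM c) (D ∷ w))) ⟩
    parse s (stem u ++ wordM c ++ D ∷ w)                ≡⟨ parse-stem u s _ ⟩
    parse ((suc k , u) ∷ s) (wordM c ++ D ∷ w)          ≡⟨ parse-wordM-D c _ w ⟩
    parse ((k , node u c) ∷ s) w                        ∎
    where open ≡-Reasoning
  parse-wordM-D nothing           s w = refl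
  parse-wordM-D (just (node u c)) s w = begin
    parse s ((stem u ++ wordM c) ++ D ∷ w)              ≡⟨ cong (parse s) (++-assoc (stem u) (wordM c) (D ∷ w)) ⟩
    parse s (stem u ++ wordM c ++ D ∷ w)                ≡⟨ parse-stem u s _ ⟩
    parse ((0 , u) ∷ s) (wordM c ++ D ∷ w)              ≡⟨ parse-wordM-D c _ w ⟩
    resume (down (just (node u c)) s) w                 ∎
    where open ≡-Reasoning

  parse-wordM : ∀ c (s : Stack) → parse s (wordM c) ≡ close c s
  parse-wordM nothing           s = refl
  parse-wordM (just (node u c)) s = trans (parse-stem u s _) (parse-wordM c _)

  parse-word : ∀ (z : Tree m 0) → parse [] (word z) ≡ just z
  parse-word z = parse-wordM (just z) []

  stackWord : Stack → Word
  stackWord []            = []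
  stackWord ((k , u) ∷ s) = stackWord s ++ stem u

  height : Stack → ℕ
  height []            = 0
  height ((k , u) ∷ s) = height s + k

  closeable : ∀ c (s : Stack) → height s ≡ 0 → ∃ λ c′ → wordM {m} c′ ≡ stackWord s ++ wordM c
  closeable c []                eq = c , refl
  closeable c ((zero  , u) ∷ s) eq with closeable (just (node u c)) s (trans (sym (ℕ.+-identityʳ _)) eq)
  ... | c′ , eq′ = c′ , trans eq′ (sym (++-assoc (stackWord s) (stem u) (wordM c)))
  closeable c ((suc k , u) ∷ s) eq with () ← trans (sym (ℕ.+-suc (height s) k)) eq

  lowerable : ∀ c (s : Stack) h → height s ≡ suc h →
              ∃ λ s′ → height s′ ≡ h × stackWord s′ ≡ (stackWord s ++ wordM c) ++ D ∷ []
  lowerable c ((zero  , u) ∷ s) h eq with lowerable (just (node u c)) s h (trans (sym (ℕ.+-identityʳ _)) eq)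
  ... | s′ , p , q = s′ , p , trans q (cong (_++ D ∷ []) (sym (++-assoc (stackWord s) (stem u) (wordM c))))
  lowerable c ((suc k , u) ∷ s) h eq =
    (k , node u c) ∷ s , ℕ.suc-injective (trans (sym (ℕ.+-suc (height s) k)) eq) ,
    trans (sym (++-assoc (stackWord s) (stem u ++ wordM c) _))
      (cong (_++ D ∷ []) (sym (++-assoc (stackWord s) (stem u) (wordM c))))

  readable : ∀ s h w → height s ≡ h → T (walkOK m h w) → ∃ λ c → wordM {m} c ≡ stackWord s ++ w
  readable s h       []      eq ok = closeable nothing s (trans eq (ℕ.≡ᵇ⇒≡ h 0 ok))
  readable s h       (U ∷ w) eq ok with readable ((m , root) ∷ s) (h + m) w (cong (_+ m) eq) ok
  ... | c , eq′ = c , trans eq′ (++-assoc (stackWord s) (U ∷ []) w)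
  readable s (suc h) (D ∷ w) eq ok with lowerable nothing s h eq
  ... | s′ , p , q with readable s′ h w p ok
  ... | c , eq′ = c , trans eq′ (trans (cong (_++ w) q)
    (trans (++-assoc (stackWord s ++ []) _ w) (cong (_++ D ∷ w) (++-identityʳ (stackWord s)))))

  dyck⇒word : ∀ P → T (IsDyck m P) → ∃ λ (z : Tree m 0) → word z ≡ P
  dyck⇒word (x ∷ P) ok with readable [] 0 (x ∷ P) refl ok
  ... | just z , eq = z , eq

  walkOK-stem : ∀ {k} (u : Tree m (suc k)) h w → walkOK m h (stem u ++ w) ≡ walkOK m (h + k) w
  walkOK-wordM : ∀ (c : Maybe (Tree m 0)) h w → walkOK m h (wordM c ++ w) ≡ walkOK m h w
  walkOK-stem root h w = refl
  walkOK-stem {k} (node u c) h w = begin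
    walkOK m h (((stem u ++ wordM c) ++ D ∷ []) ++ w)
      ≡⟨ cong (walkOK m h) (trans (++-assoc (stem u ++ wordM c) _ w) (++-assoc (stem u) (wordM c) (D ∷ w))) ⟩
    walkOK m h (stem u ++ wordM c ++ D ∷ w)             ≡⟨ walkOK-stem u h _ ⟩
    walkOK m (h + suc k) (wordM c ++ D ∷ w)             ≡⟨ walkOK-wordM c _ _ ⟩
    walkOK m (h + suc k) (D ∷ w)                        ≡⟨ cong (λ g → walkOK m g (D ∷ w)) (ℕ.+-suc h k) ⟩
    walkOK m (h + k) w                                  ∎
    where open ≡-Reasoning
  walkOK-wordM nothing           h w = refl
  walkOK-wordM (just (node u c)) h w = begin
    walkOK m h ((stem u ++ wordM c) ++ w)               ≡⟨ cong (walkOK m h) (++-assoc (stem u) (wordM c) w) ⟩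
    walkOK m h (stem u ++ wordM c ++ w)                 ≡⟨ walkOK-stem u h _ ⟩
    walkOK m (h + 0) (wordM c ++ w)                     ≡⟨ cong (λ g → walkOK m g (wordM c ++ w)) (ℕ.+-identityʳ h) ⟩
    walkOK m h (wordM c ++ w)                           ≡⟨ walkOK-wordM c h w ⟩
    walkOK m h w                                        ∎
    where open ≡-Reasoning

  word-isDyck : ∀ (z : Tree m 0) → T (IsDyck m (word z))
  word-isDyck z@(node u c) = nonempty (word z) (λ eq → stem≢[] u (++-[] eq))
    (subst T (sym (trans (cong (walkOK m 0) (sym (++-identityʳ (word z)))) (walkOK-wordM (just z) 0 []))) _)
    where
    nonempty : ∀ w → ¬ w ≡ [] → T (walkOK m 0 w) → T (IsDyck m w)
    nonempty []      w≢[] _  = w≢[] refl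
    nonempty (_ ∷ _) _    ok = ok

    ++-[] : ∀ {v w : Word} → v ++ w ≡ [] → v ≡ []
    ++-[] {[]} _ = refl

    stem≢[] : ∀ {k} (u : Tree m (suc k)) → ¬ stem u ≡ []
    stem≢[] (node u c) eq = stem≢[] u (++-[] {stem u} {wordM c} (++-[] eq))

-- The identities on paths

module _ {c ℓ} (M : CommutativeMonoid c ℓ) (m : ℕ) (1≤m : 1 ≤ m) where
  open CommutativeMonoid M renaming (refl to ≈-refl; sym to ≈-sym; trans to ≈-trans)
  open import Relation.Binary.Reasoning.Setoid setoid
  open Summation M
  open TreeSums M m
  open PathSums M m 1≤m

  module _ (h : Word → Carrier) (p q r : Tree m 0) where

    ⨁-multR : ∀ i j →
      ⨁ (multR m i (word p) (mult m j (word q) (word r))) h ≈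
      ⨁ (mul q r) (λ (b , Y) → ⨁ (mul p Y) (λ (a , X) → when ((b ≡ᵇ j) ∧ (a ≡ᵇ i)) (h (word X))))
    ⨁-multR i j = begin
      ⨁ (multR m i (word p) (mult m j (word q) (word r))) h
        ≈⟨ ⨁-concatMap (mult m i (word p)) (mult m j (word q) (word r)) h ⟩
      ⨁ (mult m j (word q) (word r)) (λ y → ⨁ (mult m i (word p) y) h)
        ≈⟨ ⨁-mult j q r _ ⟩
      ⨁ (mul q r) (λ (b , Y) → when (b ≡ᵇ j) (⨁ (mult m i (word p) (word Y)) h))
        ≈⟨ ⨁-cong (mul q r) (λ (b , Y) → ≈-trans (when-cong (b ≡ᵇ j) (⨁-mult i p Y h))
             (≈-trans (when-⨁ (b ≡ᵇ j) (mul p Y) _) (⨁-cong (mul p Y) (λ (a , X) → when-∧ (b ≡ᵇ j) (a ≡ᵇ i) _)))) ⟩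
      _ ∎

    ⨁-multL : ∀ i j →
      ⨁ (multL m j (mult m i (word p) (word q)) (word r)) h ≈
      ⨁ (mul p q) (λ (a , Y) → ⨁ (mul Y r) (λ (b , X) → when ((a ≡ᵇ i) ∧ (b ≡ᵇ j)) (h (word X))))
    ⨁-multL i j = begin
      ⨁ (multL m j (mult m i (word p) (word q)) (word r)) h
        ≈⟨ ⨁-concatMap (λ y → mult m j y (word r)) (mult m i (word p) (word q)) h ⟩
      ⨁ (mult m i (word p) (word q)) (λ y → ⨁ (mult m j y (word r)) h)
        ≈⟨ ⨁-mult i p q _ ⟩
      ⨁ (mul p q) (λ (a , Y) → when (a ≡ᵇ i) (⨁ (mult m j (word Y) (word r)) h))
        ≈⟨ ⨁-cong (mul p q) (λ (a , Y) → ≈-trans (when-cong (a ≡ᵇ i) (⨁-mult j Y r h))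
             (≈-trans (when-⨁ (a ≡ᵇ i) (mul Y r) _) (⨁-cong (mul Y r) (λ (b , X) → when-∧ (a ≡ᵇ i) (b ≡ᵇ j) _)))) ⟩
      _ ∎

    -- The part of `mul-assoc` with tag (i, j). Since i < j, a = i and max(a, b) = j force b = j,
    -- while b = j and min(a, b) = i force a = i.
    paths-assoc : ∀ i j → i < j →
      ⨁ (multR m i (word p) (mult m j (word q) (word r))) h ≈
      ⨁ (multL m j (mult m i (word p) (word q)) (word r)) h
    paths-assoc i j i<j = begin
      ⨁ (multR m i (word p) (mult m j (word q) (word r))) h
        ≈⟨ ⨁-multR i j ⟩
      ⨁ (mul q r) (λ (b , Y) → ⨁ (mul p Y) (λ (a , X) → when ((b ≡ᵇ j) ∧ (a ≡ᵇ i)) (h (word X))))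
        ≈⟨ ⨁-cong (mul q r) (λ (b , Y) → ⨁-cong (mul p Y) (λ (a , X) →
             reflexive (cong (λ t → when t (h (word X))) (tagsR a b)))) ⟩
      ⨁ (mul q r) (λ (b , Y) → ⨁ (mul p Y) (λ (a , X) → when ((a ≡ᵇ i) ∧ (a ⊔ b ≡ᵇ j)) (h (word X))))
        ≈⟨ mul-assoc p q r (λ a b X → when ((a ≡ᵇ i) ∧ (b ≡ᵇ j)) (h (word X))) ⟩
      ⨁ (mul p q) (λ (a , Y) → ⨁ (mul Y r) (λ (b , X) → when ((a ⊓ b ≡ᵇ i) ∧ (b ≡ᵇ j)) (h (word X))))
        ≈⟨ ⨁-cong (mul p q) (λ (a , Y) → ⨁-cong (mul Y r) (λ (b , X) →
             reflexive (cong (λ t → when t (h (word X))) (tagsL a b)))) ⟩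
      ⨁ (mul p q) (λ (a , Y) → ⨁ (mul Y r) (λ (b , X) → when ((a ≡ᵇ i) ∧ (b ≡ᵇ j)) (h (word X))))
        ≈⟨ ≈-sym (⨁-multL i j) ⟩
      ⨁ (multL m j (mult m i (word p) (word q)) (word r)) h ∎
      where
      tagsR : ∀ a b → ((b ≡ᵇ j) ∧ (a ≡ᵇ i)) ≡ ((a ≡ᵇ i) ∧ (a ⊔ b ≡ᵇ j))
      tagsR a b = T-ext to from
        where
        to : T ((b ≡ᵇ j) ∧ (a ≡ᵇ i)) → T ((a ≡ᵇ i) ∧ (a ⊔ b ≡ᵇ j))
        to t with Equivalence.to T-∧ t
        ... | b≡j , a≡i with ℕ.≡ᵇ⇒≡ b j b≡j | ℕ.≡ᵇ⇒≡ a i a≡i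
        ... | refl | refl = Equivalence.from T-∧ (a≡i , ℕ.≡⇒≡ᵇ _ _ (ℕ.m≤n⇒m⊔n≡n (ℕ.<⇒≤ i<j)))
        from : T ((a ≡ᵇ i) ∧ (a ⊔ b ≡ᵇ j)) → T ((b ≡ᵇ j) ∧ (a ≡ᵇ i))
        from t with Equivalence.to T-∧ t
        ... | a≡i , m≡j with ℕ.≡ᵇ⇒≡ a i a≡i | ℕ.≡ᵇ⇒≡ (a ⊔ b) j m≡j
        ... | refl | m≡j′ with ℕ.⊔-sel a b
        ...   | inj₁ eq = ⊥-elim (ℕ.<⇒≢ i<j (≡.trans (≡.sym eq) m≡j′))
        ...   | inj₂ eq = Equivalence.from T-∧ (ℕ.≡⇒≡ᵇ _ _ (≡.trans (≡.sym eq) m≡j′) , a≡i)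

      tagsL : ∀ a b → ((a ⊓ b ≡ᵇ i) ∧ (b ≡ᵇ j)) ≡ ((a ≡ᵇ i) ∧ (b ≡ᵇ j))
      tagsL a b = T-ext to from
        where
        to : T ((a ⊓ b ≡ᵇ i) ∧ (b ≡ᵇ j)) → T ((a ≡ᵇ i) ∧ (b ≡ᵇ j))
        to t with Equivalence.to T-∧ t
        ... | m≡i , b≡j with ℕ.≡ᵇ⇒≡ b j b≡j | ℕ.≡ᵇ⇒≡ (a ⊓ b) i m≡i
        ... | refl | m≡i′ with ℕ.⊓-sel a b
        ...   | inj₁ eq = Equivalence.from T-∧ (ℕ.≡⇒≡ᵇ _ _ (≡.trans (≡.sym eq) m≡i′) , b≡j)
        ...   | inj₂ eq = ⊥-elim (ℕ.<⇒≢ i<j (≡.trans (≡.sym m≡i′) eq))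
        from : T ((a ≡ᵇ i) ∧ (b ≡ᵇ j)) → T ((a ⊓ b ≡ᵇ i) ∧ (b ≡ᵇ j))
        from t with Equivalence.to T-∧ t
        ... | a≡i , b≡j with ℕ.≡ᵇ⇒≡ b j b≡j | ℕ.≡ᵇ⇒≡ a i a≡i
        ... | refl | refl = Equivalence.from T-∧ (ℕ.≡⇒≡ᵇ _ _ (ℕ.m≤n⇒m⊓n≡m (ℕ.<⇒≤ i<j)) , b≡j)

    -- The part of `mul-assoc` with tag (i, i). For a = i, max(a, b) = i means b ≤ i; for b = i,
    -- min(a, b) = i means a ≥ i. These are the two ranges of summation.
    paths-sum : ∀ i →
      ⨁ (concatMap (λ j → multR m i (word p) (mult m (toℕ j) (word q) (word r)))
                   (filter (λ j → toℕ j ≤? i) (allFin (suc m)))) h ≈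
      ⨁ (concatMap (λ k → multL m i (mult m (toℕ k) (word p) (word q)) (word r))
                   (filter (λ k → i ≤? toℕ k) (allFin (suc m)))) h
    paths-sum i = begin
      ⨁ (concatMap fR (filter (λ j → toℕ j ≤? i) (allFin (suc m)))) h
        ≈⟨ ⨁-concatMap fR (filter (λ j → toℕ j ≤? i) (allFin (suc m))) h ⟩
      ⨁ (filter (λ j → toℕ j ≤? i) (allFin (suc m))) (λ j → ⨁ (fR j) h)
        ≈⟨ ⨁-filter (λ j → toℕ j ≤? i) (allFin (suc m)) _ ⟩
      ⨁ (allFin (suc m)) (λ j → when (toℕ j ≤ᵇ i) (⨁ (fR j) h))
        ≈⟨ ⨁-cong (allFin (suc m)) (λ j → ≈-trans (when-cong (toℕ j ≤ᵇ i) (⨁-multR i (toℕ j)))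
             (≈-trans (when-⨁ (toℕ j ≤ᵇ i) (mul q r) _)
               (⨁-cong (mul q r) (λ (b , Y) → when-⨁ (toℕ j ≤ᵇ i) (mul p Y) _)))) ⟩
      ⨁ (allFin (suc m)) (λ j → ⨁ (mul q r) (λ (b , Y) → ⨁ (mul p Y) (λ (a , X) →
        when (toℕ j ≤ᵇ i) (when ((b ≡ᵇ toℕ j) ∧ (a ≡ᵇ i)) (h (word X))))))
        ≈⟨ ≈-trans (⨁-swap (allFin (suc m)) (mul q r) _) (⨁-cong (mul q r) (λ (b , Y) →
             ⨁-swap (allFin (suc m)) (mul p Y) _)) ⟩
      ⨁ (mul q r) (λ (b , Y) → ⨁ (mul p Y) (λ (a , X) → ⨁ (allFin (suc m)) (λ j →
        when (toℕ j ≤ᵇ i) (when ((b ≡ᵇ toℕ j) ∧ (a ≡ᵇ i)) (h (word X))))))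
        ≈⟨ ⨁-cong-All (All.map (λ {(b , Y)} (_ , b≤m) → ⨁-cong (mul p Y) (λ (a , X) → ≈-trans
             (⨁-cong (allFin (suc m)) (λ j → when-cong (toℕ j ≤ᵇ i) (≈-sym (when-∧ (b ≡ᵇ toℕ j) (a ≡ᵇ i) _))))
             (≈-trans (⨁-δ-when (s≤s b≤m) (_≤ᵇ i) _) (≈-trans (when-∧ (b ≤ᵇ i) (a ≡ᵇ i) _)
               (reflexive (cong (λ t → when t (h (word X))) (tagsR a b))))))) (mul-tags q r)) ⟩
      ⨁ (mul q r) (λ (b , Y) → ⨁ (mul p Y) (λ (a , X) → when ((a ≡ᵇ i) ∧ (a ⊔ b ≡ᵇ i)) (h (word X))))
        ≈⟨ mul-assoc p q r (λ a b X → when ((a ≡ᵇ i) ∧ (b ≡ᵇ i)) (h (word X))) ⟩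
      ⨁ (mul p q) (λ (a , Y) → ⨁ (mul Y r) (λ (b , X) → when ((a ⊓ b ≡ᵇ i) ∧ (b ≡ᵇ i)) (h (word X))))
        ≈⟨ ⨁-cong-All (All.map (λ {(a , Y)} (_ , a≤m) → ⨁-cong (mul Y r) (λ (b , X) → ≈-sym (≈-trans
             (⨁-cong (allFin (suc m)) (λ k → when-cong (i ≤ᵇ toℕ k) (≈-sym (when-∧ (a ≡ᵇ toℕ k) (b ≡ᵇ i) _))))
             (≈-trans (⨁-δ-when (s≤s a≤m) (i ≤ᵇ_) _) (≈-trans (when-∧ (i ≤ᵇ a) (b ≡ᵇ i) _)
               (reflexive (cong (λ t → when t (h (word X))) (tagsL a b)))))))) (mul-tags p q)) ⟩
      ⨁ (mul p q) (λ (a , Y) → ⨁ (mul Y r) (λ (b , X) → ⨁ (allFin (suc m)) (λ k →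
        when (i ≤ᵇ toℕ k) (when ((a ≡ᵇ toℕ k) ∧ (b ≡ᵇ i)) (h (word X))))))
        ≈⟨ ≈-sym (≈-trans (⨁-swap (allFin (suc m)) (mul p q) _) (⨁-cong (mul p q) (λ (a , Y) →
             ⨁-swap (allFin (suc m)) (mul Y r) _))) ⟩
      ⨁ (allFin (suc m)) (λ k → ⨁ (mul p q) (λ (a , Y) → ⨁ (mul Y r) (λ (b , X) →
        when (i ≤ᵇ toℕ k) (when ((a ≡ᵇ toℕ k) ∧ (b ≡ᵇ i)) (h (word X))))))
        ≈⟨ ⨁-cong (allFin (suc m)) (λ k → ≈-sym (≈-trans (when-cong (i ≤ᵇ toℕ k) (⨁-multL (toℕ k) i))
             (≈-trans (when-⨁ (i ≤ᵇ toℕ k) (mul p q) _)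
               (⨁-cong (mul p q) (λ (a , Y) → when-⨁ (i ≤ᵇ toℕ k) (mul Y r) _))))) ⟩
      ⨁ (allFin (suc m)) (λ k → when (i ≤ᵇ toℕ k) (⨁ (fL k) h))
        ≈⟨ ≈-sym (⨁-filter (λ k → i ≤? toℕ k) (allFin (suc m)) _) ⟩
      ⨁ (filter (λ k → i ≤? toℕ k) (allFin (suc m))) (λ k → ⨁ (fL k) h)
        ≈⟨ ≈-sym (⨁-concatMap fL (filter (λ k → i ≤? toℕ k) (allFin (suc m))) h) ⟩
      ⨁ (concatMap fL (filter (λ k → i ≤? toℕ k) (allFin (suc m)))) h ∎
      where
      fR : Fin (suc m) → List Word
      fR j = multR m i (word p) (mult m (toℕ j) (word q) (word r))
      fL : Fin (suc m) → List Word
      fL k = multL m i (mult m (toℕ k) (word p) (word q)) (word r)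

      tagsR : ∀ a b → ((b ≤ᵇ i) ∧ (a ≡ᵇ i)) ≡ ((a ≡ᵇ i) ∧ (a ⊔ b ≡ᵇ i))
      tagsR a b = T-ext to from
        where
        to : T ((b ≤ᵇ i) ∧ (a ≡ᵇ i)) → T ((a ≡ᵇ i) ∧ (a ⊔ b ≡ᵇ i))
        to t with Equivalence.to T-∧ t
        ... | b≤i , a≡i with ℕ.≡ᵇ⇒≡ a i a≡i
        ... | refl = Equivalence.from T-∧ (a≡i , ℕ.≡⇒≡ᵇ _ _ (ℕ.m≥n⇒m⊔n≡m (ℕ.≤ᵇ⇒≤ b i b≤i)))
        from : T ((a ≡ᵇ i) ∧ (a ⊔ b ≡ᵇ i)) → T ((b ≤ᵇ i) ∧ (a ≡ᵇ i))
        from t with Equivalence.to T-∧ t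
        ... | a≡i , m≡i = Equivalence.from T-∧
          (ℕ.≤⇒≤ᵇ (ℕ.≤-trans (ℕ.m≤n⊔m a b) (ℕ.≤-reflexive (ℕ.≡ᵇ⇒≡ (a ⊔ b) i m≡i))) , a≡i)

      tagsL : ∀ a b → ((i ≤ᵇ a) ∧ (b ≡ᵇ i)) ≡ ((a ⊓ b ≡ᵇ i) ∧ (b ≡ᵇ i))
      tagsL a b = T-ext to from
        where
        to : T ((i ≤ᵇ a) ∧ (b ≡ᵇ i)) → T ((a ⊓ b ≡ᵇ i) ∧ (b ≡ᵇ i))
        to t with Equivalence.to T-∧ t
        ... | i≤a , b≡i with ℕ.≡ᵇ⇒≡ b i b≡i
        ... | refl = Equivalence.from T-∧ (ℕ.≡⇒≡ᵇ _ _ (ℕ.m≥n⇒m⊓n≡n (ℕ.≤ᵇ⇒≤ i a i≤a)) , b≡i)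
        from : T ((a ⊓ b ≡ᵇ i) ∧ (b ≡ᵇ i)) → T ((i ≤ᵇ a) ∧ (b ≡ᵇ i))
        from t with Equivalence.to T-∧ t
        ... | m≡i , b≡i = Equivalence.from T-∧
          (ℕ.≤⇒≤ᵇ (ℕ.≤-trans (ℕ.≤-reflexive (≡.sym (ℕ.≡ᵇ⇒≡ (a ⊓ b) i m≡i))) (ℕ.m⊓n≤m a b)) , b≡i)

δ : Word → Word → ℕ
δ w P = if listEq w P then 1 else 0

multiplicity-⨁ : ∀ w L → multiplicity w L ≡ Summation.⨁ ℕ.+-0-commutativeMonoid L (δ w)
multiplicity-⨁ w []      = refl
multiplicity-⨁ w (P ∷ L) = cong (δ w P +_) (multiplicity-⨁ w L)

-- Multiplicities agree as natural numbers, hence in a field of any characteristic.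
sums⇒coefficients : ∀ {c ℓ} (K : Field c ℓ) w {A B} →
  Summation.⨁ ℕ.+-0-commutativeMonoid A (δ w) ≡ Summation.⨁ ℕ.+-0-commutativeMonoid B (δ w) →
  Field._≈_ K (ℕ→K K (multiplicity w A)) (ℕ→K K (multiplicity w B))
sums⇒coefficients K w {A} {B} eq = Field.reflexive K
  (cong (ℕ→K K) (≡.trans (multiplicity-⨁ w A) (≡.trans eq (≡.sym (multiplicity-⨁ w B)))))

paths-identities : ∀ {c ℓ} (K : Field c ℓ) m → 1 ≤ m → KDyckIdentities K m
proj₁ (paths-identities K m 1≤m) i j i<j P Q R P-dyck Q-dyck R-dyck w
  with dyck⇒word P P-dyck | dyck⇒word Q Q-dyck | dyck⇒word R R-dyck
... | p , refl | q , refl | r , refl = sums⇒coefficients K w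
  {multR m (toℕ i) (word p) (mult m (toℕ j) (word q) (word r))}
  {multL m (toℕ j) (mult m (toℕ i) (word p) (word q)) (word r)}
  (paths-assoc ℕ.+-0-commutativeMonoid m 1≤m (δ w) p q r (toℕ i) (toℕ j) i<j)
proj₂ (paths-identities K m 1≤m) i P Q R P-dyck Q-dyck R-dyck w
  with dyck⇒word P P-dyck | dyck⇒word Q Q-dyck | dyck⇒word R R-dyck
... | p , refl | q , refl | r , refl = sums⇒coefficients K w
  {concatMap (λ j → multR m (toℕ i) (word p) (mult m (toℕ j) (word q) (word r)))
             (filter (λ j → toℕ j ≤? toℕ i) (allFin (suc m)))}
  {concatMap (λ k → multL m (toℕ i) (mult m (toℕ k) (word p) (word q)) (word r))
             (filter (λ k → toℕ i ≤? toℕ k) (allFin (suc m)))}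
  (paths-sum ℕ.+-0-commutativeMonoid m 1≤m (δ w) p q r (toℕ i))

-- Evaluation of trees in a Dyck algebra

module _ {m : ℕ} where

  dec-size  : ∀ (z : Tree m 0) → All (λ (a , b) → sizeM a + size b ≡ size z) (dec z)
  dec⁺-size : ∀ (z : Tree m 0) → All (λ (a , b) → size a + size b ≡ size z) (dec⁺ z)
  dec-size z = refl ∷ All.map⁺ (dec⁺-size z)
  dec⁺-size (node u nothing)  = []
  dec⁺-size (node u (just y)) = All.map⁺ (All.map
    (λ {(a , b)} eq → ≡.trans (ℕ.+-assoc (size u) (sizeM a) (size b)) (cong (size u +_) eq)) (dec-size y))

  -- The asymmetry matches the fuel in `ext`: the left part is evaluated with the same fuel, the
  -- right part, shorter because the left one is nonempty, with one unit less.
  dec⁺-≤ : ∀ (z : Tree m 0) {n} → size z ≤ suc n → All (λ (a , b) → size a ≤ suc n × size b ≤ n) (dec⁺ z)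
  dec⁺-≤ z {n} z≤ = All.map (λ {(a , b)} eq →
      ≤-trans (ℕ.m≤m+n (size a) (size b)) (≤-trans (ℕ.≤-reflexive eq) z≤) ,
      ℕ.≤-pred (≤-trans (ℕ.+-monoˡ-≤ (size b) (size>0 a)) (≤-trans (ℕ.≤-reflexive eq) z≤)))
    (dec⁺-size z)

  node-just-≤ : ∀ {k} (u : Tree m (suc k)) y {n} → size (node u (just y)) ≤ suc n → size y ≤ n
  node-just-≤ u y le = ℕ.≤-pred (≤-trans (ℕ.+-monoˡ-≤ (size y) (size>0 u)) le)

  slot : ∀ {k} → Tree m (suc k) → Fin (suc m)
  slot {k} u = fromℕ< {k} (level≤ u)

  toℕ-slot : ∀ {k} (u : Tree m (suc k)) → toℕ (slot u) ≡ k
  toℕ-slot u = Fin.toℕ-fromℕ< (level≤ u)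

  slot-unique : ∀ {k} (u : Tree m (suc k)) κ → toℕ κ ≡ k → slot u ≡ κ
  slot-unique u κ eq = Fin.toℕ-injective (≡.trans (toℕ-slot u) (≡.sym eq))

≡ᵇ-refl : ∀ n → (n ≡ᵇ n) ≡ true
≡ᵇ-refl n = T⇒≡ (ℕ.≡⇒≡ᵇ n n refl)

≢⇒≡ᵇ : ∀ {a b} → ¬ a ≡ b → (a ≡ᵇ b) ≡ false
≢⇒≡ᵇ {a} {b} a≢b = ¬T⇒≡ (a≢b ∘ ℕ.≡ᵇ⇒≡ a b)

<ᵇ-≤ᵇ : ∀ a b → (a <ᵇ suc b) ≡ (a ≤ᵇ b)
<ᵇ-≤ᵇ zero    b = refl
<ᵇ-≤ᵇ (suc a) b = refl

module Evaluation {c ℓ c′ ℓ′} {K : Field c ℓ} {m : ℕ} (A : DyckAlgebra K m c′ ℓ′) where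
  open DyckAlgebra A using (vectorSpace; op; op-cong; op-+ˡ; op-+ʳ; op-*ₗˡ; op-*ₗʳ; dyck-assoc; dyck-sum; *ₗ-zeroˡ)
  open AbelianGroup (Module.+ᴹ-abelianGroup vectorSpace)
    renaming (Carrier to C; refl to ≈-refl; sym to ≈-sym; trans to ≈-trans)
  open AbelianGroupProperties (Module.+ᴹ-abelianGroup vectorSpace)
    using (∙-cancelʳ; ⁻¹-∙-comm; ε⁻¹≈ε)
  open import Relation.Binary.Reasoning.Setoid setoid
  open import Algebra.Properties.CommutativeSemigroup commutativeSemigroup using (interchange)
  open Summation commutativeMonoid
  open TreeSums commutativeMonoid m

  I : List (Fin (suc m))
  I = allFin (suc m)

  op-zeroˡ : ∀ i y → op i ε y ≈ ε
  op-zeroˡ i y = ≈-trans (op-cong i (≈-sym (*ₗ-zeroˡ ε)) ≈-refl)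
    (≈-trans (op-*ₗˡ i (Field.0# K) ε y) (*ₗ-zeroˡ _))

  op-zeroʳ : ∀ i x → op i x ε ≈ ε
  op-zeroʳ i x = ≈-trans (op-cong i ≈-refl (≈-sym (*ₗ-zeroˡ ε)))
    (≈-trans (op-*ₗʳ i (Field.0# K) x ε) (*ₗ-zeroˡ _))

  op-⨁ˡ : ∀ {a} {X : Set a} i (L : List X) h y → op i (⨁ L h) y ≈ ⨁ L (λ x → op i (h x) y)
  op-⨁ˡ i L h y = ⨁-homo {φ = λ x → op i x y} (op-zeroˡ i y) (λ x x′ → op-+ˡ i x x′ y) L h

  op-⨁ʳ : ∀ {a} {X : Set a} i x (L : List X) h → op i x (⨁ L h) ≈ ⨁ L (λ y → op i x (h y))
  op-⨁ʳ i x L h = ⨁-homo {φ = op i x} (op-zeroʳ i x) (op-+ʳ i x) L h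

  total : C → C → C
  total x y = ⨁ I (λ i → op i x y)

  below : Fin (suc m) → C → C → C
  below κ x y = ⨁ I (λ i → when (toℕ i ≤ᵇ toℕ κ) (op i x y))

  above : Fin (suc m) → C → C → C
  above κ x y = ⨁ I (λ i → when (toℕ κ <ᵇ toℕ i) (op i x y))

  above-cong : ∀ κ {x x′ y y′} → x ≈ x′ → y ≈ y′ → above κ x y ≈ above κ x′ y′
  above-cong κ p q = ⨁-cong I (λ i → when-cong (toℕ κ <ᵇ toℕ i) (op-cong i p q))

  above-∙ˡ : ∀ κ x x′ y → above κ (x ∙ x′) y ≈ above κ x y ∙ above κ x′ y
  above-∙ˡ κ x x′ y = ≈-trans
    (⨁-cong I (λ i → ≈-trans (when-cong (toℕ κ <ᵇ toℕ i) (op-+ˡ i x x′ y)) (when-∙ (toℕ κ <ᵇ toℕ i) _ _)))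
    (⨁-∙ I _ _)

  above-zeroˡ : ∀ κ y → above κ ε y ≈ ε
  above-zeroˡ κ y = ≈-trans
    (⨁-cong I (λ i → ≈-trans (when-cong (toℕ κ <ᵇ toℕ i) (op-zeroˡ i y)) (when-ε (toℕ κ <ᵇ toℕ i)))) (⨁-ε I)

  above-⨁ʳ : ∀ {a} {X : Set a} κ x (L : List X) h → above κ x (⨁ L h) ≈ ⨁ L (λ y → above κ x (h y))
  above-⨁ʳ κ x L h = ≈-trans
    (⨁-cong I (λ i → ≈-trans (when-cong (toℕ κ <ᵇ toℕ i) (op-⨁ʳ i x L h)) (when-⨁ (toℕ κ <ᵇ toℕ i) L _)))
    (⨁-swap I L _)

  op-below : ∀ i x y z → op i x (below i y z) ≈ ⨁ I (λ k → when (toℕ i ≤ᵇ toℕ k) (op i (op k x y) z))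
  op-below i x y z = begin
    op i x (below i y z)
      ≈⟨ op-⨁ʳ i x I _ ⟩
    ⨁ I (λ j → op i x (when (toℕ j ≤ᵇ toℕ i) (op j y z)))
      ≈⟨ ⨁-cong I (λ j → when-homo {φ = op i x} (op-zeroʳ i x) (toℕ j ≤ᵇ toℕ i) _) ⟩
    ⨁ I (λ j → when (toℕ j ≤ᵇ toℕ i) (op i x (op j y z)))
      ≈⟨ ≈-sym (⨁-filter (λ j → toℕ j ≤? toℕ i) I _) ⟩
    ⨁ (filter (λ j → toℕ j ≤? toℕ i) I) (λ j → op i x (op j y z))
      ≈⟨ ≈-sym (⨁-foldr (filter (λ j → toℕ j ≤? toℕ i) I) _) ⟩
    _
      ≈⟨ dyck-sum i x y z ⟩
    _
      ≈⟨ ⨁-foldr (filter (λ k → toℕ i ≤? toℕ k) I) _ ⟩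
    ⨁ (filter (λ k → toℕ i ≤? toℕ k) I) (λ k → op i (op k x y) z)
      ≈⟨ ⨁-filter (λ k → toℕ i ≤? toℕ k) I _ ⟩
    ⨁ I (λ k → when (toℕ i ≤ᵇ toℕ k) (op i (op k x y) z)) ∎

  -- Sets the term `k = i` of the summation identity apart. The others are the surplus that appears
  -- as `S₂` in `graft-multiplicative`.
  op-below-above : ∀ i x y z → op i x (below i y z) ≈ op i (op i x y) z ∙ op i (above i x y) z
  op-below-above i x y z = begin
    op i x (below i y z)
      ≈⟨ op-below i x y z ⟩
    ⨁ I (λ k → when (toℕ i ≤ᵇ toℕ k) (op i (op k x y) z))
      ≈⟨ ⨁-cong I (λ k → split-≤ (toℕ i) (toℕ k) _) ⟩
    ⨁ I (λ k → when (toℕ k ≡ᵇ toℕ i) (op i (op k x y) z) ∙ when (toℕ i <ᵇ toℕ k) (op i (op k x y) z))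
      ≈⟨ ⨁-∙ I _ _ ⟩
    ⨁ I (λ k → when (toℕ k ≡ᵇ toℕ i) (op i (op k x y) z)) ∙ ⨁ I (λ k → when (toℕ i <ᵇ toℕ k) (op i (op k x y) z))
      ≈⟨ ∙-cong (⨁-δ i (λ k → op i (op k x y) z)) (⨁-cong I (λ k → ≈-sym
           (when-homo {φ = λ v → op i v z} (op-zeroˡ i z) (toℕ i <ᵇ toℕ k) _))) ⟩
    op i (op i x y) z ∙ ⨁ I (λ k → op i (when (toℕ i <ᵇ toℕ k) (op k x y)) z)
      ≈⟨ ∙-congˡ (≈-sym (op-⨁ˡ i I _ z)) ⟩
    op i (op i x y) z ∙ op i (above i x y) z ∎
    where
    split-≤ : ∀ a b v → when (a ≤ᵇ b) v ≈ when (b ≡ᵇ a) v ∙ when (a <ᵇ b) v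
    split-≤ zero    zero    v = ≈-sym (identityʳ v)
    split-≤ zero    (suc b) v = ≈-sym (identityˡ v)
    split-≤ (suc a) zero    v = ≈-sym (identityʳ ε)
    split-≤ (suc a) (suc b) v = ≈-trans (reflexive (cong (λ t → when t v) (<ᵇ-≤ᵇ a b))) (split-≤ a b v)

  -- Expand x *_i (y *_j z) by associativity for i < j and by the summation identity for j ≤ i. This
  -- yields (x *_i y) *_j z with κ < i < j from the former and with κ < j ≤ i from the latter, hence
  -- every pair above κ once.
  above-assoc : ∀ κ x y z → above κ (above κ x y) z ≈ above κ x (total y z)
  above-assoc κ x y z = ≈-sym (begin
    above κ x (total y z)
      ≈⟨ ⨁-cong I (λ i → when-cong (toℕ κ <ᵇ toℕ i) (expand i)) ⟩
    ⨁ I (λ i → when (toℕ κ <ᵇ toℕ i)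
      (⨁ I (λ j → when (toℕ i ≤ᵇ toℕ j) (B j i)) ∙ ⨁ I (λ j → when (toℕ i <ᵇ toℕ j) (B i j))))
      ≈⟨ ⨁-cong I (λ i → ≈-trans (when-∙ (toℕ κ <ᵇ toℕ i) _ _)
           (∙-cong (when-⨁ (toℕ κ <ᵇ toℕ i) I _) (when-⨁ (toℕ κ <ᵇ toℕ i) I _))) ⟩
    ⨁ I (λ i → ⨁ I (λ j → when (toℕ κ <ᵇ toℕ i) (when (toℕ i ≤ᵇ toℕ j) (B j i))) ∙
               ⨁ I (λ j → when (toℕ κ <ᵇ toℕ i) (when (toℕ i <ᵇ toℕ j) (B i j))))
      ≈⟨ ⨁-∙ I _ _ ⟩
    ⨁ I (λ i → ⨁ I (λ j → when (toℕ κ <ᵇ toℕ i) (when (toℕ i ≤ᵇ toℕ j) (B j i)))) ∙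
    ⨁ I (λ i → ⨁ I (λ j → when (toℕ κ <ᵇ toℕ i) (when (toℕ i <ᵇ toℕ j) (B i j))))
      ≈⟨ ∙-congˡ (⨁-swap I I _) ⟩
    ⨁ I (λ j → ⨁ I (λ i → when (toℕ κ <ᵇ toℕ j) (when (toℕ j ≤ᵇ toℕ i) (B i j)))) ∙
    ⨁ I (λ j → ⨁ I (λ i → when (toℕ κ <ᵇ toℕ i) (when (toℕ i <ᵇ toℕ j) (B i j))))
      ≈⟨ ≈-sym (≈-trans (⨁-cong I (λ j → ⨁-∙ I _ _)) (⨁-∙ I _ _)) ⟩
    ⨁ I (λ j → ⨁ I (λ i → when (toℕ κ <ᵇ toℕ j) (when (toℕ j ≤ᵇ toℕ i) (B i j)) ∙
                          when (toℕ κ <ᵇ toℕ i) (when (toℕ i <ᵇ toℕ j) (B i j))))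
      ≈⟨ ⨁-cong I (λ j → ⨁-cong I (λ i → merge (toℕ κ) (toℕ i) (toℕ j) (B i j))) ⟩
    ⨁ I (λ j → ⨁ I (λ i → when (toℕ κ <ᵇ toℕ j) (when (toℕ κ <ᵇ toℕ i) (B i j))))
      ≈⟨ ⨁-cong I (λ j → ≈-sym (when-⨁ (toℕ κ <ᵇ toℕ j) I _)) ⟩
    ⨁ I (λ j → when (toℕ κ <ᵇ toℕ j) (⨁ I (λ i → when (toℕ κ <ᵇ toℕ i) (B i j))))
      ≈⟨ ⨁-cong I (λ j → when-cong (toℕ κ <ᵇ toℕ j) (≈-sym (≈-trans (op-⨁ˡ j I _ z)
           (⨁-cong I (λ i → when-homo {φ = λ v → op j v z} (op-zeroˡ j z) (toℕ κ <ᵇ toℕ i) _))))) ⟩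
    above κ (above κ x y) z ∎)
    where
    B : Fin (suc m) → Fin (suc m) → C
    B i j = op j (op i x y) z

    split-total : ∀ a b v → v ≈ when (b ≤ᵇ a) v ∙ when (a <ᵇ b) v
    split-total zero    zero    v = ≈-sym (identityʳ v)
    split-total zero    (suc b) v = ≈-sym (identityˡ v)
    split-total (suc a) zero    v = ≈-sym (identityʳ v)
    split-total (suc a) (suc b) v = ≈-trans (split-total a b v)
      (∙-congʳ (reflexive (cong (λ t → when t v) (≡.sym (<ᵇ-≤ᵇ b a)))))

    expand : ∀ i → op i x (total y z) ≈
      ⨁ I (λ j → when (toℕ i ≤ᵇ toℕ j) (B j i)) ∙ ⨁ I (λ j → when (toℕ i <ᵇ toℕ j) (B i j))
    expand i = begin
      op i x (total y z)
        ≈⟨ op-⨁ʳ i x I _ ⟩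
      ⨁ I (λ j → op i x (op j y z))
        ≈⟨ ⨁-cong I (λ j → split-total (toℕ i) (toℕ j) _) ⟩
      ⨁ I (λ j → when (toℕ j ≤ᵇ toℕ i) (op i x (op j y z)) ∙ when (toℕ i <ᵇ toℕ j) (op i x (op j y z)))
        ≈⟨ ⨁-∙ I _ _ ⟩
      ⨁ I (λ j → when (toℕ j ≤ᵇ toℕ i) (op i x (op j y z))) ∙
      ⨁ I (λ j → when (toℕ i <ᵇ toℕ j) (op i x (op j y z)))
        ≈⟨ ∙-cong (≈-trans (≈-sym (≈-trans (op-⨁ʳ i x I _) (⨁-cong I (λ j →
               when-homo {φ = op i x} (op-zeroʳ i x) (toℕ j ≤ᵇ toℕ i) _)))) (op-below i x y z))
             (⨁-cong I (λ j → when-cong-T (toℕ i <ᵇ toℕ j) (λ i<j →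
               dyck-assoc i j (ℕ.<ᵇ⇒< (toℕ i) (toℕ j) i<j) x y z))) ⟩
      ⨁ I (λ j → when (toℕ i ≤ᵇ toℕ j) (B j i)) ∙ ⨁ I (λ j → when (toℕ i <ᵇ toℕ j) (B i j)) ∎

    merge : ∀ k i j v → when (k <ᵇ j) (when (j ≤ᵇ i) v) ∙ when (k <ᵇ i) (when (i <ᵇ j) v) ≈
                        when (k <ᵇ j) (when (k <ᵇ i) v)
    merge k i j v with ℕ.<-≤-connex i j
    ... | inj₁ i<j
      rewrite ¬T⇒≡ (λ t → ℕ.<⇒≱ i<j (ℕ.≤ᵇ⇒≤ j i t)) | T⇒≡ (ℕ.<⇒<ᵇ i<j)
      = ≈-trans (∙-congʳ (when-ε (k <ᵇ j))) (≈-trans (identityˡ _) (absorb (k <ᵇ i) (k <ᵇ j)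
          (λ k<i → ℕ.<⇒<ᵇ (ℕ.<-trans (ℕ.<ᵇ⇒< k i k<i) i<j))))
      where
      absorb : ∀ b b′ → (T b → T b′) → when b v ≈ when b′ (when b v)
      absorb false b′    _ = ≈-sym (when-ε b′)
      absorb true  true  _ = ≈-refl
      absorb true  false f = ⊥-elim (f _)
    ... | inj₂ j≤i
      rewrite T⇒≡ (ℕ.≤⇒≤ᵇ j≤i) | ¬T⇒≡ (λ t → ℕ.≤⇒≯ j≤i (ℕ.<ᵇ⇒< i j t))
      = ≈-trans (∙-congˡ (when-ε (k <ᵇ i))) (≈-trans (identityʳ _) (when-cong-T (k <ᵇ j) (λ k<j →
          reflexive (cong (λ b → when b v) (≡.sym (T⇒≡ (ℕ.<⇒<ᵇ (ℕ.<-≤-trans (ℕ.<ᵇ⇒< k j k<j) j≤i))))))))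

  -- Values of grafts, obtained by solving the third rule

  module _ (d : C) where

    -- ev n and ext n have the intended value on trees of size at most n only.
    ev  : ∀ {k} → ℕ → Tree m k → C
    ext : ℕ → Fin (suc m) → C → Tree m 0 → C
    ev n       root              = d
    ev n       (node u nothing)  = ev n u
    ev zero    (node u (just y)) = ε
    ev (suc n) (node u (just y)) = ext n (slot u) (ev (suc n) u) y
    ext zero    κ x z = ε
    ext (suc n) κ x z =
      op κ x (ev (suc n) z) ∙ ⨁ (dec⁺ z) (λ (a , b) → ext n κ (above κ x (ev (suc n) a)) b) ⁻¹

    -- Fuel only serves termination: any two bounds on the size give the same value. This lets
    -- `eval` and `graft` fix it as the size.
    ev-stable  : ∀ {k} n n′ (t : Tree m k) → size t ≤ n → size t ≤ n′ → ev n t ≈ ev n′ t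
    ext-stable : ∀ n n′ κ {x x′} z → size z ≤ n → size z ≤ n′ → x ≈ x′ → ext n κ x z ≈ ext n′ κ x′ z
    ev-stable n n′ root             le le′ = ≈-refl
    ev-stable n n′ (node u nothing) le le′ =
      ev-stable n n′ u (≤-trans (ℕ.m≤m+n _ 0) le) (≤-trans (ℕ.m≤m+n _ 0) le′)
    ev-stable zero    n′       t@(node u (just y)) le le′ = ⊥-elim (ℕ.<⇒≱ (size>0 t) le)
    ev-stable (suc n) zero     t@(node u (just y)) le le′ = ⊥-elim (ℕ.<⇒≱ (size>0 t) le′)
    ev-stable (suc n) (suc n′) (node u (just y)) le le′ =
      ext-stable n n′ (slot u) y (node-just-≤ u y le) (node-just-≤ u y le′)
        (ev-stable (suc n) (suc n′) u (≤-trans (ℕ.m≤m+n _ _) le) (≤-trans (ℕ.m≤m+n _ _) le′))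
    ext-stable zero    n′       κ z le le′ x≈x′ = ⊥-elim (ℕ.<⇒≱ (size>0 z) le)
    ext-stable (suc n) zero     κ z le le′ x≈x′ = ⊥-elim (ℕ.<⇒≱ (size>0 z) le′)
    ext-stable (suc n) (suc n′) κ z le le′ x≈x′ = ∙-cong
      (op-cong κ x≈x′ (ev-stable (suc n) (suc n′) z le le′))
      (⁻¹-cong (⨁-cong-All (All.zipWith
        (λ {(a , b)} ((a≤ , b≤) , (a≤′ , b≤′)) → ext-stable n n′ κ b b≤ b≤′
          (above-cong κ x≈x′ (ev-stable (suc n) (suc n′) a a≤ a≤′)))
        (dec⁺-≤ z le , dec⁺-≤ z le′))))

    -- Additivity is needed because a tree is grafted onto a whole sum over `star u a` at once.
    ext-∙ : ∀ n κ x x′ z → ext n κ (x ∙ x′) z ≈ ext n κ x z ∙ ext n κ x′ z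
    ext-cong : ∀ n κ {x x′} z → x ≈ x′ → ext n κ x z ≈ ext n κ x′ z
    ext-ε : ∀ n κ z → ext n κ ε z ≈ ε
    ext-cong zero    κ z eq = ≈-refl
    ext-cong (suc n) κ z eq = ∙-cong (op-cong κ eq ≈-refl)
      (⁻¹-cong (⨁-cong (dec⁺ z) (λ (a , b) → ext-cong n κ b (above-cong κ eq ≈-refl))))
    ext-∙ zero    κ x x′ z = ≈-sym (identityˡ ε)
    ext-∙ (suc n) κ x x′ z = begin
      op κ (x ∙ x′) e ∙ ⨁ (dec⁺ z) (term (x ∙ x′)) ⁻¹
        ≈⟨ ∙-cong (op-+ˡ κ x x′ e) (⁻¹-cong (≈-trans
             (⨁-cong (dec⁺ z) (λ (a , b) → ≈-trans (ext-cong n κ b (above-∙ˡ κ x x′ _)) (ext-∙ n κ _ _ b)))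
             (⨁-∙ (dec⁺ z) _ _))) ⟩
      (op κ x e ∙ op κ x′ e) ∙ (⨁ (dec⁺ z) (term x) ∙ ⨁ (dec⁺ z) (term x′)) ⁻¹
        ≈⟨ ∙-congˡ (≈-sym (⁻¹-∙-comm _ _)) ⟩
      (op κ x e ∙ op κ x′ e) ∙ (⨁ (dec⁺ z) (term x) ⁻¹ ∙ ⨁ (dec⁺ z) (term x′) ⁻¹)
        ≈⟨ interchange _ _ _ _ ⟩
      ext (suc n) κ x z ∙ ext (suc n) κ x′ z ∎
      where
      e = ev (suc n) z
      term : C → Tree m 0 × Tree m 0 → C
      term x (a , b) = ext n κ (above κ x (ev (suc n) a)) b
    ext-ε zero    κ z = ≈-refl
    ext-ε (suc n) κ z = begin
      op κ ε (ev (suc n) z) ∙ ⨁ (dec⁺ z) (λ (a , b) → ext n κ (above κ ε (ev (suc n) a)) b) ⁻¹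
        ≈⟨ ∙-cong (op-zeroˡ κ _) (⁻¹-cong (≈-trans
             (⨁-cong (dec⁺ z) (λ (a , b) → ≈-trans (ext-cong n κ b (above-zeroˡ κ _)) (ext-ε n κ b)))
             (⨁-ε (dec⁺ z)))) ⟩
      ε ∙ ε ⁻¹
        ≈⟨ inverseʳ ε ⟩
      ε ∎

    eval : ∀ {k} → Tree m k → C
    eval t = ev (size t) t

    graft : Fin (suc m) → C → Tree m 0 → C
    graft κ x z = ext (size z) κ x z

    graft-cong : ∀ κ {x x′} z → x ≈ x′ → graft κ x z ≈ graft κ x′ z
    graft-cong κ z = ext-cong (size z) κ z

    graft-⨁ : ∀ {a} {X : Set a} κ (L : List X) h z → graft κ (⨁ L h) z ≈ ⨁ L (λ x → graft κ (h x) z)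
    graft-⨁ κ L h z = ⨁-homo {φ = λ x → graft κ x z} (ext-ε (size z) κ z) (λ x x′ → ext-∙ (size z) κ x x′ z) L h

    eval-nothing : ∀ {k} (u : Tree m (suc k)) → eval (node u nothing) ≈ eval u
    eval-nothing u = ev-stable (size u + 0) (size u) u (ℕ.m≤m+n _ 0) ≤-refl

    eval-just : ∀ {k} (u : Tree m (suc k)) y → eval (node u (just y)) ≈ graft (slot u) (eval u) y
    eval-just u y = ≈-trans
      (ev-stable n (suc n) (node u (just y)) ≤-refl (ℕ.n≤1+n n))
      (ext-stable n (size y) (slot u) y (ℕ.m≤n+m _ _) ≤-refl
        (ev-stable (suc n) (size u) u (ℕ.m≤n⇒m≤1+n (ℕ.m≤m+n _ _)) ≤-refl))
      where n = size u + size y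

    -- For `x` the value of `u`, this is the value of the sum over `star u a`; see `star-act`.
    act : Fin (suc m) → C → Maybe (Tree m 0) → C
    act κ x nothing  = x
    act κ x (just y) = above κ x (eval y)

    graft-dec⁺ : ∀ κ x z → op κ x (eval z) ≈ graft κ x z ∙ ⨁ (dec⁺ z) (λ (a , b) → graft κ (above κ x (eval a)) b)
    graft-dec⁺ κ x z = ≈-sym (begin
      graft κ x z ∙ S
        ≈⟨ ∙-congʳ (ext-stable n (suc n) κ z ≤-refl (ℕ.n≤1+n n) ≈-refl) ⟩
      (op κ x (ev (suc n) z) ∙ ⨁ (dec⁺ z) (λ (a , b) → ext n κ (above κ x (ev (suc n) a)) b) ⁻¹) ∙ S
        ≈⟨ ∙-congʳ (∙-cong (op-cong κ ≈-refl (ev-stable (suc n) n z (ℕ.n≤1+n n) ≤-refl))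
             (⁻¹-cong (⨁-cong-All (All.map
               (λ {(a , b)} (a≤ , b≤) → ext-stable n (size b) κ b b≤ ≤-refl
                 (above-cong κ ≈-refl (ev-stable (suc n) (size a) a a≤ ≤-refl)))
               (dec⁺-≤ z (ℕ.n≤1+n n)))))) ⟩
      (op κ x (eval z) ∙ S ⁻¹) ∙ S
        ≈⟨ ≈-trans (assoc _ _ _) (≈-trans (∙-congˡ (inverseˡ S)) (identityʳ _)) ⟩
      op κ x (eval z) ∎)
      where
      n = size z
      S = ⨁ (dec⁺ z) (λ (a , b) → graft κ (above κ x (eval a)) b)

    graft-dec : ∀ κ x z → op κ x (eval z) ≈ ⨁ (dec z) (λ (a , b) → graft κ (act κ x a) b)
    graft-dec κ x z = ≈-trans (graft-dec⁺ κ x z) (≈-sym (⨁-dec z _))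

    -- Only operations `i ≥ k` are tested, as `mul` records no others. The map `h` is left open
    -- because the property serves `eval` as well as an arbitrary morphism in `Uniqueness`.
    Multiplicative : (∀ {k} → Tree m k → C) → ∀ {k} → Tree m k → Set _
    Multiplicative h {k} u = ∀ z i → k ≤ toℕ i →
      ⨁ (mul u z) (λ (j , X) → when (j ≡ᵇ toℕ i) (h X)) ≈ op i (h u) (h z)

    ⨁-by-tags : ∀ {k} (u : Tree m k) z (P : ℕ → Bool) (g : Tree m k → C) →
      ⨁ (mul u z) (λ (j , X) → when (P j) (g X)) ≈
      ⨁ I (λ i → when (P (toℕ i)) (⨁ (mul u z) (λ (j , X) → when (j ≡ᵇ toℕ i) (g X))))
    ⨁-by-tags u z P g = begin
      ⨁ (mul u z) (λ (j , X) → when (P j) (g X))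
        ≈⟨ ⨁-cong-All (All.map (λ {(j , X)} (_ , j≤m) → ≈-sym (⨁-δ-when (s≤s j≤m) P (g X))) (mul-tags u z)) ⟩
      ⨁ (mul u z) (λ (j , X) → ⨁ I (λ i → when (P (toℕ i)) (when (j ≡ᵇ toℕ i) (g X))))
        ≈⟨ ⨁-swap (mul u z) I _ ⟩
      ⨁ I (λ i → ⨁ (mul u z) (λ (j , X) → when (P (toℕ i)) (when (j ≡ᵇ toℕ i) (g X))))
        ≈⟨ ⨁-cong I (λ i → ≈-sym (when-⨁ (P (toℕ i)) (mul u z) _)) ⟩
      ⨁ I (λ i → when (P (toℕ i)) (⨁ (mul u z) (λ (j , X) → when (j ≡ᵇ toℕ i) (g X)))) ∎

    module _ (h : ∀ {k} → Tree m k → C) where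

      star-above : ∀ {k} (u : Tree m (suc k)) κ → toℕ κ ≡ k → Multiplicative h u → ∀ z →
                   ⨁ (star u (just z)) h ≈ above κ (h u) (h z)
      star-above u κ refl hu z = begin
        ⨁ (star u (just z)) h
          ≈⟨ ⨁-star u z h ⟩
        ⨁ (mul u z) (λ (j , X) → h X)
          ≈⟨ ⨁-cong-All (All.map (λ {(j , X)} (κ<j , _) → reflexive
               (cong (λ b → when b (h X)) (≡.sym (T⇒≡ (ℕ.<⇒<ᵇ κ<j))))) (mul-tags u z)) ⟩
        ⨁ (mul u z) (λ (j , X) → when (toℕ κ <ᵇ j) (h X))
          ≈⟨ ⨁-by-tags u z (toℕ κ <ᵇ_) h ⟩
        ⨁ I (λ i → when (toℕ κ <ᵇ toℕ i) (⨁ (mul u z) (λ (j , X) → when (j ≡ᵇ toℕ i) (h X))))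
          ≈⟨ ⨁-cong I (λ i → when-cong-T (toℕ κ <ᵇ toℕ i) (λ κ<i → hu z i (ℕ.<ᵇ⇒< (toℕ κ) (toℕ i) κ<i))) ⟩
        above κ (h u) (h z) ∎

      mul-below : ∀ κ (y z : Tree m 0) → Multiplicative h y →
        ⨁ (mul y z) (λ (j , Y) → when (j ≤ᵇ toℕ κ) (h Y)) ≈ below κ (h y) (h z)
      mul-below κ y z hy = ≈-trans (⨁-by-tags y z (_≤ᵇ toℕ κ) h)
        (⨁-cong I (λ i → when-cong (toℕ i ≤ᵇ toℕ κ) (hy z i z≤n)))

      star-total : ∀ (y z : Tree m 0) → Multiplicative h y → ⨁ (star y (just z)) h ≈ total (h y) (h z)
      star-total y z hy = ≈-trans (⨁-star y z h)
        (≈-trans (⨁-by-tags y z (λ _ → true) h) (⨁-cong I (λ i → hy z i z≤n)))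

    star-act : ∀ {k} (u : Tree m (suc k)) κ → toℕ κ ≡ k → Multiplicative eval u → ∀ a →
               ⨁ (star u a) eval ≈ act κ (eval u) a
    star-act u κ eq hu nothing  = identityʳ _
    star-act u κ eq hu (just z) = star-above eval u κ eq hu z

    -- The first two rules for values: max(κ, j) = i selects j = i if i > κ, and all j ≤ κ if i = κ.
    -- The element `x` varies since the induction replaces it by `above κ x (eval a)`.
    GraftMultiplicative : Fin (suc m) → Tree m 0 → Set _
    GraftMultiplicative κ y = ∀ x z i → toℕ κ ≤ toℕ i →
      ⨁ (mul y z) (λ (j , Y) → when (toℕ κ ⊔ j ≡ᵇ toℕ i) (graft κ x Y)) ≈ op i (graft κ x y) (eval z)

    -- Compute the sum of x *_κ (y *_j z) over all j with max(κ, j) = i twice. The third rule and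
    -- `dec-mul` give `S₁ ∙ S₂`; the identities of the algebra give (x *_κ y) *_i z and the same
    -- `S₂`. Expand x *_κ y by the third rule and `S₁` by the induction hypothesis: after cancelling
    -- `S`, the cuts with empty left part remain, and these are the claim.
    graft-multiplicative : ∀ κ y → Multiplicative eval y →
      All (λ (a , q) → GraftMultiplicative κ q) (dec⁺ y) → GraftMultiplicative κ y
    graft-multiplicative κ y hy hq x z i κ≤i = ∙-cancelʳ S _ _ (begin
      E ∙ S
        ≈⟨ ∙-congˡ (≈-sym (⨁-cong-All (All.map (λ {(a , q)} h → h (above κ x (eval a)) z i κ≤i) hq))) ⟩
      E ∙ ⨁ (dec⁺ y) (λ (a , q) → ⨁ (mul q z) (λ (j , Y) → when (W j) (graft κ (above κ x (eval a)) Y)))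
        ≈⟨ ≈-sym (⨁-dec y _) ⟩
      S₁
        ≈⟨ ∙-cancelʳ S₂ _ _ (≈-trans (≈-sym sums) (by-cases (ℕ.m≤n⇒m<n∨m≡n κ≤i))) ⟩
      op i (op κ x (eval y)) (eval z)
        ≈⟨ op-cong i (graft-dec⁺ κ x y) ≈-refl ⟩
      op i (graft κ x y ∙ ⨁ (dec⁺ y) (λ (a , q) → graft κ (above κ x (eval a)) q)) (eval z)
        ≈⟨ op-+ˡ i _ _ _ ⟩
      op i (graft κ x y) (eval z) ∙ op i (⨁ (dec⁺ y) (λ (a , q) → graft κ (above κ x (eval a)) q)) (eval z)
        ≈⟨ ∙-congˡ (op-⨁ˡ i (dec⁺ y) _ _) ⟩
      op i (graft κ x y) (eval z) ∙ S ∎)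
      where
      W : ℕ → Bool
      W j = toℕ κ ⊔ j ≡ᵇ toℕ i

      E  = ⨁ (mul y z) (λ (j , Y) → when (W j) (graft κ x Y))
      S  = ⨁ (dec⁺ y) (λ (a , q) → op i (graft κ (above κ x (eval a)) q) (eval z))
      S₁ = ⨁ (dec y) (λ (a , q) → ⨁ (mul q z) (λ (j , Y) → when (W j) (graft κ (act κ x a) Y)))
      S₂ = when (W 0) (op κ (above κ x (eval y)) (eval z))

      star-y : ∀ a → above κ x (⨁ (star y a) eval) ≈ act κ (above κ x (eval y)) a
      star-y nothing  = above-cong κ ≈-refl (identityʳ _)
      star-y (just b) = ≈-trans (above-cong κ ≈-refl (star-total eval y b hy)) (≈-sym (above-assoc κ x (eval y) (eval b)))

      -- For a cut inside `z`, operations above `κ` act with the product of `y` and `a`;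
      -- `above-assoc` lets `y` act first and `a` afterwards.
      second : ⨁ (dec z) (λ (a , b) → ⨁ (star y a) (λ X → when (W 0) (graft κ (above κ x (eval X)) b))) ≈ S₂
      second = begin
        ⨁ (dec z) (λ (a , b) → ⨁ (star y a) (λ X → when (W 0) (graft κ (above κ x (eval X)) b)))
          ≈⟨ ⨁-cong (dec z) (λ (a , b) → ≈-trans (≈-sym (when-⨁ (W 0) (star y a) _))
               (when-cong (W 0) (≈-trans (≈-sym (graft-⨁ κ (star y a) _ b))
                 (graft-cong κ b (≈-trans (≈-sym (above-⨁ʳ κ x (star y a) eval)) (star-y a)))))) ⟩
        ⨁ (dec z) (λ (a , b) → when (W 0) (graft κ (act κ (above κ x (eval y)) a) b))
          ≈⟨ ≈-sym (when-⨁ (W 0) (dec z) _) ⟩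
        when (W 0) (⨁ (dec z) (λ (a , b) → graft κ (act κ (above κ x (eval y)) a) b))
          ≈⟨ when-cong (W 0) (≈-sym (graft-dec κ (above κ x (eval y)) z)) ⟩
        S₂ ∎

      sums : ⨁ (mul y z) (λ (j , Y) → when (W j) (op κ x (eval Y))) ≈ S₁ ∙ S₂
      sums = begin
        ⨁ (mul y z) (λ (j , Y) → when (W j) (op κ x (eval Y)))
          ≈⟨ ⨁-cong (mul y z) (λ (j , Y) → ≈-trans (when-cong (W j) (graft-dec κ x Y)) (when-⨁ (W j) (dec Y) _)) ⟩
        ⨁ (mul y z) (λ (j , Y) → ⨁ (dec Y) (λ (a , b) → when (W j) (graft κ (act κ x a) b)))
          ≈⟨ dec-mul y z (λ j a b → when (W j) (graft κ (act κ x a) b)) ⟩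
        S₁ ∙ ⨁ (dec z) (λ (a , b) → ⨁ (star y a) (λ X → when (W 0) (graft κ (above κ x (eval X)) b)))
          ≈⟨ ∙-congˡ second ⟩
        S₁ ∙ S₂ ∎

      pull : ∀ (P : ℕ → Bool) → ⨁ (mul y z) (λ (j , Y) → when (P j) (op κ x (eval Y))) ≈
                                op κ x (⨁ (mul y z) (λ (j , Y) → when (P j) (eval Y)))
      pull P = ≈-sym (≈-trans (op-⨁ʳ κ x (mul y z) _)
        (⨁-cong (mul y z) (λ (j , Y) → when-homo {φ = op κ x} (op-zeroʳ κ x) (P j) _)))

      tags : ∀ {P : ℕ → Bool} → (∀ j → W j ≡ P j) →
        ⨁ (mul y z) (λ (j , Y) → when (W j) (op κ x (eval Y))) ≈
        op κ x (⨁ (mul y z) (λ (j , Y) → when (P j) (eval Y)))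
      tags {P} eq = ≈-trans (⨁-cong (mul y z) (λ (j , Y) → reflexive (cong (λ b → when b (op κ x (eval Y))) (eq j)))) (pull P)

      -- For `i > κ` the term `S₂` vanishes and associativity suffices; for `i = κ` it is the
      -- surplus in `op-below-above`.
      by-cases : toℕ κ < toℕ i ⊎ toℕ κ ≡ toℕ i →
        ⨁ (mul y z) (λ (j , Y) → when (W j) (op κ x (eval Y))) ≈ op i (op κ x (eval y)) (eval z) ∙ S₂
      by-cases (inj₁ κ<i) = begin
        ⨁ (mul y z) (λ (j , Y) → when (W j) (op κ x (eval Y)))
          ≈⟨ tags W-high ⟩
        op κ x (⨁ (mul y z) (λ (j , Y) → when (j ≡ᵇ toℕ i) (eval Y)))
          ≈⟨ op-cong κ ≈-refl (hy z i z≤n) ⟩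
        op κ x (op i (eval y) (eval z))
          ≈⟨ dyck-assoc κ i κ<i x (eval y) (eval z) ⟩
        op i (op κ x (eval y)) (eval z)
          ≈⟨ ≈-trans (≈-sym (identityʳ _)) (∙-congˡ (reflexive
               (cong (λ b → when b (op κ (above κ x (eval y)) (eval z))) (≡.sym W₀≡false)))) ⟩
        op i (op κ x (eval y)) (eval z) ∙ S₂ ∎
        where
        W₀≡false : W 0 ≡ false
        W₀≡false = ≢⇒≡ᵇ (λ eq → ℕ.<⇒≢ κ<i (≡.trans (≡.sym (ℕ.⊔-identityʳ (toℕ κ))) eq))

        W-high : ∀ j → W j ≡ (j ≡ᵇ toℕ i)
        W-high j = T-ext to from
          where
          to : T (W j) → T (j ≡ᵇ toℕ i)
          to t with ℕ.⊔-sel (toℕ κ) j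
          ... | inj₁ eq = ⊥-elim (ℕ.<⇒≢ κ<i (≡.trans (≡.sym eq) (ℕ.≡ᵇ⇒≡ _ _ t)))
          ... | inj₂ eq = ℕ.≡⇒≡ᵇ _ _ (≡.trans (≡.sym eq) (ℕ.≡ᵇ⇒≡ _ _ t))
          from : T (j ≡ᵇ toℕ i) → T (W j)
          from t with ℕ.≡ᵇ⇒≡ j (toℕ i) t
          ... | refl = ℕ.≡⇒≡ᵇ _ _ (ℕ.m≤n⇒m⊔n≡n (ℕ.<⇒≤ κ<i))
      by-cases (inj₂ κ≡i) with Fin.toℕ-injective κ≡i
      ... | refl = begin
        ⨁ (mul y z) (λ (j , Y) → when (W j) (op κ x (eval Y)))
          ≈⟨ tags W-low ⟩
        op κ x (⨁ (mul y z) (λ (j , Y) → when (j ≤ᵇ toℕ κ) (eval Y)))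
          ≈⟨ op-cong κ ≈-refl (mul-below eval κ y z hy) ⟩
        op κ x (below κ (eval y) (eval z))
          ≈⟨ op-below-above κ x (eval y) (eval z) ⟩
        op κ (op κ x (eval y)) (eval z) ∙ op κ (above κ x (eval y)) (eval z)
          ≈⟨ ∙-congˡ (reflexive (cong (λ b → when b (op κ (above κ x (eval y)) (eval z))) (≡.sym (W-low 0)))) ⟩
        op κ (op κ x (eval y)) (eval z) ∙ S₂ ∎
        where
        W-low : ∀ j → W j ≡ (j ≤ᵇ toℕ κ)
        W-low j = T-ext
          (λ t → ℕ.≤⇒≤ᵇ (≤-trans (ℕ.m≤n⊔m (toℕ κ) j) (ℕ.≤-reflexive (ℕ.≡ᵇ⇒≡ _ _ t))))
          (λ t → ℕ.≡⇒≡ᵇ _ _ (ℕ.m≥n⇒m⊔n≡m (ℕ.≤ᵇ⇒≤ j (toℕ κ) t)))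

    -- A filled slot lowers the bound `n`; an empty slot keeps it and shortens the tree. For an
    -- empty slot `k`, operations above `k` are inherited from `u`, and operation `k` is the third
    -- rule by which grafts were defined.
    eval-multiplicative  : ∀ n {k} (u : Tree m k) → size u ≤ n → Multiplicative eval u
    graft-multiplicative-all : ∀ n κ (y : Tree m 0) → size y ≤ n → GraftMultiplicative κ y
    graft-multiplicative-all zero    κ y y≤ = ⊥-elim (ℕ.<⇒≱ (size>0 y) y≤)
    graft-multiplicative-all (suc n) κ y y≤ = graft-multiplicative κ y (eval-multiplicative (suc n) y y≤)
      (All.map (λ {(a , q)} (_ , q≤) → graft-multiplicative-all n κ q q≤) (dec⁺-≤ y y≤))
    eval-multiplicative n root u≤ z i 1+m≤i = ⊥-elim (ℕ.<⇒≱ (Fin.toℕ<n i) 1+m≤i)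
    eval-multiplicative zero t@(node u (just y)) u≤ = ⊥-elim (ℕ.<⇒≱ (size>0 t) u≤)
    eval-multiplicative (suc n) {k} (node u (just y)) u≤ z i k≤i = begin
      ⨁ (mul (node u (just y)) z) (λ (j , X) → when (j ≡ᵇ toℕ i) (eval X))
        ≈⟨ ⨁-mul-just u y z _ ⟩
      ⨁ (mul y z) (λ (j , Y) → when (k ⊔ j ≡ᵇ toℕ i) (eval (node u (just Y))))
        ≈⟨ ⨁-cong (mul y z) (λ (j , Y) → ≈-trans (when-cong (k ⊔ j ≡ᵇ toℕ i) (eval-just u Y))
             (reflexive (cong (λ k → when (k ⊔ j ≡ᵇ toℕ i) (graft κ (eval u) Y)) (≡.sym κ≡k)))) ⟩
      ⨁ (mul y z) (λ (j , Y) → when (toℕ κ ⊔ j ≡ᵇ toℕ i) (graft κ (eval u) Y))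
        ≈⟨ graft-multiplicative-all n κ y (node-just-≤ u y u≤) (eval u) z i (subst (_≤ toℕ i) (≡.sym κ≡k) k≤i) ⟩
      op i (graft κ (eval u) y) (eval z)
        ≈⟨ op-cong i (≈-sym (eval-just u y)) ≈-refl ⟩
      op i (eval (node u (just y))) (eval z) ∎
      where
      κ   = slot u
      κ≡k = toℕ-slot u
    eval-multiplicative n {k} (node u nothing) u≤ z i k≤i = begin
      ⨁ (mul (node u nothing) z) (λ (j , X) → when (j ≡ᵇ toℕ i) (eval X))
        ≈⟨ ⨁-mul-nothing u z _ ⟩
      ⨁ (mul u z) (λ (j , X) → when (j ≡ᵇ toℕ i) (eval (node X nothing))) ∙
      ⨁ (dec z) (λ (a , b) → ⨁ (star u a) (λ X → when (k ≡ᵇ toℕ i) (eval (node X (just b)))))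
        ≈⟨ ∙-congʳ (⨁-cong (mul u z) (λ (j , X) → when-cong (j ≡ᵇ toℕ i) (eval-nothing X))) ⟩
      ⨁ (mul u z) (λ (j , X) → when (j ≡ᵇ toℕ i) (eval X)) ∙
      ⨁ (dec z) (λ (a , b) → ⨁ (star u a) (λ X → when (k ≡ᵇ toℕ i) (eval (node X (just b)))))
        ≈⟨ by-cases (ℕ.m≤n⇒m<n∨m≡n k≤i) ⟩
      op i (eval u) (eval z)
        ≈⟨ op-cong i (≈-sym (eval-nothing u)) ≈-refl ⟩
      op i (eval (node u nothing)) (eval z) ∎
      where
      hu : Multiplicative eval u
      hu = eval-multiplicative n u (≤-trans (ℕ.m≤m+n _ 0) u≤)

      by-cases : k < toℕ i ⊎ k ≡ toℕ i →
        ⨁ (mul u z) (λ (j , X) → when (j ≡ᵇ toℕ i) (eval X)) ∙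
        ⨁ (dec z) (λ (a , b) → ⨁ (star u a) (λ X → when (k ≡ᵇ toℕ i) (eval (node X (just b))))) ≈
        op i (eval u) (eval z)
      by-cases (inj₁ k<i) = begin
        _ ≈⟨ ∙-cong (hu z i k<i) (≈-trans
               (⨁-cong (dec z) (λ (a , b) → ≈-trans
                 (⨁-cong (star u a) (λ X → reflexive (cong (λ b′ → when b′ (eval (node X (just b)))) (≢⇒≡ᵇ (ℕ.<⇒≢ k<i)))))
                 (⨁-ε (star u a))))
               (⨁-ε (dec z))) ⟩
        op i (eval u) (eval z) ∙ ε
          ≈⟨ identityʳ _ ⟩
        op i (eval u) (eval z) ∎
      by-cases (inj₂ k≡i) = begin
        _ ≈⟨ ∙-cong (≈-trans
               (⨁-cong-All (All.map (λ {(j , X)} (k<j , _) → reflexive (cong (λ b → when b (eval X))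
                 (≢⇒≡ᵇ (λ j≡i → ℕ.<⇒≢ k<j (≡.trans k≡i (≡.sym j≡i)))))) (mul-tags u z)))
               (⨁-ε (mul u z)))
             (⨁-cong (dec z) (λ (a , b) → ⨁-cong (star u a) (λ X → reflexive
               (cong (λ b′ → when b′ (eval (node X (just b)))) (T⇒≡ (ℕ.≡⇒≡ᵇ k (toℕ i) k≡i)))))) ⟩
        ε ∙ ⨁ (dec z) (λ (a , b) → ⨁ (star u a) (λ X → eval (node X (just b))))
          ≈⟨ identityˡ _ ⟩
        ⨁ (dec z) (λ (a , b) → ⨁ (star u a) (λ X → eval (node X (just b))))
          ≈⟨ ⨁-cong (dec z) (λ (a , b) → ≈-trans
               (⨁-cong (star u a) (λ X → ≈-trans (eval-just X b)
                 (reflexive (cong (λ κ → graft κ (eval X) b) (slot-unique X i (≡.sym k≡i))))))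
               (≈-trans (≈-sym (graft-⨁ i (star u a) eval b))
                 (graft-cong i b (star-act u i (≡.sym k≡i) hu a)))) ⟩
        ⨁ (dec z) (λ (a , b) → graft i (act i (eval u) a) b)
          ≈⟨ ≈-sym (graft-dec i (eval u) z) ⟩
        op i (eval u) (eval z) ∎

    -- Uniqueness of the evaluation

    module Uniqueness (h : ∀ {k} → Tree m k → C)
      (h-root : h root ≈ d)
      (h-nothing : ∀ {k} (u : Tree m (suc k)) → h (node u nothing) ≈ h u)
      (h-mul : ∀ {k} (u : Tree m k) → Multiplicative h u) where

      -- The recursion of `ext` again: multiplying `node u nothing` by `y` with operation `κ` gives
      -- a sum over cuts of `y`, in which the terms with nonempty left part are known by induction,
      -- so the remaining one is forced. The tree `u` must vary because those terms sit on the trees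
      -- `X` of `star u (just a)`.
      h-just : ∀ n (y : Tree m 0) → size y ≤ n → (∀ (w : Tree m 0) → size w ≤ size y → h w ≈ eval w) →
               ∀ {k} (u : Tree m (suc k)) κ → toℕ κ ≡ k → h (node u (just y)) ≈ graft κ (h u) y
      h-just zero    y y≤ agree u κ eq = ⊥-elim (ℕ.<⇒≱ (size>0 y) y≤)
      h-just (suc n) y y≤ agree {k} u κ refl = ∙-cancelʳ S _ _ (begin
        h (node u (just y)) ∙ S
          ≈⟨ ∙-cong (≈-sym (identityʳ _)) (⨁-cong-All (All.zipWith (λ {(a , b)} → rest a b)
               (dec⁺-≤ y y≤ , dec⁺-size y))) ⟩
        (h (node u (just y)) ∙ ε) ∙ ⨁ (dec⁺ y) (λ (a , b) → ⨁ (star u (just a)) (λ X → h (node X (just b))))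
          ≈⟨ ≈-sym (⨁-dec y _) ⟩
        ⨁ (dec y) (λ (a , b) → ⨁ (star u a) (λ X → h (node X (just b))))
          ≈⟨ ≈-sym (≈-trans (∙-cong
               (≈-trans (⨁-cong-All (All.map (λ {(j , X)} (κ<j , _) → reflexive (cong (λ b → when b (h (node X nothing)))
                 (≢⇒≡ᵇ (λ j≡κ → ℕ.<⇒≢ κ<j (≡.sym j≡κ))))) (mul-tags u y))) (⨁-ε (mul u y)))
               (⨁-cong (dec y) (λ (a , b) → ⨁-cong (star u a) (λ X → reflexive
                 (cong (λ b′ → when b′ (h (node X (just b)))) (≡ᵇ-refl (toℕ κ)))))))
               (identityˡ _)) ⟩
        ⨁ (mul u y) (λ (j , X) → when (j ≡ᵇ toℕ κ) (h (node X nothing))) ∙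
        ⨁ (dec y) (λ (a , b) → ⨁ (star u a) (λ X → when (toℕ κ ≡ᵇ toℕ κ) (h (node X (just b)))))
          ≈⟨ ≈-sym (⨁-mul-nothing u y _) ⟩
        ⨁ (mul (node u nothing) y) (λ (j , X) → when (j ≡ᵇ toℕ κ) (h X))
          ≈⟨ h-mul (node u nothing) y κ ≤-refl ⟩
        op κ (h (node u nothing)) (h y)
          ≈⟨ op-cong κ (h-nothing u) (agree y ≤-refl) ⟩
        op κ (h u) (eval y)
          ≈⟨ graft-dec⁺ κ (h u) y ⟩
        graft κ (h u) y ∙ S ∎)
        where
        S = ⨁ (dec⁺ y) (λ (a , b) → graft κ (above κ (h u) (eval a)) b)

        rest : ∀ a b → (size a ≤ suc n × size b ≤ n) × (size a + size b ≡ size y) →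
               graft κ (above κ (h u) (eval a)) b ≈ ⨁ (star u (just a)) (λ X → h (node X (just b)))
        rest a b ((_ , b≤) , eq) = begin
          graft κ (above κ (h u) (eval a)) b
            ≈⟨ graft-cong κ b (above-cong κ ≈-refl (≈-sym (agree a (≤-trans (ℕ.m≤m+n _ _) (ℕ.≤-reflexive eq))))) ⟩
          graft κ (above κ (h u) (h a)) b
            ≈⟨ graft-cong κ b (≈-sym (star-above h u κ refl (h-mul u) a)) ⟩
          graft κ (⨁ (star u (just a)) h) b
            ≈⟨ graft-⨁ κ (star u (just a)) h b ⟩
          ⨁ (star u (just a)) (λ X → graft κ (h X) b)
            ≈⟨ ⨁-cong (star u (just a)) (λ X → ≈-sym (h-just n b b≤
                 (λ w w≤ → agree w (≤-trans w≤ (≤-trans (ℕ.m≤n+m _ (size a)) (ℕ.≤-reflexive eq)))) X κ refl)) ⟩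
          ⨁ (star u (just a)) (λ X → h (node X (just b))) ∎

      h≈eval : ∀ n {k} (t : Tree m k) → size t ≤ n → h t ≈ eval t
      h≈eval n root t≤ = h-root
      h≈eval n (node u nothing) t≤ = ≈-trans (h-nothing u)
        (≈-trans (h≈eval n u (≤-trans (ℕ.m≤m+n _ 0) t≤)) (≈-sym (eval-nothing u)))
      h≈eval zero    t@(node u (just y)) t≤ = ⊥-elim (ℕ.<⇒≱ (size>0 t) t≤)
      h≈eval (suc n) (node u (just y)) t≤ = ≈-trans
        (h-just (size y) y ≤-refl (λ w w≤ → h≈eval n w (≤-trans w≤ (node-just-≤ u y t≤))) u (slot u) (toℕ-slot u))
        (≈-trans (graft-cong (slot u) y (h≈eval (suc n) u (≤-trans (ℕ.m≤m+n _ _) t≤))) (≈-sym (eval-just u y)))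

    -- No path receives the default `ε` by a failure of parsing: every path is the word of a tree,
    -- and `parse-word` reads it back.
    fromWord : Word → C
    fromWord P = maybe′ eval ε (parse {m} [] P)

    fromWord-word : ∀ (z : Tree m 0) → fromWord (word z) ≈ eval z
    fromWord-word z = reflexive (cong (maybe′ eval ε) (parse-word z))

  -- From trees back to paths: existence and uniqueness of the morphism

  module _ (1≤m : 1 ≤ m) where
    open PathSums commutativeMonoid m 1≤m

    ⨁-mult-foldr : ∀ i (p q : Tree m 0) (g : Word → C) →
      DyckAlgebra.∑ A (map g (mult m i (word p) (word q))) ≈
      ⨁ (mul p q) (λ (j , X) → when (j ≡ᵇ i) (g (word X)))
    ⨁-mult-foldr i p q g = ≈-trans (⨁-foldr (mult m i (word p) (word q)) g) (⨁-mult i p q g)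

    fromWord-morphism : ∀ d → IsDyckMorphism A (fromWord d)
    fromWord-morphism d i P Q P-dyck Q-dyck with dyck⇒word P P-dyck | dyck⇒word Q Q-dyck
    ... | p , refl | q , refl = begin
      DyckAlgebra.∑ A (map (fromWord d) (mult m (toℕ i) (word p) (word q)))
        ≈⟨ ⨁-mult-foldr (toℕ i) p q (fromWord d) ⟩
      ⨁ (mul p q) (λ (j , X) → when (j ≡ᵇ toℕ i) (fromWord d (word X)))
        ≈⟨ ⨁-cong (mul p q) (λ (j , X) → when-cong (j ≡ᵇ toℕ i) (fromWord-word d X)) ⟩
      ⨁ (mul p q) (λ (j , X) → when (j ≡ᵇ toℕ i) (eval d X))
        ≈⟨ eval-multiplicative d (size p) p ≤-refl q i z≤n ⟩
      op i (eval d p) (eval d q)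
        ≈⟨ ≈-sym (op-cong i (fromWord-word d p) (fromWord-word d q)) ⟩
      op i (fromWord d (word p)) (fromWord d (word q)) ∎

    complete : ∀ {k} → Tree m k → Tree m 0
    complete {zero}  u = u
    complete {suc k} u = complete (node u nothing)

    -- Products with `i ≥ k` leave the slots below `k` empty, so they commute with completion; the
    -- extra terms after completion all have tags below `k`.
    mul-complete : ∀ {k} (u : Tree m k) z i → k ≤ i → (g : Tree m 0 → C) →
      ⨁ (mul (complete u) z) (λ (j , X) → when (j ≡ᵇ i) (g X)) ≈
      ⨁ (mul u z) (λ (j , X) → when (j ≡ᵇ i) (g (complete X)))
    mul-complete {zero}  u z i k≤i g = ≈-refl
    mul-complete {suc k} u z i k<i g = begin
      ⨁ (mul (complete (node u nothing)) z) (λ (j , X) → when (j ≡ᵇ i) (g X))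
        ≈⟨ mul-complete (node u nothing) z i (ℕ.<⇒≤ k<i) g ⟩
      ⨁ (mul (node u nothing) z) (λ (j , X) → when (j ≡ᵇ i) (g (complete X)))
        ≈⟨ ⨁-mul-nothing u z _ ⟩
      ⨁ (mul u z) (λ (j , X) → when (j ≡ᵇ i) (g (complete X))) ∙
      ⨁ (dec z) (λ (a , b) → ⨁ (star u a) (λ X → when (k ≡ᵇ i) (g (complete (node X (just b))))))
        ≈⟨ ∙-congˡ (≈-trans (⨁-cong (dec z) (λ (a , b) → ≈-trans (⨁-cong (star u a) (λ X → reflexive
             (cong (λ b′ → when b′ (g (complete (node X (just b))))) (≢⇒≡ᵇ (ℕ.<⇒≢ k<i))))) (⨁-ε (star u a)))) (⨁-ε (dec z))) ⟩
      ⨁ (mul u z) (λ (j , X) → when (j ≡ᵇ i) (g (complete X))) ∙ ε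
        ≈⟨ identityʳ _ ⟩
      ⨁ (mul u z) (λ (j , X) → when (j ≡ᵇ i) (g (complete X))) ∎

    word-complete : ∀ {k} (u : Tree m (suc k)) c → word (complete (node u c)) ≡ word (node u c) ++ replicate k D
    word-complete {zero}  u c = ≡.sym (++-identityʳ _)
    word-complete {suc k} u c = ≡.trans (word-complete (node u c) nothing)
      (≡.trans (cong (_++ replicate k D) (++-identityʳ _)) (++-assoc (word (node u c)) (D ∷ []) _))

    morphism-unique : ∀ d (g : Word → C) → g (ρ m) ≈ d → IsDyckMorphism A g →
                      ∀ P → T (IsDyck m P) → g P ≈ fromWord d P
    morphism-unique d g g-ρ g-mor P P-dyck with dyck⇒word P P-dyck
    ... | p , refl = ≈-trans (h≈eval (size p) p ≤-refl) (≈-sym (fromWord-word d p))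
      where
      -- A map on paths is extended to partial trees by leaving the remaining slots empty; passing
      -- an empty slot then changes nothing by definition.
      open Uniqueness d (λ u → g (word (complete u)))
        (≈-trans (reflexive (cong g (word-complete root nothing))) g-ρ)
        (λ u → ≈-refl)
        (λ u z i k≤i → ≈-trans
          (≈-sym (mul-complete u z (toℕ i) k≤i (λ X → g (word X))))
          (≈-trans (≈-sym (⨁-mult-foldr (toℕ i) (complete u) z g))
            (g-mor i (word (complete u)) (word z) (word-isDyck (complete u)) (word-isDyck z))))

    fromWord-ρ : ∀ d → fromWord d (ρ m) ≈ d
    fromWord-ρ d = ≈-trans (reflexive (cong (fromWord d) (≡.sym (word-complete root nothing))))
      (≈-trans (fromWord-word d (complete (node root nothing))) (eval-complete (node root nothing)))
      where
      eval-complete : ∀ {k} (u : Tree m k) → eval d (complete u) ≈ eval d u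
      eval-complete {zero}  u = ≈-refl
      eval-complete {suc k} u = ≈-trans (eval-complete (node u nothing)) (eval-nothing d u)

theorem5p11 : ∀ {c ℓ c' ℓ'} (K : Field c ℓ) (m : ℕ) → 1 ≤ m →
    KDyckIdentities K m
    ×
    ((D : DyckAlgebra K m c' ℓ') (d : Module.Carrierᴹ (DyckAlgebra.vectorSpace D)) →
    Σ (List Step → Module.Carrierᴹ (DyckAlgebra.vectorSpace D)) λ f →
    Module._≈ᴹ_ (DyckAlgebra.vectorSpace D) (f (ρ m)) d
    × IsDyckMorphism D f
    × ((g : List Step → Module.Carrierᴹ (DyckAlgebra.vectorSpace D)) →
    Module._≈ᴹ_ (DyckAlgebra.vectorSpace D) (g (ρ m)) d →
    IsDyckMorphism D g →
    (P : List Step) → T (IsDyck m P) →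
    Module._≈ᴹ_ (DyckAlgebra.vectorSpace D) (g P) (f P)))
theorem5p11 K m 1≤m = paths-identities K m 1≤m , λ A d →
  let open Evaluation A in
  fromWord d , fromWord-ρ 1≤m d , fromWord-morphism 1≤m d , morphism-unique 1≤m d
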